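{- For every partition $\lambda$ with at most $n$ parts, $$U_{\lambda,(1^n)}(q)=q^{\,n-|\lambda|}\,X_{\lambda,(1^n)}(q).$$
   Context: Fix $n\ge1$, $(1^n)=(1,\dots,1)$, $\rho_n=(n,\dots,1)$, $|\beta|=\sum\beta_i$, $x^\beta=\prod x_i^{\beta_i}$; $S_n$ permutes coordinates, $l(\sigma)$ = number of inversions. $F_q(\beta)$ is the coefficient of $x^\beta$ in $\prod_{1\le i<j\le n}(1-qx_i/x_j)^{ -1}\prod_{1\le r\le s\le n}(1-\frac{q}{x_rx_s})^{ -1}$, and $U_{\lambda,\mu}(q)=\sum_{\sigma\in S_n}(-1)^{l(\sigma)}F_q(\sigma(\lambda+\rho_n)-\mu-\rho_n)$. One dimension sum for $\mu=(1^n)$: let $\mathcal{C}_n$ be the ordered alphabet $1<\cdots<n<\bar n<\cdots<\bar1$ with $\mathrm{wt}(k)=\varepsilon_k$, $\mathrm{wt}(\bar k)=-\varepsilon_k$. $E_\lambda$ is the set of words $x_1\otimes\cdots\otimes x_n$ over $\mathcal{C}_n$ such that each partial sum $w_i=\sum_{j\le i}\mathrm{wt}(x_j)$ ($1\le i\le n$) is a partition and $w_n=\lambda$ (the highest weight vertices of weight $\lambda$ in the $U_q(\mathfrak{sp}_{2n})$-crystal $B(\Lambda_1)^{\otimes n}$, Kashiwara's convention). With $H(x\otimes y)=1$ if $x\ge y$ and $0$ otherwise, $X_{\lambda,(1^n)}(q)=\sum_{b\in E_\lambda}q^{\sum_{i=1}^{n-1}(n-i)H(x_i\otimes x_{i+1})}$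 (the $C_n^{(1)}$ one dimension sum of Hatayama–Kuniba–Okado–Takagi specialized to $\mu=(1^n)$). -}

module Defs where

open import Data.Fin.Base as Fin using (Fin; toℕ)
import Data.Fin.Properties as Fin
open import Data.Fin.Permutation as Perm using (Permutation′; _⟨$⟩ʳ_; _⟨$⟩ˡ_)
open import Data.Integer.Base as ℤ using (ℤ; +_; -[1+_]; 0ℤ; 1ℤ; -1ℤ)
import Data.Integer.Properties as ℤ
open import Data.List.Base as List using (List; []; _∷_; _++_)
open import Data.Nat.Base as ℕ using (ℕ; zero; suc)
open import Data.Product.Base using (_×_; _,_)
open import Data.Vec.Base as Vec using (Vec; []; _∷_)
import Data.Vec.Properties as Vec
open import Data.Vec.Relation.Unary.All as All using (All)
open import Data.Vec.Relation.Unary.Linked as Linked using (Linked)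
open import Relation.Binary.Definitions using (DecidableEquality)
open import Relation.Binary.PropositionalEquality
open import Relation.Nullary.Decidable
  using (Dec; yes; no; map′; does; _×-dec_)
open import Data.Bool.Base using (if_then_else_)

private
  variable
    n k : ℕ
    A : Set

-- f d is the coefficient of q^d.  Only sums, integer multiples and monomial
-- multiples are formed, so no support condition is imposed.
Laurent : Set
Laurent = ℤ → ℤ

infix 4 _≈_
_≈_ : Laurent → Laurent → Set
f ≈ g = ∀ d → f d ≡ g d

q^_ : ℤ → Laurent
(q^ e) d = if does (e ℤ.≟ d) then 1ℤ else 0ℤ

infixr 7 _·_ q^_⊛_
_·_ : ℤ → Laurent → Laurent
(c · f) d = c ℤ.* f d

q^_⊛_ : ℤ → Laurent → Laurent
(q^ e ⊛ f) d = f (d ℤ.- e)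

∑ : List A → (A → Laurent) → Laurent
∑ xs f d = List.foldr (λ x s → f x d ℤ.+ s) 0ℤ xs

-- β ∈ ℤⁿ, also used for the monomial x^β.
Weight : ℕ → Set
Weight n = Vec ℤ n

infixl 6 _⊕_ _⊖_
_⊕_ _⊖_ : Weight n → Weight n → Weight n
_⊕_ = Vec.zipWith ℤ._+_
_⊖_ = Vec.zipWith ℤ._-_

𝟘 𝟙 : ∀ n → Weight n
𝟘 n = Vec.replicate n 0ℤ
𝟙 n = Vec.replicate n 1ℤ

_≟ʷ_ : DecidableEquality (Weight n)
_≟ʷ_ = Vec.≡-dec ℤ._≟_

ε : Fin n → Weight n
ε {n} i = 𝟘 n Vec.[ i ]≔ 1ℤ

∣_∣ʷ : Weight n → ℤ
∣ β ∣ʷ = Vec.foldr′ ℤ._+_ 0ℤ β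

ρ : ∀ n → Weight n
ρ zero    = []
ρ (suc n) = + suc n ∷ ρ n

-- Partitions with at most n parts, padded with zeros.
IsPartition : Weight n → Set
IsPartition β = Linked ℤ._≥_ β × All (0ℤ ℤ.≤_) β

isPartition? : (β : Weight n) → Dec (IsPartition β)
isPartition? β = Linked.linked? (λ a b → b ℤ.≤? a) β ×-dec All.all? (0ℤ ℤ.≤?_) β

-- A permutation σ of Fin (suc n) is given by i = σ⁻¹(0) together with the
-- bijection it induces between the remaining points, so every element of
-- Sₙ is listed exactly once.
permutations : ∀ n → List (Permutation′ n)
permutations zero    = Perm.id ∷ []
permutations (suc n) =
  List.cartesianProductWith (λ i π → Perm.insert i Fin.zero π)
    (List.allFin (suc n)) (permutations n)

pairs : ∀ n → List (Fin n × Fin n)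
pairs n = List.cartesianProduct (List.allFin n) (List.allFin n)

inversions : Permutation′ n → ℕ
inversions {n} σ = List.length (List.filter inversion? (pairs n))
  where
  inversion? : ((i , j) : Fin n × Fin n) →
               Dec (i Fin.< j × (σ ⟨$⟩ʳ j) Fin.< (σ ⟨$⟩ʳ i))
  inversion? (i , j) = (i Fin.<? j) ×-dec ((σ ⟨$⟩ʳ j) Fin.<? (σ ⟨$⟩ʳ i))

-- Left action: (σβ)ᵢ = β_{σ⁻¹(i)}, equivalently σ εᵢ = ε_{σ(i)}.
infixr 8 _▷_
_▷_ : Permutation′ n → Weight n → Weight n
σ ▷ β = Vec.tabulate λ i → Vec.lookup β (σ ⟨$⟩ˡ i)

-- Elements of ℤ[x₁^±,…,xₙ^±][[q]]: f m β is the coefficient of q^m x^β.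
-- Each 1 - q x^α is invertible in this ring, so the product defining F_q
-- makes sense here without any further choice of an expansion region.
Series : ℕ → Set
Series n = ℕ → Weight n → ℤ

one : Series n
one         (suc m) β = 0ℤ
one {n = n} zero    β = if does (β ≟ʷ 𝟘 n) then 1ℤ else 0ℤ

infixr 7 [1-qx^_]*_ [1-qx^_]⁻¹*_
[1-qx^_]*_ : Weight n → Series n → Series n
([1-qx^ α ]* f) zero    β = f zero β
([1-qx^ α ]* f) (suc m) β = f (suc m) β ℤ.- f m (β ⊖ α)

-- The unique solution g of g = f + q x^α g; see *-⁻¹-cancel.
[1-qx^_]⁻¹*_ : Weight n → Series n → Series n
([1-qx^ α ]⁻¹* f) zero    β = f zero β
([1-qx^ α ]⁻¹* f) (suc m) β = f (suc m) β ℤ.+ ([1-qx^ α ]⁻¹* f) m (β ⊖ α)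

*-⁻¹-cancel : ∀ (α : Weight n) f m β →
              ([1-qx^ α ]* [1-qx^ α ]⁻¹* f) m β ≡ f m β
*-⁻¹-cancel α f zero    β = refl
*-⁻¹-cancel α f (suc m) β = begin
  (a ℤ.+ b) ℤ.- b    ≡⟨ ℤ.+-assoc a b (ℤ.- b) ⟩
  a ℤ.+ (b ℤ.- b)    ≡⟨ cong (λ t → a ℤ.+ t) (ℤ.+-inverseʳ b) ⟩
  a ℤ.+ 0ℤ           ≡⟨ ℤ.+-identityʳ a ⟩
  a                  ∎
  where
  open ≡-Reasoning
  a = f (suc m) β
  b = ([1-qx^ α ]⁻¹* f) m (β ⊖ α)

-- Exponents of x_i/x_j for i < j, and of 1/(x_r x_s) for r ≤ s.
roots : ∀ n → List (Weight n)
roots n =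
     List.map (λ (i , j) → ε i ⊖ ε j)
       (List.filter (λ (i , j) → i Fin.<? j) (pairs n))
  ++ List.map (λ (r , s) → 𝟘 n ⊖ (ε r ⊕ ε s))
       (List.filter (λ (r , s) → r Fin.≤? s) (pairs n))

generating : ∀ n → Series n
generating n = List.foldr [1-qx^_]⁻¹*_ one (roots n)

F : Weight n → Laurent
F β (+ m)    = generating _ m β
F β -[1+ m ] = 0ℤ

U : Weight n → Weight n → Laurent
U {n} κ μ = ∑ (permutations n) λ σ →
  (-1ℤ ℤ.^ inversions σ) · F (σ ▷ (κ ⊕ ρ n) ⊖ μ ⊖ ρ n)

data Letter (n : ℕ) : Set where
  unbarred barred : Fin n → Letter n

-- 1 < ⋯ < n < n̄ < ⋯ < 1̄
infix 4 _≤ᶜ_ _≤ᶜ?_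
data _≤ᶜ_ {n : ℕ} : Letter n → Letter n → Set where
  u≤u : ∀ {i j} → i Fin.≤ j → unbarred i ≤ᶜ unbarred j
  u≤b : ∀ {i j} → unbarred i ≤ᶜ barred j
  b≤b : ∀ {i j} → j Fin.≤ i → barred i ≤ᶜ barred j

_≤ᶜ?_ : (x y : Letter n) → Dec (x ≤ᶜ y)
unbarred i ≤ᶜ? unbarred j = map′ u≤u (λ { (u≤u p) → p }) (i Fin.≤? j)
unbarred i ≤ᶜ? barred j   = yes u≤b
barred i   ≤ᶜ? unbarred j = no λ ()
barred i   ≤ᶜ? barred j   = map′ b≤b (λ { (b≤b p) → p }) (j Fin.≤? i)

wt : Letter n → Weight n
wt     (unbarred i) = ε i
wt {n} (barred i)   = 𝟘 n ⊖ ε i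

alphabet : ∀ n → List (Letter n)
alphabet n = List.map unbarred (List.allFin n)
          ++ List.map barred (List.reverse (List.allFin n))

words : List A → ∀ k → List (Vec A k)
words as zero    = [] ∷ []
words as (suc k) = List.cartesianProductWith _∷_ as (words as k)

partialSums : Weight n → Vec (Letter n) k → Vec (Weight n) k
partialSums v []      = []
partialSums v (x ∷ w) = v ⊕ wt x ∷ partialSums (v ⊕ wt x) w

-- Prepending the empty sum makes "last" total, also for the empty word.
HighestWeight : Weight n → Vec (Letter n) k → Set
HighestWeight {n} κ w =
  All IsPartition (partialSums (𝟘 n) w) ×
  Vec.last (𝟘 n ∷ partialSums (𝟘 n) w) ≡ κ

highestWeight? : (κ : Weight n) (w : Vec (Letter n) k) →
                 Dec (HighestWeight κ w)
highestWeight? κ w = All.all? isPartition? _ ×-dec (_ ≟ʷ κ)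

E : Weight n → List (Vec (Letter n) n)
E {n} κ = List.filter (highestWeight? κ) (words (alphabet n) n)

H : Letter n → Letter n → ℕ
H x y = if does (y ≤ᶜ? x) then 1 else 0

-- The factor n - i of H(xᵢ ⊗ xᵢ₊₁) is the number of letters to the right
-- of xᵢ.
energy : Vec (Letter n) k → ℕ
energy []                          = 0
energy (x ∷ [])                    = 0
energy (_∷_ {suc l} x w@(y ∷ _)) = suc l ℕ.* H x y ℕ.+ energy w

X : Weight n → Laurent
X κ = ∑ (E κ) λ b → q^ (+ energy b)

{-# OPTIONS --safe #-}
module Submission where

-- Let E(x) = ∏_{k≥0} (1 + q^k x) = Σ e_r x^r, D(λ + ρ) = det (e_{λᵢ-i+j})
-- and C′(z) = ∏_{i≤j} 1/(1 - z² q^{i+j}).  Then, up to the common factor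
-- (1-q)⋯(1-qⁿ), X_λ is the coefficient of z^{n-∣λ∣} in C′(z) times D(λ + ρ),
-- and U_λ is the coefficient of z^{n-∣λ∣} in C(z) = C′(qz) times D(λ + ρ).
--
-- For U, expanding the alternating sum along x₁ reduces rank n + 1 to rank n.
-- As D is an eigenvector of ∏ⱼ (1 + u/xⱼ), the factors ∏ⱼ 1/(1 - q x₁/xⱼ) and
-- ∏ⱼ 1/(1 - q/(x₁xⱼ)) act on it as the scalars E(q x₁) and E(q/x₁), and the
-- sum over x₁ is evaluated by column operations based on E(x) = (1+x) E(qx).
--
-- For X, cut a highest weight word into increasing words.  An increasing word
-- adds a vertical strip and then removes one.  On functions that alternate
-- under the hyperoctahedral group the dominance condition may be dropped, so
-- these operators T_r commute and are self-adjoint; hence the walks from 0 to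
-- λ may be replaced by walks from λ to 0, for which the recursion
-- (1 - qˡ) ℓ_l = Σ_{r≥1} q^{l-r} T_r ℓ_{l-r} is solved by C′ and D.

open import Algebra.Bundles using (CommutativeRing)
import Algebra.Properties.CommutativeSemigroup as CommutativeSemigroup
import Algebra.Solver.Ring
open import Algebra.Solver.Ring.AlmostCommutativeRing using (AlmostCommutativeRing; fromCommutativeRing; _-Raw-AlmostCommutative⟶_)
open import Algebra.Structures using (IsCommutativeRing)
open import Data.Integer.Base as ℤ using (ℤ; +_; -[1+_]; 0ℤ; 1ℤ; -1ℤ)
import Data.Integer.Properties as ℤ
import Data.Integer.Solver
open import Data.Maybe.Base using (Maybe; just; nothing)
open import Data.Nat.Base as ℕ using (ℕ; zero; suc; z≤n; s≤s; _≥_)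
import Data.Nat.Properties as ℕ
open import Data.Product.Base using (_×_; _,_; proj₁; proj₂; ∃)
open import Function.Base using (_∘_; id)
open import Level using (0ℓ)
open import Relation.Binary.PropositionalEquality using (_≡_; refl; sym; trans; cong; cong₂; subst; module ≡-Reasoning; _≢_; subst₂)
open import Relation.Nullary.Decidable using (yes; no; Dec; does; dec-true; dec-false; _×-dec_)

-- D(λ + ρ) is the Schur function of the conjugate of λ at 1, q, q², .... The eigenvector property
-- is then the Pieri rule, and E(x) = (1+x) E(qx) is the splitting off of the variable 1.
--
-- The Pieri rule needs room: a vertical strip added to λ may spill below row n, so the eigenvalue
-- equation holds only for strips with at most as many boxes as λ has zero parts. This is where μ =
-- (1^n) matters: the coefficient of degree n - |λ| involves only strips of at most n - |λ| boxes,
-- and these fit. Hence the weights carry the cutoff `θ`, and generating functions are handled as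
-- coefficient sequences on ℤ that vanish at negative indices.
--
-- C′(z) is Littlewood's product ∏_{i ≤ j} 1/(1 - z² xᵢxⱼ) at xᵢ = q^i. Its factors with i = 0
-- multiply to 1/E(-z²), so C′(z) E(-z²) = C′(qz), which determines C′.
--
-- Several identities would require inverting an operator or an expansion without end. They are
-- proved by uniqueness instead: a difference that is q times a combination of differences of the
-- same kind is divisible by every power of q.

-- Formal power series in q

module PowerSeries where
  module IntSolver = Data.Integer.Solver.+-*-Solver
  open IntSolver public using () renaming (_:+_ to _⊞_; _:*_ to _⊠_; _:-_ to _⊟_; :-_ to ⊝_; _:=_ to _⊜_)

  +ℤ-cancelʳ : ∀ x y z → x ℤ.+ z ≡ y ℤ.+ z → x ≡ y
  +ℤ-cancelʳ x y z p = trans (lemma x) (trans (cong (λ w → w ℤ.- z) p) (sym (lemma y)))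
    where
    lemma : ∀ x → x ≡ x ℤ.+ z ℤ.- z
    lemma x = IntSolver.solve 2 (λ x z → x ⊜ x ⊞ z ⊟ z) refl x z

  -- Course-of-values recursion: hist l r is the value at l ∸ r, with the
  -- junk value d for r > l.
  hist : {A : Set} → A → A → (ℕ → (ℕ → A) → A) → ℕ → ℕ → A
  hist a d s zero    zero    = a
  hist a d s zero    (suc r) = d
  hist a d s (suc l) zero    = s l (hist a d s l)
  hist a d s (suc l) (suc r) = hist a d s l r

  hist-≤ : ∀ {A : Set} (a d : A) s l r → r ℕ.≤ l →
           hist a d s l r ≡ hist a d s (l ℕ.∸ r) 0
  hist-≤ a d s l       zero    _       = refl
  hist-≤ a d s (suc l) (suc r) (s≤s p) = hist-≤ a d s l r p

  hist-> : ∀ {A : Set} (a d : A) s l r → l ℕ.< r → hist a d s l r ≡ d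
  hist-> a d s zero    (suc r) _       = refl
  hist-> a d s (suc l) (suc r) (s≤s p) = hist-> a d s l r p

  PS : Set
  PS = ℕ → ℤ


  open ≡-Reasoning

  infix 4 _≃_
  -- Opaque outside this block: series are handled as elements of a commutative ring, and single
  -- coefficients are reached only through the lemmas exported here.
  abstract
    _≃_ : PS → PS → Set
    f ≃ g = ∀ d → f d ≡ g d

    ≃⇒≡ : ∀ {f g} → f ≃ g → ∀ d → f d ≡ g d
    ≃⇒≡ p = p

    ≡⇒≃ : ∀ {f g} → (∀ d → f d ≡ g d) → f ≃ g
    ≡⇒≃ p = p

    add mul : PS → PS → PS
    add f g d = f d ℤ.+ g d
    mul f g zero    = f 0 ℤ.* g 0
    mul f g (suc n) = f 0 ℤ.* g (suc n) ℤ.+ mul (f ∘ suc) g n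

    neg : PS → PS
    neg f d = ℤ.- f d

    const : ℤ → PS
    const c zero    = c
    const c (suc d) = 0ℤ

    add-coeff : ∀ f g d → add f g d ≡ f d ℤ.+ g d
    add-coeff f g d = refl

    neg-coeff : ∀ f d → neg f d ≡ ℤ.- f d
    neg-coeff f d = refl

    const-head : ∀ c → const c 0 ≡ c
    const-head c = refl

    const-tail : ∀ c d → const c (suc d) ≡ 0ℤ
    const-tail c d = refl

    const-zero : ∀ d → const 0ℤ d ≡ 0ℤ
    const-zero zero    = refl
    const-zero (suc d) = refl

    private
      mul-cong : ∀ {f f′ g g′} → f ≃ f′ → g ≃ g′ → mul f g ≃ mul f′ g′
      mul-cong p r zero    = cong₂ ℤ._*_ (p 0) (r 0)
      mul-cong p r (suc n) = cong₂ ℤ._+_ (cong₂ ℤ._*_ (p 0) (r (suc n))) (mul-cong (p ∘ suc) r n)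

      mul-addˡ : ∀ f g h → mul (add f g) h ≃ add (mul f h) (mul g h)
      mul-addˡ f g h zero    = ℤ.*-distribʳ-+ (h 0) (f 0) (g 0)
      mul-addˡ f g h (suc n) = begin
        (f 0 ℤ.+ g 0) ℤ.* h (suc n) ℤ.+ mul (add (f ∘ suc) (g ∘ suc)) h n
          ≡⟨ cong (λ x → ((f 0 ℤ.+ g 0) ℤ.* h (suc n)) ℤ.+ x) (mul-addˡ (f ∘ suc) (g ∘ suc) h n) ⟩
        (f 0 ℤ.+ g 0) ℤ.* h (suc n) ℤ.+ (mul (f ∘ suc) h n ℤ.+ mul (g ∘ suc) h n)
          ≡⟨ IntSolver.solve 5 (λ a b c x y → (a ⊞ b) ⊠ c ⊞ (x ⊞ y) ⊜ (a ⊠ c ⊞ x) ⊞ (b ⊠ c ⊞ y)) refl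
               (f 0) (g 0) (h (suc n)) (mul (f ∘ suc) h n) (mul (g ∘ suc) h n) ⟩
        mul f h (suc n) ℤ.+ mul g h (suc n) ∎

      mul-scale : ∀ c f g n → mul (λ d → c ℤ.* f d) g n ≡ c ℤ.* mul f g n
      mul-scale c f g zero    = ℤ.*-assoc c (f 0) (g 0)
      mul-scale c f g (suc n) = begin
        c ℤ.* f 0 ℤ.* g (suc n) ℤ.+ mul (λ d → c ℤ.* f (suc d)) g n
          ≡⟨ cong₂ ℤ._+_ (ℤ.*-assoc c (f 0) _) (mul-scale c (f ∘ suc) g n) ⟩
        c ℤ.* (f 0 ℤ.* g (suc n)) ℤ.+ c ℤ.* mul (f ∘ suc) g n
          ≡⟨ ℤ.*-distribˡ-+ c _ _ ⟨
        c ℤ.* mul f g (suc n) ∎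

      mul-sucʳ : ∀ f g n → mul f g (suc n) ≡ mul f (g ∘ suc) n ℤ.+ f (suc n) ℤ.* g 0
      mul-sucʳ f g zero    = refl
      mul-sucʳ f g (suc n) =
        trans (cong (λ x → (f 0 ℤ.* g (suc (suc n))) ℤ.+ x) (mul-sucʳ (f ∘ suc) g n))
              (sym (ℤ.+-assoc (f 0 ℤ.* g (suc (suc n))) _ _))

      mul-comm : ∀ f g → mul f g ≃ mul g f
      mul-comm f g zero    = ℤ.*-comm (f 0) (g 0)
      mul-comm f g (suc n) = begin
        f 0 ℤ.* g (suc n) ℤ.+ mul (f ∘ suc) g n
          ≡⟨ cong₂ ℤ._+_ (ℤ.*-comm (f 0) _) (mul-comm (f ∘ suc) g n) ⟩
        g (suc n) ℤ.* f 0 ℤ.+ mul g (f ∘ suc) n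
          ≡⟨ ℤ.+-comm (g (suc n) ℤ.* f 0) _ ⟩
        mul g (f ∘ suc) n ℤ.+ g (suc n) ℤ.* f 0
          ≡⟨ mul-sucʳ g f n ⟨
        mul g f (suc n) ∎

      mul-assoc : ∀ f g h → mul (mul f g) h ≃ mul f (mul g h)
      mul-assoc f g h zero    = ℤ.*-assoc (f 0) (g 0) (h 0)
      mul-assoc f g h (suc n) = begin
        f 0 ℤ.* g 0 ℤ.* h (suc n) ℤ.+ mul (add (λ d → f 0 ℤ.* g (suc d)) (mul (f ∘ suc) g)) h n
          ≡⟨ cong (λ x → (f 0 ℤ.* g 0 ℤ.* h (suc n)) ℤ.+ x) (mul-addˡ (λ d → f 0 ℤ.* g (suc d)) (mul (f ∘ suc) g) h n) ⟩
        f 0 ℤ.* g 0 ℤ.* h (suc n) ℤ.+ (mul (λ d → f 0 ℤ.* g (suc d)) h n ℤ.+ mul (mul (f ∘ suc) g) h n)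
          ≡⟨ cong (λ x → (f 0 ℤ.* g 0 ℤ.* h (suc n)) ℤ.+ x)
               (cong₂ ℤ._+_ (mul-scale (f 0) (g ∘ suc) h n) (mul-assoc (f ∘ suc) g h n)) ⟩
        f 0 ℤ.* g 0 ℤ.* h (suc n) ℤ.+ (f 0 ℤ.* mul (g ∘ suc) h n ℤ.+ mul (f ∘ suc) (mul g h) n)
          ≡⟨ IntSolver.solve 5 (λ a b c x y → a ⊠ b ⊠ c ⊞ (a ⊠ x ⊞ y) ⊜ a ⊠ (b ⊠ c ⊞ x) ⊞ y) refl
               (f 0) (g 0) (h (suc n)) (mul (g ∘ suc) h n) (mul (f ∘ suc) (mul g h) n) ⟩
        f 0 ℤ.* mul g h (suc n) ℤ.+ mul (f ∘ suc) (mul g h) n ∎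

      mul-zeroˡ : ∀ f n → mul (λ _ → 0ℤ) f n ≡ 0ℤ
      mul-zeroˡ f zero    = refl
      mul-zeroˡ f (suc n) = trans (ℤ.+-identityˡ _) (mul-zeroˡ f n)

      mul-const : ∀ c f n → mul (const c) f n ≡ c ℤ.* f n
      mul-const c f zero    = refl
      mul-const c f (suc n) = trans (cong (λ x → (c ℤ.* f (suc n)) ℤ.+ x) (mul-zeroˡ f n)) (ℤ.+-identityʳ _)

      mul-identityˡ : ∀ f → mul (const 1ℤ) f ≃ f
      mul-identityˡ f n = trans (mul-const 1ℤ f n) (ℤ.*-identityˡ (f n))

    isCommutativeRing : IsCommutativeRing _≃_ add mul neg (const 0ℤ) (const 1ℤ)
    isCommutativeRing = record
      { isRing = record
        { +-isAbelianGroup = record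
          { isGroup = record
            { isMonoid = record
              { isSemigroup = record
                { isMagma = record
                  { isEquivalence = record
                    { refl = λ _ → refl ; sym = λ p d → sym (p d) ; trans = λ p r d → trans (p d) (r d) }
                  ; ∙-cong = λ p r d → cong₂ ℤ._+_ (p d) (r d) }
                ; assoc = λ f g h d → ℤ.+-assoc (f d) (g d) (h d) }
              ; identity = (λ { f zero → ℤ.+-identityˡ (f 0) ; f (suc d) → ℤ.+-identityˡ _ })
                         , (λ { f zero → ℤ.+-identityʳ (f 0) ; f (suc d) → ℤ.+-identityʳ _ }) }
            ; inverse = (λ { f zero → ℤ.+-inverseˡ (f 0) ; f (suc d) → ℤ.+-inverseˡ (f (suc d)) })
                      , (λ { f zero → ℤ.+-inverseʳ (f 0) ; f (suc d) → ℤ.+-inverseʳ (f (suc d)) })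
            ; ⁻¹-cong = λ p d → cong ℤ.-_ (p d) }
          ; comm = λ f g d → ℤ.+-comm (f d) (g d) }
        ; *-cong = mul-cong
        ; *-assoc = mul-assoc
        ; *-identity = mul-identityˡ , λ f d → trans (mul-comm f (const 1ℤ) d) (mul-identityˡ f d)
        ; distrib = (λ f g h d → trans (mul-comm f (add g h) d)
                                (trans (mul-addˡ g h f d)
                                       (cong₂ ℤ._+_ (mul-comm g f d) (mul-comm h f d))))
                  , (λ f g h → mul-addˡ g h f) }
      ; *-comm = mul-comm }

    q : PS
    q zero    = 0ℤ
    q (suc d) = const 1ℤ d

    q*-zero : ∀ f → mul q f 0 ≡ 0ℤ
    q*-zero f = refl

    q*-suc : ∀ f d → mul q f (suc d) ≡ f d
    q*-suc f d = trans (ℤ.+-identityˡ _) (mul-identityˡ f d)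

    private
      dot : ℕ → (ℕ → ℤ) → (ℕ → ℤ) → ℤ
      dot zero    f g = f 0 ℤ.* g 0
      dot (suc n) f g = f 0 ℤ.* g 0 ℤ.+ dot n (f ∘ suc) (g ∘ suc)

      mul-dot : ∀ f g h n → (∀ r → r ℕ.≤ n → h r ≡ g (n ℕ.∸ r)) → dot n f h ≡ mul f g n
      mul-dot f g h zero    p = cong (f 0 ℤ.*_) (p 0 z≤n)
      mul-dot f g h (suc n) p = cong₂ ℤ._+_ (cong (f 0 ℤ.*_) (p 0 z≤n))
                                            (mul-dot (f ∘ suc) g (h ∘ suc) n λ r r≤n → p (suc r) (s≤s r≤n))

    -- The inverse g of 1 - q f, from g = 1 + q f g.
    geometric : PS → PS
    geometric f l = hist 1ℤ 0ℤ (λ l h → dot l f h) l 0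

    geometric-unfold : ∀ f → geometric f ≃ add (const 1ℤ) (mul q (mul f (geometric f)))
    geometric-unfold f zero    = refl
    geometric-unfold f (suc d) = begin
      dot d f (hist 1ℤ 0ℤ step d)
        ≡⟨ mul-dot f (geometric f) (hist 1ℤ 0ℤ step d) d (hist-≤ 1ℤ 0ℤ step d) ⟩
      mul f (geometric f) d
        ≡⟨ q*-suc (mul f (geometric f)) d ⟨
      mul q (mul f (geometric f)) (suc d)
        ≡⟨ ℤ.+-identityˡ (mul q (mul f (geometric f)) (suc d)) ⟨
      add (const 1ℤ) (mul q (mul f (geometric f))) (suc d) ∎
      where
      step : ℕ → (ℕ → ℤ) → ℤ
      step l h = dot l f h

    const-+ : ∀ a b → const (a ℤ.+ b) ≃ add (const a) (const b)
    const-+ a b zero    = refl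
    const-+ a b (suc d) = refl

    const-* : ∀ a b → const (a ℤ.* b) ≃ mul (const a) (const b)
    const-* a b zero    = refl
    const-* a b (suc d) = sym (trans (mul-const a (const b) (suc d)) (ℤ.*-zeroʳ a))

    const-neg : ∀ a → const (ℤ.- a) ≃ neg (const a)
    const-neg a zero    = refl
    const-neg a (suc d) = refl

    const-cong : ∀ {a b} → a ≡ b → const a ≃ const b
    const-cong refl _ = refl

  ℤ[[q]] : CommutativeRing 0ℓ 0ℓ
  ℤ[[q]] = record { isCommutativeRing = isCommutativeRing }

  const-morphism : CommutativeRing.rawRing ℤ.+-*-commutativeRing
                     -Raw-AlmostCommutative⟶ fromCommutativeRing ℤ[[q]]
  const-morphism = record
    { ⟦_⟧    = const
    ; +-homo = const-+
    ; *-homo = const-*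
    ; -‿homo = const-neg
    ; 0-homo = const-cong refl
    ; 1-homo = const-cong refl }

  coefficient-dec : ∀ a b → Maybe (const a ≃ const b)
  coefficient-dec a b with a ℤ.≟ b
  ... | yes a≡b = just (const-cong a≡b)
  ... | no  _   = nothing

open PowerSeries
open CommutativeRing ℤ[[q]] using (0#; 1#; _+_; _*_; -_; _-_; setoid; ring; +-cong; +-congˡ; +-congʳ; *-cong; *-congˡ; *-congʳ; -‿cong; +-identityˡ; +-identityʳ; *-identityˡ; *-identityʳ; zeroˡ; zeroʳ; +-comm; +-assoc; *-comm; *-assoc; distribˡ; distribʳ; -‿inverseʳ; -‿inverseˡ) renaming (refl to ≃-refl; sym to ≃-sym; trans to ≃-trans; reflexive to ≃-reflexive)
open Algebra.Solver.Ring (CommutativeRing.rawRing ℤ.+-*-commutativeRing) (fromCommutativeRing ℤ[[q]]) const-morphism coefficient-dec using (solve; _:=_; _:+_; _:*_; :-_; _:-_; con)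


open CommutativeSemigroup (CommutativeRing.*-commutativeSemigroup ℤ[[q]]) using (x∙yz≈y∙xz)
open CommutativeSemigroup (CommutativeRing.+-commutativeSemigroup ℤ[[q]]) using () renaming (interchange to +-interchange)

annihilateˡ : ∀ {x y} → x ≃ 0# → x * y ≃ 0#
annihilateˡ p = ≃-trans (*-congʳ p) (zeroˡ _)

annihilateʳ : ∀ {x y} → y ≃ 0# → x * y ≃ 0#
annihilateʳ p = ≃-trans (*-congˡ p) (zeroʳ _)

geometric-inverse : ∀ f → (1# - q * f) * geometric f ≃ 1#
geometric-inverse f =
  ≃-trans (solve 3 (λ q f g → (con 1ℤ :- q :* f) :* g := g :- q :* (f :* g)) ≃-refl q f g)
  (≃-trans (+-congʳ (geometric-unfold f))
           (solve 1 (λ x → con 1ℤ :+ x :- x := con 1ℤ) ≃-refl (q * (f * g))))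
  where g = geometric f

private
  variable
    n : ℕ

open import Data.Sum.Base using (_⊎_; inj₁; inj₂)
open import Data.Vec.Base as Vec using (Vec; []; _∷_)
open import Data.Vec.Relation.Unary.Any as Any using (Any; here; there)
open import Relation.Binary.Reasoning.Setoid setoid

-- Alternating sums

-- Laplace expansion along the first column: the chosen entry moves to the front with the sign of
-- its position, and the others keep their order.
pick : Vec ℤ (suc n) → (ℤ → Vec ℤ n → PS) → PS
pick {zero}  (b ∷ bs) k = k b bs
pick {suc n} (b ∷ bs) k = k b bs - pick bs (λ c γ → k c (b ∷ γ))

data Picks : Vec ℤ (suc n) → ℤ → Vec ℤ n → Set where
  here  : ∀ {b} {bs : Vec ℤ n} → Picks (b ∷ bs) b bs
  there : ∀ {b c} {bs : Vec ℤ (suc n)} {γ} → Picks bs c γ → Picks (b ∷ bs) c (b ∷ γ)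

pick-cong∈ : ∀ (β : Vec ℤ (suc n)) {k k′} → (∀ c γ → Picks β c γ → k c γ ≃ k′ c γ) →
             pick β k ≃ pick β k′
pick-cong∈ {zero}  (b ∷ bs) p = p b bs here
pick-cong∈ {suc n} (b ∷ bs) p =
  +-cong (p b bs here) (-‿cong (pick-cong∈ bs λ c γ x → p c (b ∷ γ) (there x)))

pick-cong : ∀ (β : Vec ℤ (suc n)) {k k′} → (∀ c γ → k c γ ≃ k′ c γ) → pick β k ≃ pick β k′
pick-cong β p = pick-cong∈ β λ c γ _ → p c γ

pick-+ : ∀ (β : Vec ℤ (suc n)) k k′ → pick β (λ c γ → k c γ + k′ c γ) ≃ pick β k + pick β k′
pick-+ {zero}  (b ∷ bs) k k′ = ≃-refl
pick-+ {suc n} (b ∷ bs) k k′ = ≃-trans (+-congˡ (-‿cong (pick-+ bs _ _)))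
  (solve 4 (λ x y u v → x :+ y :- (u :+ v) := x :- u :+ (y :- v)) ≃-refl (k b bs) (k′ b bs) _ _)

pick-* : ∀ (β : Vec ℤ (suc n)) x k → pick β (λ c γ → x * k c γ) ≃ x * pick β k
pick-* {zero}  (b ∷ bs) x k = ≃-refl
pick-* {suc n} (b ∷ bs) x k = ≃-trans (+-congˡ (-‿cong (pick-* bs x _)))
  (solve 3 (λ x y u → x :* y :- x :* u := x :* (y :- u)) ≃-refl x (k b bs) _)

pick-neg : ∀ (β : Vec ℤ (suc n)) k → pick β (λ c γ → - k c γ) ≃ - pick β k
pick-neg {zero}  (b ∷ bs) k = ≃-refl
pick-neg {suc n} (b ∷ bs) k = ≃-trans (+-congˡ (-‿cong (pick-neg bs _)))
  (solve 2 (λ y u → :- y :- :- u := :- (y :- u)) ≃-refl (k b bs) _)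

pick-zero : ∀ (β : Vec ℤ (suc n)) {k} → (∀ c γ → Picks β c γ → k c γ ≃ 0#) → pick β k ≃ 0#
pick-zero {zero}  (b ∷ bs) p = p b bs here
pick-zero {suc n} (b ∷ bs) p =
  ≃-trans (+-cong (p b bs here) (-‿cong (pick-zero bs λ c γ x → p c (b ∷ γ) (there x))))
          (-‿inverseʳ 0#)

private
  pick-pick-unfold : ∀ b (bs : Vec ℤ (suc (suc n))) (Ψ : ℤ → ℤ → Vec ℤ (suc n) → PS) →
    pick (b ∷ bs) (λ c γ → pick γ (Ψ c)) ≃
    pick bs (Ψ b) - (pick bs (λ c γ → Ψ c b γ)
                     - pick bs (λ c γ → pick γ (λ d δ → Ψ c d (b ∷ δ))))
  pick-pick-unfold b bs Ψ = +-congˡ (-‿cong (≃-trans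
    (pick-+ bs (λ c γ → Ψ c b γ) _) (+-congˡ (pick-neg bs _))))

pick-pick-flip : ∀ (β : Vec ℤ (suc (suc n))) (Ψ : ℤ → ℤ → Vec ℤ n → PS) →
  pick β (λ b γ → pick γ (λ c δ → Ψ b c δ)) ≃ - pick β (λ b γ → pick γ (λ c δ → Ψ c b δ))
pick-pick-flip {zero} (b ∷ c ∷ []) Ψ =
  solve 2 (λ x y → x :- y := :- (y :- x)) ≃-refl (Ψ b c []) (Ψ c b [])
pick-pick-flip {suc n} (b ∷ bs) Ψ = begin
  _ ≈⟨ pick-pick-unfold b bs Ψ ⟩
  x - (y - pick bs (λ c γ → pick γ (λ d δ → Ψ c d (b ∷ δ))))
    ≈⟨ +-congˡ (-‿cong (+-congˡ (-‿cong (pick-pick-flip bs (λ c d δ → Ψ c d (b ∷ δ)))))) ⟩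
  x - (y - - z)
    ≈⟨ solve 3 (λ x y z → x :- (y :- :- z) := :- (y :- (x :- z))) ≃-refl x y z ⟩
  - (y - (x - z))
    ≈⟨ -‿cong (pick-pick-unfold b bs (λ c d → Ψ d c)) ⟨
  _ ∎
  where
  x = pick bs (Ψ b)
  y = pick bs (λ c γ → Ψ c b γ)
  z = pick bs (λ c γ → pick γ (λ d δ → Ψ d c (b ∷ δ)))

-- `pick-pick-flip` would only yield x = -x, leaving a division by 2. So the two orders in which a
-- pair of entries can be chosen are cancelled against each other directly.
pick-pick-symmetric : ∀ (β : Vec ℤ (suc (suc n))) (Ψ : ℤ → ℤ → Vec ℤ n → PS) → (∀ b c δ → Ψ b c δ ≃ Ψ c b δ) →
  pick β (λ b γ → pick γ (λ c δ → Ψ b c δ)) ≃ 0#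
pick-pick-symmetric {zero} (b ∷ c ∷ []) Ψ p = ≃-trans (+-congʳ (p b c [])) (-‿inverseʳ _)
pick-pick-symmetric {suc n} (b ∷ bs) Ψ p = begin
  _ ≈⟨ pick-pick-unfold b bs Ψ ⟩
  x - (y - pick bs (λ c γ → pick γ (λ d δ → Ψ c d (b ∷ δ))))
    ≈⟨ +-cong (pick-cong bs (p b)) (-‿cong (+-congˡ (-‿cong
         (pick-pick-symmetric bs _ λ c d δ → p c d (b ∷ δ))))) ⟩
  y - (y - 0#)
    ≈⟨ solve 1 (λ y → y :- (y :- con 0ℤ) := con 0ℤ) ≃-refl y ⟩
  0# ∎
  where
  x = pick bs (Ψ b)
  y = pick bs (λ c γ → Ψ c b γ)

-- The signed sum of Φ over all rearrangements of β, with repetition if β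
-- has equal entries.
alt : Vec ℤ n → (Vec ℤ n → PS) → PS
alt {zero}  β Φ = Φ []
alt {suc n} β Φ = pick β (λ c γ → alt γ (λ δ → Φ (c ∷ δ)))

alt-cong : ∀ (β : Vec ℤ n) Φ Φ′ → (∀ γ → Φ γ ≃ Φ′ γ) → alt β Φ ≃ alt β Φ′
alt-cong {zero}  β Φ Φ′ p = p []
alt-cong {suc n} β Φ Φ′ p = pick-cong β λ c γ → alt-cong γ _ _ λ δ → p (c ∷ δ)

alt-+ : ∀ (β : Vec ℤ n) Φ Φ′ → alt β (λ γ → Φ γ + Φ′ γ) ≃ alt β Φ + alt β Φ′
alt-+ {zero}  β Φ Φ′ = ≃-refl
alt-+ {suc n} β Φ Φ′ = ≃-trans (pick-cong β λ c γ → alt-+ γ _ _) (pick-+ β _ _)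

alt-* : ∀ (β : Vec ℤ n) x Φ → alt β (λ γ → x * Φ γ) ≃ x * alt β Φ
alt-* {zero}  β x Φ = ≃-refl
alt-* {suc n} β x Φ = ≃-trans (pick-cong β λ c γ → alt-* γ x _) (pick-* β x _)

flip₂ : (Vec ℤ (suc (suc n)) → PS) → Vec ℤ (suc (suc n)) → PS
flip₂ Φ (b ∷ c ∷ γ) = Φ (c ∷ b ∷ γ)

alt-flip : ∀ (β : Vec ℤ (suc (suc n))) Φ → alt β Φ ≃ - alt β (flip₂ Φ)
alt-flip β Φ = pick-pick-flip β λ b c δ → alt δ λ γ → Φ (b ∷ c ∷ γ)

alt-symmetric : ∀ (β : Vec ℤ (suc (suc n))) Φ → (∀ b c γ → Φ (b ∷ c ∷ γ) ≃ Φ (c ∷ b ∷ γ)) →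
  alt β Φ ≃ 0#
alt-symmetric β Φ p = pick-pick-symmetric β _ λ b c δ → alt-cong δ _ _ (p b c)

sum : Vec ℤ n → ℤ
sum = Vec.foldr′ ℤ._+_ 0ℤ

Picks-sum : ∀ {β : Vec ℤ (suc n)} {c γ} → Picks β c γ → sum β ≡ c ℤ.+ sum γ
Picks-sum here = refl
Picks-sum {c = c} {γ = b ∷ γ} (there x) = trans (cong (λ z → b ℤ.+ z) (Picks-sum x))
  (trans (sym (ℤ.+-assoc b c _)) (trans (cong (λ z → z ℤ.+ sum γ) (ℤ.+-comm b c)) (ℤ.+-assoc c b _)))

alt-cong-sum : ∀ (β : Vec ℤ n) Φ Φ′ → (∀ γ → sum γ ≡ sum β → Φ γ ≃ Φ′ γ) → alt β Φ ≃ alt β Φ′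
alt-cong-sum {zero}  [] Φ Φ′ p = p [] refl
alt-cong-sum {suc n} β  Φ Φ′ p = pick-cong∈ β λ c γ x → alt-cong-sum γ _ _ λ δ s →
  p (c ∷ δ) (trans (cong (λ z → c ℤ.+ z) s) (sym (Picks-sum x)))

data AdjEq : Vec ℤ n → Set where
  here  : ∀ {a} {γ : Vec ℤ n} → AdjEq (a ∷ a ∷ γ)
  there : ∀ {a} {γ : Vec ℤ n} → AdjEq γ → AdjEq (a ∷ γ)

pick-AdjEq : ∀ {β : Vec ℤ (suc n)} {k} → AdjEq β → (∀ c γ → AdjEq γ → k c γ ≃ 0#) → pick β k ≃ 0#
pick-AdjEq {zero} {b ∷ []} (there ())
pick-AdjEq {suc zero} here p = -‿inverseʳ _
pick-AdjEq {suc (suc n)} {a ∷ a ∷ γ} {k} here p = ≃-trans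
  (+-congˡ (-‿cong (+-congˡ (-‿cong (pick-zero γ λ c δ _ → p c (a ∷ a ∷ δ) here)))))
  (solve 1 (λ x → x :- (x :- con 0ℤ) := con 0ℤ) ≃-refl (k a (a ∷ γ)))
pick-AdjEq {suc n} {a ∷ γ} (there x) p = ≃-trans
  (+-cong (p a γ x) (-‿cong (pick-AdjEq x λ c δ y → p c (a ∷ δ) (there y)))) (-‿inverseʳ 0#)

alt-AdjEq : ∀ {β : Vec ℤ n} Φ → AdjEq β → alt β Φ ≃ 0#
alt-AdjEq {suc n} Φ x = pick-AdjEq x λ c γ y → alt-AdjEq (λ δ → Φ (c ∷ δ)) y

data Swap : Vec ℤ n → Vec ℤ n → Set where
  here  : ∀ {a b} {γ : Vec ℤ n} → Swap (a ∷ b ∷ γ) (b ∷ a ∷ γ)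
  there : ∀ {a} {γ δ : Vec ℤ n} → Swap γ δ → Swap (a ∷ γ) (a ∷ δ)

pick-Swap : ∀ {β β′ : Vec ℤ (suc n)} {k} → Swap β β′ →
  (∀ c γ γ′ → Swap γ γ′ → k c γ ≃ - k c γ′) → pick β k ≃ - pick β′ k
pick-Swap {zero} (there ())
pick-Swap {suc zero} {a ∷ b ∷ []} {k = k} here p =
  solve 2 (λ x y → x :- y := :- (y :- x)) ≃-refl (k a (b ∷ [])) (k b (a ∷ []))
pick-Swap {suc (suc n)} {a ∷ b ∷ γ} {k = k} here p = ≃-trans
  (+-congˡ (-‿cong (+-congˡ (-‿cong (≃-trans
     (pick-cong γ λ c δ → p c (a ∷ b ∷ δ) (b ∷ a ∷ δ) here) (pick-neg γ _))))))
  (solve 3 (λ x y z → x :- (y :- :- z) := :- (y :- (x :- z))) ≃-refl (k a (b ∷ γ)) (k b (a ∷ γ)) _)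
pick-Swap {suc n} {a ∷ γ} {.a ∷ γ′} {k = k} (there x) p = ≃-trans
  (+-cong (p a γ γ′ x) (-‿cong (pick-Swap x λ c δ δ′ y → p c (a ∷ δ) (a ∷ δ′) (there y))))
  (solve 2 (λ x y → :- x :- :- y := :- (x :- y)) ≃-refl (k a γ′) _)

alt-Swap : ∀ {β β′ : Vec ℤ n} Φ → Swap β β′ → alt β Φ ≃ - alt β′ Φ
alt-Swap {suc n} Φ x = pick-Swap x λ c γ γ′ y → alt-Swap (λ δ → Φ (c ∷ δ)) y

HasZero : Vec ℤ n → Set
HasZero = Any (_≡ 0ℤ)

Picks-HasZero : ∀ {β : Vec ℤ (suc n)} {c γ} → Picks β c γ → HasZero β → c ≡ 0ℤ ⊎ HasZero γ
Picks-HasZero here      (here z)  = inj₁ z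
Picks-HasZero here      (there z) = inj₂ z
Picks-HasZero (there x) (here z)  = inj₂ (here z)
Picks-HasZero (there x) (there z) with Picks-HasZero x z
... | inj₁ y = inj₁ y
... | inj₂ y = inj₂ (there y)

alt-HasZero : ∀ {β : Vec ℤ n} Φ → HasZero β → (∀ γ → HasZero γ → Φ γ ≃ 0#) → alt β Φ ≃ 0#
alt-zero : ∀ (β : Vec ℤ n) Φ → (∀ γ → Φ γ ≃ 0#) → alt β Φ ≃ 0#
alt-zero {zero}  β Φ p = p []
alt-zero {suc n} β Φ p = pick-zero β λ c γ _ → alt-zero γ _ λ δ → p (c ∷ δ)
alt-HasZero {suc n} {β} Φ z p = pick-zero β λ c γ x → case c γ (Picks-HasZero x z)
  where
  case : ∀ c γ → c ≡ 0ℤ ⊎ HasZero γ → alt γ (λ δ → Φ (c ∷ δ)) ≃ 0#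
  case c γ (inj₁ y) = alt-zero γ _ λ δ → p (c ∷ δ) (here y)
  case c γ (inj₂ y) = alt-HasZero (λ δ → Φ (c ∷ δ)) y λ δ w → p (c ∷ δ) (there w)

-- Sums over subsets of the coordinates

Family : ℕ → Set
Family n = ℕ → Vec ℤ n → PS

-- es s F r β is the sum over all subsets I of F (r + ∣I∣) (β + s εᴵ).
es : ℤ → Family n → Family n
es s F r []      = F r []
es s F r (b ∷ β) = es s (λ r γ → F r (b ∷ γ)) r β + es s (λ r γ → F (suc r) (b ℤ.+ s ∷ γ)) r β

data Shifted (s : ℤ) : ℕ → Vec ℤ n → ℕ → Vec ℤ n → Set where
  []   : ∀ {r} → Shifted s r [] r []
  keep : ∀ {r r′ b} {β γ : Vec ℤ n} → Shifted s r β r′ γ → Shifted s r (b ∷ β) r′ (b ∷ γ)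
  step : ∀ {r r′ b} {β γ : Vec ℤ n} → Shifted s (suc r) β r′ γ → Shifted s r (b ∷ β) r′ (b ℤ.+ s ∷ γ)

es-suc : ∀ s (F : Family n) r β → es s (λ r → F (suc r)) r β ≃ es s F (suc r) β
es-suc s F r []      = ≃-refl
es-suc s F r (b ∷ β) = +-cong (es-suc s _ r β) (es-suc s _ r β)

private
  es-suc∈ : ∀ {s} {F F′ : Family n} r β → es s F (suc r) β ≃ es s F′ (suc r) β →
            es s (λ r → F (suc r)) r β ≃ es s (λ r → F′ (suc r)) r β
  es-suc∈ r β p = ≃-trans (es-suc _ _ r β) (≃-trans p (≃-sym (es-suc _ _ r β)))

es-cong∈ : ∀ s {F F′ : Family n} r β → (∀ r′ γ → Shifted s r β r′ γ → F r′ γ ≃ F′ r′ γ) →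
           es s F r β ≃ es s F′ r β
es-cong∈ s r []      p = p r [] []
es-cong∈ s r (b ∷ β) p = +-cong
  (es-cong∈ s r β λ r′ γ x → p r′ (b ∷ γ) (keep x))
  (es-suc∈ r β (es-cong∈ s (suc r) β λ r′ γ x → p r′ (b ℤ.+ s ∷ γ) (step x)))

Shifted-≤ : ∀ {s r r′} {β γ : Vec ℤ n} → Shifted s r β r′ γ → r ℕ.≤ r′
Shifted-≤ []       = ℕ.≤-refl
Shifted-≤ (keep x) = Shifted-≤ x
Shifted-≤ (step x) = ℕ.<⇒≤ (Shifted-≤ x)

Shifted-sum : ∀ {r r′} {β γ : Vec ℤ n} → Shifted 1ℤ r β r′ γ → sum γ ℤ.+ + r ≡ sum β ℤ.+ + r′
Shifted-sum [] = refl
Shifted-sum {r = r} {r′} {b ∷ β} {_ ∷ γ} (keep x) = trans (ℤ.+-assoc b (sum γ) (+ r))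
  (trans (cong (λ z → b ℤ.+ z) (Shifted-sum x)) (sym (ℤ.+-assoc b (sum β) (+ r′))))
Shifted-sum {r = r} {r′} {b ∷ β} {_ ∷ γ} (step x) = trans
  (IntSolver.solve 3 (λ b γ r → b ⊞ IntSolver.con 1ℤ ⊞ γ ⊞ r ⊜ b ⊞ (γ ⊞ (IntSolver.con 1ℤ ⊞ r))) refl b (sum γ) (+ r))
  (trans (cong (λ z → b ℤ.+ z) (Shifted-sum x)) (sym (ℤ.+-assoc b (sum β) (+ r′))))

es-cong : ∀ s {F F′ : Family n} r β → (∀ r γ → F r γ ≃ F′ r γ) → es s F r β ≃ es s F′ r β
es-cong s r β p = es-cong∈ s r β λ r′ γ _ → p r′ γ

es-+ : ∀ s (F F′ : Family n) r β → es s (λ r γ → F r γ + F′ r γ) r β ≃ es s F r β + es s F′ r β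
es-+ s F F′ r []      = ≃-refl
es-+ s F F′ r (b ∷ β) = ≃-trans (+-cong (es-+ s _ _ r β) (es-+ s _ _ r β))
  (+-interchange _ _ _ _)

es-* : ∀ s x (F : Family n) r β → es s (λ r γ → x * F r γ) r β ≃ x * es s F r β
es-* s x F r []      = ≃-refl
es-* s x F r (b ∷ β) = ≃-trans (+-cong (es-* s x _ r β) (es-* s x _ r β)) (≃-sym (distribˡ x _ _))

es-neg : ∀ s (F : Family n) r β → es s (λ r γ → - F r γ) r β ≃ - es s F r β
es-neg s F r []      = ≃-refl
es-neg s F r (b ∷ β) = ≃-trans (+-cong (es-neg s _ r β) (es-neg s _ r β))
  (solve 2 (λ x y → :- x :+ :- y := :- (x :+ y)) ≃-refl _ _)

es-zero : ∀ s (F : Family n) r β → (∀ r′ γ → Shifted s r β r′ γ → F r′ γ ≃ 0#) → es s F r β ≃ 0#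
es-zero s F r β p = ≃-trans (es-cong∈ s {F} {λ r γ → 0# * F r γ} r β λ r′ γ x → ≃-trans (p r′ γ x) (≃-sym (zeroˡ _)))
  (≃-trans (es-* s 0# F r β) (zeroˡ _))

pick-es : ∀ s (K : ℕ → ℤ → Vec ℤ n → PS) r (β : Vec ℤ (suc n)) →
  es s (λ r δ → pick δ (K r)) r β ≃
  pick β (λ c γ → es s (λ r → K r c) r γ + es s (λ r → K (suc r) (c ℤ.+ s)) r γ)
pick-es {zero}  s K r (b ∷ []) = ≃-refl
pick-es {suc n} s K r (b ∷ β) = begin
  es s (λ r γ → K r b γ - pick γ (λ c δ → K r c (b ∷ δ))) r β
    + es s (λ r γ → K (suc r) (b ℤ.+ s) γ - pick γ (λ c δ → K (suc r) c (b ℤ.+ s ∷ δ))) r β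
      ≈⟨ +-cong (split (λ r → K r b) (λ r c δ → K r c (b ∷ δ)))
                (split (λ r → K (suc r) (b ℤ.+ s)) (λ r c δ → K (suc r) c (b ℤ.+ s ∷ δ))) ⟩
  (x - pick β k) + (y - pick β k′)
      ≈⟨ solve 4 (λ x y u v → (x :- u) :+ (y :- v) := (x :+ y) :- (u :+ v)) ≃-refl x y (pick β k) (pick β k′) ⟩
  (x + y) - (pick β k + pick β k′)
      ≈⟨ +-congˡ (-‿cong (≃-trans (≃-sym (pick-+ β k k′)) (pick-cong β λ c γ →
           +-interchange _ _ _ _))) ⟩
  _ ∎
  where
  x = es s (λ r → K r b) r β
  y = es s (λ r → K (suc r) (b ℤ.+ s)) r β
  k k′ : ℤ → Vec ℤ n → PS
  k  c γ = es s (λ r δ → K r c (b ∷ δ)) r γ + es s (λ r δ → K (suc r) (c ℤ.+ s) (b ∷ δ)) r γ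
  k′ c γ = es s (λ r δ → K (suc r) c (b ℤ.+ s ∷ δ)) r γ
         + es s (λ r δ → K (suc (suc r)) (c ℤ.+ s) (b ℤ.+ s ∷ δ)) r γ
  split : ∀ (F : Family (suc n)) (K : ℕ → ℤ → Vec ℤ n → PS) →
    es s (λ r γ → F r γ - pick γ (K r)) r β ≃
    es s F r β - pick β (λ c γ → es s (λ r → K r c) r γ + es s (λ r → K (suc r) (c ℤ.+ s)) r γ)
  split F K = ≃-trans (es-+ s F _ r β) (+-congˡ (≃-trans (es-neg s _ r β) (-‿cong (pick-es s K r β))))

-- The subset sum prefers no coordinate, since its index sees a subset only through its size. So it
-- commutes with antisymmetrization.
alt-es : ∀ s (F : Family n) r β → alt β (es s F r) ≃ es s (λ r δ → alt δ (F r)) r β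
alt-es {zero}  s F r [] = ≃-refl
alt-es {suc n} s F r β  = ≃-trans
  (pick-cong β λ c γ → ≃-trans (alt-+ γ _ _) (+-cong (alt-es s _ r γ) (alt-es s _ r γ)))
  (≃-sym (pick-es s (λ r c γ → alt γ (λ δ → F r (c ∷ δ))) r β))

es-es-comm : ∀ s t (F : ℕ → ℕ → Vec ℤ n → PS) r u β →
  es s (λ r γ → es t (λ u → F r u) u γ) r β ≃ es t (λ u γ → es s (λ r → F r u) r γ) u β
es-es-comm s t F r u []      = ≃-refl
es-es-comm {suc n} s t F r u (b ∷ β) = begin
  es s (λ r γ → es t (F₁ r) u γ + es t (F₂ r) u γ) r β + es s (λ r γ → es t (F₃ r) u γ + es t (F₄ r) u γ) r β
    ≈⟨ +-cong (es-+ s (λ r → es t (F₁ r) u) (λ r → es t (F₂ r) u) r β)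
              (es-+ s (λ r → es t (F₃ r) u) (λ r → es t (F₄ r) u) r β) ⟩
  (x₁ + x₂) + (x₃ + x₄)
    ≈⟨ +-interchange x₁ x₂ x₃ x₄ ⟩
  (x₁ + x₃) + (x₂ + x₄)
    ≈⟨ +-cong (+-cong (es-es-comm s t F₁ r u β) (es-es-comm s t F₃ r u β))
              (+-cong (es-es-comm s t F₂ r u β) (≃-trans (es-es-comm s t F₄ r u β)
                 (es-cong t u β λ u γ → es-cong s r γ λ r δ →
                    ≃-reflexive (cong (λ z → F (suc r) (suc u) (z ∷ δ)) (exchange b))))) ⟩
  (es t (G F₁) u β + es t (G F₃) u β) + (es t (G F₂) u β + es t (G F₄′) u β)
    ≈⟨ +-cong (es-+ t (G F₁) (G F₃) u β) (es-+ t (G F₂) (G F₄′) u β) ⟨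
  es t (λ u γ → G F₁ u γ + G F₃ u γ) u β + es t (λ u γ → G F₂ u γ + G F₄′ u γ) u β ∎
  where
  F₁ F₂ F₃ F₄ F₄′ : ℕ → ℕ → Vec ℤ n → PS
  F₁  r u γ = F r u (b ∷ γ)
  F₂  r u γ = F r (suc u) (b ℤ.+ t ∷ γ)
  F₃  r u γ = F (suc r) u (b ℤ.+ s ∷ γ)
  F₄  r u γ = F (suc r) (suc u) (b ℤ.+ s ℤ.+ t ∷ γ)
  F₄′ r u γ = F (suc r) (suc u) (b ℤ.+ t ℤ.+ s ∷ γ)
  G : (ℕ → ℕ → Vec ℤ n → PS) → ℕ → Vec ℤ n → PS
  G F u = es s (λ r → F r u) r
  x₁ = es s (λ r → es t (F₁ r) u) r β
  x₂ = es s (λ r → es t (F₂ r) u) r β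
  x₃ = es s (λ r → es t (F₃ r) u) r β
  x₄ = es s (λ r → es t (F₄ r) u) r β
  exchange : ∀ b → b ℤ.+ s ℤ.+ t ≡ b ℤ.+ t ℤ.+ s
  exchange b = trans (ℤ.+-assoc b s t) (trans (cong (λ z → b ℤ.+ z) (ℤ.+-comm s t)) (sym (ℤ.+-assoc b t s)))

-- Coefficient sequences

pow : PS → ℕ → PS
pow x zero    = 1#
pow x (suc n) = x * pow x n

pow-+ : ∀ x m n → pow x (m ℕ.+ n) ≃ pow x m * pow x n
pow-+ x zero    n = ≃-sym (*-identityˡ _)
pow-+ x (suc m) n = ≃-trans (*-congˡ (pow-+ x m n)) (≃-sym (*-assoc x _ _))

pow-* : ∀ x y n → pow (x * y) n ≃ pow x n * pow y n
pow-* x y zero    = ≃-sym (*-identityˡ _)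
pow-* x y (suc n) = ≃-trans (*-congˡ (pow-* x y n))
  (solve 4 (λ x y u v → x :* y :* (u :* v) := x :* u :* (y :* v)) ≃-refl x y (pow x n) (pow y n))

pow-cong : ∀ {x y} n → x ≃ y → pow x n ≃ pow y n
pow-cong zero    p = ≃-refl
pow-cong (suc n) p = *-cong p (pow-cong n p)

qp : ℕ → PS
qp = pow q

sgn : ℕ → PS
sgn = pow (- 1#)

qz : ℤ → PS
qz (+ n)    = qp n
qz -[1+ _ ] = 0#

recip : ℕ → PS
recip k = geometric (qp k)

recip-inverse : ∀ k → (1# - qp (suc k)) * recip k ≃ 1#
recip-inverse k = geometric-inverse (qp k)

qp-low : ∀ k x d → d ℕ.< k → (qp k * x) d ≡ 0ℤ
qp-low (suc k) x zero    _       = trans (≃⇒≡ (*-assoc q (qp k) x) 0) (q*-zero (qp k * x))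
qp-low (suc k) x (suc d) (s≤s p) =
  trans (≃⇒≡ (*-assoc q (qp k) x) (suc d)) (trans (q*-suc (qp k * x) d) (qp-low k x d p))

-- The q-adic topology is separated. This stands in for convergence arguments wherever an expansion
-- does not terminate.
separated : ∀ x → (∀ k → ∃ λ y → x ≃ qp k * y) → x ≃ 0#
separated x p = ≡⇒≃ λ d → trans (≃⇒≡ (proj₂ (p (suc d))) d)
  (trans (qp-low (suc d) _ d ℕ.≤-refl) (sym (const-zero d)))

pochhammer : ℕ → PS
pochhammer zero    = 1#
pochhammer (suc n) = pochhammer n * (1# - qp (suc n))

-- Finite sums and convolutions

dot : ℕ → (ℕ → PS) → (ℕ → PS) → PS
dot zero    f a = f 0 * a 0
dot (suc n) f a = f 0 * a 0 + dot n (f ∘ suc) (a ∘ suc)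

dot-cong≤ : ∀ n {f f′ a a′} → (∀ r → r ℕ.≤ n → f r * a r ≃ f′ r * a′ r) → dot n f a ≃ dot n f′ a′
dot-cong≤ zero    p = p 0 z≤n
dot-cong≤ (suc n) p = +-cong (p 0 z≤n) (dot-cong≤ n λ r r≤n → p (suc r) (s≤s r≤n))

dot-cong : ∀ n {f f′ a a′} → (∀ r → f r * a r ≃ f′ r * a′ r) → dot n f a ≃ dot n f′ a′
dot-cong n p = dot-cong≤ n λ r _ → p r

dot-snoc : ∀ n f a → dot (suc n) f a ≃ dot n f a + f (suc n) * a (suc n)
dot-snoc zero    f a = ≃-refl
dot-snoc (suc n) f a = ≃-trans (+-congˡ (dot-snoc n (f ∘ suc) (a ∘ suc))) (≃-sym (+-assoc _ _ _))

dot-+ˡ : ∀ n f g a → dot n (λ r → f r + g r) a ≃ dot n f a + dot n g a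
dot-+ˡ zero    f g a = distribʳ _ _ _
dot-+ˡ (suc n) f g a = ≃-trans (+-congˡ (dot-+ˡ n _ _ _))
  (solve 5 (λ f g a x y → (f :+ g) :* a :+ (x :+ y) := f :* a :+ x :+ (g :* a :+ y)) ≃-refl (f 0) (g 0) (a 0) (dot n (f ∘ suc) (a ∘ suc)) (dot n (g ∘ suc) (a ∘ suc)))

dot-scale : ∀ n x f a → dot n (λ r → x * f r) a ≃ x * dot n f a
dot-scale zero    x f a = *-assoc x _ _
dot-scale (suc n) x f a = ≃-trans (+-cong (*-assoc x _ _) (dot-scale n x _ _)) (≃-sym (distribˡ x _ _))

dot-swap : ∀ n f a → dot n f a ≃ dot n a f
dot-swap n f a = dot-cong n {f} {a} {a} {f} λ r → *-comm (f r) (a r)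

dot-zero : ∀ n f a → (∀ r → r ℕ.≤ n → f r * a r ≃ 0#) → dot n f a ≃ 0#
dot-zero zero    f a p = p 0 z≤n
dot-zero (suc n) f a p = ≃-trans (+-cong (p 0 z≤n) (dot-zero n _ _ λ r r≤n → p (suc r) (s≤s r≤n))) (+-identityˡ 0#)

dot-extend : ∀ m n f a → m ℕ.≤ n → (∀ r → m ℕ.< r → f r * a r ≃ 0#) → dot n f a ≃ dot m f a
dot-extend zero    zero    f a _       p = ≃-refl
dot-extend zero    (suc n) f a _       p =
  ≃-trans (+-congˡ (dot-zero n _ _ λ r _ → p (suc r) (s≤s z≤n))) (+-identityʳ _)
dot-extend (suc m) (suc n) f a (s≤s l) p = +-congˡ (dot-extend m n _ _ l λ r m<r → p (suc r) (s≤s m<r))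

conv : (ℕ → PS) → (ℕ → PS) → ℕ → PS
conv f g zero    = f 0 * g 0
conv f g (suc n) = f 0 * g (suc n) + conv (f ∘ suc) g n

conv-dot : ∀ f g n → conv f g n ≡ dot n f (λ r → g (n ℕ.∸ r))
conv-dot f g zero    = refl
conv-dot f g (suc n) = cong (λ x → f 0 * g (suc n) + x) (conv-dot (f ∘ suc) g n)

conv-sucʳ : ∀ f g n → conv f g (suc n) ≃ conv f (g ∘ suc) n + f (suc n) * g 0
conv-sucʳ f g zero    = ≃-refl
conv-sucʳ f g (suc n) = ≃-trans (+-congˡ (conv-sucʳ (f ∘ suc) g n)) (≃-sym (+-assoc _ _ _))

conv-comm : ∀ f g n → conv f g n ≃ conv g f n
conv-comm f g zero    = *-comm _ _
conv-comm f g (suc n) = ≃-trans (+-cong (*-comm (f 0) (g (suc n))) (conv-comm (f ∘ suc) g n))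
  (≃-trans (+-comm _ _) (≃-sym (conv-sucʳ g f n)))

conv-cong : ∀ {f f′ g g′} → (∀ r → f r ≃ f′ r) → (∀ r → g r ≃ g′ r) → ∀ n → conv f g n ≃ conv f′ g′ n
conv-cong p r zero    = *-cong (p 0) (r 0)
conv-cong p r (suc n) = +-cong (*-cong (p 0) (r (suc n))) (conv-cong (p ∘ suc) r n)

conv-scale : ∀ x f g n → conv (λ r → x * f r) g n ≃ x * conv f g n
conv-scale x f g n = ≃-trans (≃-reflexive (conv-dot _ g n))
  (≃-trans (dot-scale n x f _) (*-congˡ (≃-reflexive (sym (conv-dot f g n)))))

conv-pow : ∀ x f g n → conv (λ r → pow x r * f r) (λ r → pow x r * g r) n ≃ pow x n * conv f g n
conv-pow x f g zero    = solve 2 (λ f g → con 1ℤ :* f :* (con 1ℤ :* g) := con 1ℤ :* (f :* g)) ≃-refl (f 0) (g 0)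
conv-pow x f g (suc n) = begin
  1# * f 0 * (x * pow x n * g (suc n)) + conv (λ r → x * pow x r * f (suc r)) (λ r → pow x r * g r) n
    ≈⟨ +-congˡ (conv-cong {g = λ r → pow x r * g r} (λ r → ≃-trans (*-assoc x _ _) ≃-refl) (λ _ → ≃-refl) n) ⟩
  1# * f 0 * (x * pow x n * g (suc n)) + conv (λ r → x * (pow x r * f (suc r))) (λ r → pow x r * g r) n
    ≈⟨ +-congˡ (≃-trans (conv-scale x _ (λ r → pow x r * g r) n) (*-congˡ (conv-pow x (f ∘ suc) g n))) ⟩
  1# * f 0 * (x * pow x n * g (suc n)) + x * (pow x n * conv (f ∘ suc) g n)
    ≈⟨ solve 5 (λ f g x p c → con 1ℤ :* f :* (x :* p :* g) :+ x :* (p :* c) := x :* p :* (f :* g :+ c)) ≃-refl (f 0) (g (suc n)) x (pow x n) (conv (f ∘ suc) g n) ⟩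
  _ ∎

δ₀ : ℕ → PS
δ₀ zero    = 1#
δ₀ (suc n) = 0#

dot-δ₀ : ∀ n f a → (∀ r → f r ≃ δ₀ r) → dot n f a ≃ a 0
dot-δ₀ zero    f a p = ≃-trans (*-congʳ (p 0)) (*-identityˡ _)
dot-δ₀ (suc n) f a p = ≃-trans
  (+-cong (≃-trans (*-congʳ (p 0)) (*-identityˡ _)) (dot-zero n _ _ λ r _ → annihilateˡ (p (suc r))))
  (+-identityʳ _)

-- A Cauchy product: as `a` vanishes beyond n, the square of index pairs shrinks to the triangle r +
-- t ≤ n.
dot-dot : ∀ n f g a → (∀ r → n ℕ.< r → a r ≃ 0#) →
          dot n f (λ r → dot n g (λ t → a (r ℕ.+ t))) ≃ dot n (conv f g) a
dot-dot zero    f g a p = ≃-sym (*-assoc _ _ _)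
dot-dot (suc n) f g a p = begin
  f 0 * (g 0 * a 0 + dot n (g ∘ suc) (a ∘ suc)) + dot n (f ∘ suc) (λ r → dot (suc n) g (λ t → a (suc r ℕ.+ t)))
    ≈⟨ +-congˡ (dot-cong n λ r → *-congˡ (dot-extend n (suc n) g (λ t → a (suc r ℕ.+ t)) (ℕ.n≤1+n n) λ t n<t →
         annihilateʳ (p (suc r ℕ.+ t) (s≤s (ℕ.≤-trans n<t (ℕ.m≤n+m t r)))))) ⟩
  f 0 * (g 0 * a 0 + dot n (g ∘ suc) (a ∘ suc)) + dot n (f ∘ suc) (λ r → dot n g (λ t → a (suc r ℕ.+ t)))
    ≈⟨ +-congˡ (dot-dot n (f ∘ suc) g (a ∘ suc) λ r n<r → p (suc r) (s≤s n<r)) ⟩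
  f 0 * (g 0 * a 0 + dot n (g ∘ suc) (a ∘ suc)) + dot n (conv (f ∘ suc) g) (a ∘ suc)
    ≈⟨ solve 5 (λ f g a x y → f :* (g :* a :+ x) :+ y := f :* g :* a :+ (f :* x :+ y)) ≃-refl (f 0) (g 0) (a 0) (dot n (g ∘ suc) (a ∘ suc)) (dot n (conv (f ∘ suc) g) (a ∘ suc)) ⟩
  f 0 * g 0 * a 0 + (f 0 * dot n (g ∘ suc) (a ∘ suc) + dot n (conv (f ∘ suc) g) (a ∘ suc))
    ≈⟨ +-congˡ (≃-trans (+-congʳ (≃-sym (dot-scale n (f 0) (g ∘ suc) (a ∘ suc)))) (≃-sym (dot-+ˡ n _ _ (a ∘ suc)))) ⟩
  f 0 * g 0 * a 0 + dot n (λ r → f 0 * g (suc r) + conv (f ∘ suc) g r) (a ∘ suc) ∎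

-- e r = q^{r(r-1)/2} / ((1-q)⋯(1-q^r)), the coefficients of ∏ₖ (1 + q^k x).

e : ℕ → PS
e zero    = 1#
e (suc r) = qp r * recip r * e r

Ez Eq : ℤ → PS
Ez (+ r)    = e r
Ez -[1+ _ ] = 0#
Eq (+ r)    = qp r * e r
Eq -[1+ _ ] = 0#

-- The functional equation E(x) = (1 + x) E(qx) in degree r + 1; it amounts to clearing the
-- denominator 1 - q^(r+1) of `e (suc r)`.
e-suc : ∀ r → e (suc r) ≃ qp (suc r) * e (suc r) + qp r * e r
e-suc r = begin
  p * i * e r
    ≈⟨ solve 5 (λ p q i e o → p :* i :* e := q :* (p :* i :* e) :+ p :* ((o :- q) :* i) :* e
                 :+ (con 1ℤ :- o) :* (p :* i :* e)) ≃-refl p (qp (suc r)) i (e r) 1# ⟩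
  qp (suc r) * (p * i * e r) + p * ((1# - qp (suc r)) * i) * e r + (1# - 1#) * (p * i * e r)
    ≈⟨ +-cong (+-congˡ (*-congʳ (*-congˡ (recip-inverse r)))) (*-congʳ (-‿inverseʳ 1#)) ⟩
  qp (suc r) * (p * i * e r) + p * 1# * e r + 0# * (p * i * e r)
    ≈⟨ solve 4 (λ x y p e → x :+ p :* con 1ℤ :* e :+ con 0ℤ :* y := x :+ p :* e) ≃-refl
         (qp (suc r) * (p * i * e r)) (p * i * e r) p (e r) ⟩
  qp (suc r) * (p * i * e r) + p * e r ∎
  where
  p = qp r
  i = recip r

Ez-split : ∀ c → Ez c ≃ Eq c + Eq (c ℤ.+ -1ℤ)
Ez-split (+ zero)  = solve 0 (con 1ℤ := con 1ℤ :* con 1ℤ :+ con 0ℤ) ≃-refl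
Ez-split (+ suc r) = e-suc r
Ez-split -[1+ r ]  = ≃-sym (+-identityˡ 0#)

-- The determinants D

open import Data.Empty using (⊥-elim)
open import Data.Vec.Relation.Unary.All as All using (All; []; _∷_)
open import Defs using (ρ; Series; Weight; 𝟘; 𝟙; ε; _⊕_; _⊖_; one; roots; pairs; generating; [1-qx^_]⁻¹*_; _≟ʷ_; Letter; unbarred; barred; wt; alphabet; IsPartition; isPartition?; words; energy; H; _≤ᶜ_; _≤ᶜ?_; u≤u; u≤b; b≤b)

slot : (ℤ → PS) → (Vec ℤ n → PS) → Vec ℤ (suc n) → PS
slot f Φ (c ∷ γ) = f c * Φ γ

prod : (ℤ → PS) → Vec ℤ n → PS
prod f []                = 1#
prod {suc n} f (c ∷ γ) = f (c ℤ.- + suc n) * prod f γ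

alt-slot : ∀ (β : Vec ℤ (suc n)) f Φ → alt β (slot f Φ) ≃ pick β (λ c γ → f c * alt γ Φ)
alt-slot β f Φ = pick-cong β λ c γ → alt-* γ (f c) Φ

alt-slot-cong : ∀ (β : Vec ℤ (suc n)) {f g} {Φ Ψ : Vec ℤ n → PS} → (∀ c → f c ≃ g c) → (∀ γ → Φ γ ≃ Ψ γ) →
                alt β (slot f Φ) ≃ alt β (slot g Ψ)
alt-slot-cong β {f} {g} {Φ} {Ψ} p r = alt-cong β (slot f Φ) (slot g Ψ) λ { (c ∷ γ) → *-cong (p c) (r γ) }

-- D (λ + ρ) = det (e_{λᵢ-i+j})
D DQ : Vec ℤ n → PS
D  β = alt β (prod Ez)
DQ β = alt β (prod Eq)

D-AdjEq : ∀ {β : Vec ℤ n} → AdjEq β → D β ≃ 0#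
D-AdjEq = alt-AdjEq (prod Ez)

lower-ρ : ∀ c m → c ℤ.+ -1ℤ ℤ.- + m ≡ c ℤ.- + suc m
lower-ρ c m = IntSolver.solve 2 (λ c m → c ⊞ IntSolver.con -1ℤ ⊟ m ⊜ c ⊟ (IntSolver.con 1ℤ ⊞ m)) refl c (+ m)

lower-ρ′ : ∀ c m → c ℤ.- + m ℤ.+ -1ℤ ≡ c ℤ.- + suc m
lower-ρ′ c m = IntSolver.solve 2 (λ c m → c ⊟ m ⊞ IntSolver.con -1ℤ ⊜ c ⊟ (IntSolver.con 1ℤ ⊞ m)) refl c (+ m)

raise-ρ : ∀ c m → c ℤ.+ 1ℤ ℤ.- + suc m ≡ c ℤ.- + m
raise-ρ c m = IntSolver.solve 2 (λ c m → c ⊞ IntSolver.con 1ℤ ⊟ (IntSolver.con 1ℤ ⊞ m) ⊜ c ⊟ m) refl c (+ m)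

raise-ρ′ : ∀ c m → c ℤ.- + suc m ℤ.+ 1ℤ ≡ c ℤ.- + m
raise-ρ′ c m = IntSolver.solve 2 (λ c m → c ⊟ (IntSolver.con 1ℤ ⊞ m) ⊞ IntSolver.con 1ℤ ⊜ c ⊟ m) refl c (+ m)

es-prod-Eq : ∀ r (γ : Vec ℤ n) → es -1ℤ (λ _ → prod Eq) r γ ≃ prod Ez γ
es-prod-Eq r [] = ≃-refl
es-prod-Eq {suc n} r (c ∷ γ) = begin
  es -1ℤ (λ _ δ → x * prod Eq δ) r γ + es -1ℤ (λ _ δ → y * prod Eq δ) r γ
    ≈⟨ +-cong (≃-trans (es-* -1ℤ x _ r γ) (*-congˡ (es-prod-Eq r γ)))
              (≃-trans (es-* -1ℤ y _ r γ) (*-congˡ (es-prod-Eq r γ))) ⟩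
  x * prod Ez γ + y * prod Ez γ
    ≈⟨ distribʳ (prod Ez γ) x y ⟨
  (x + y) * prod Ez γ
    ≈⟨ *-congʳ (≃-trans (Ez-split (c ℤ.- + suc n)) (+-congˡ (≃-reflexive (cong Eq
         (trans (lower-ρ′ c (suc n)) (sym (lower-ρ c (suc n)))))))) ⟨
  prod Ez (c ∷ γ) ∎
  where
  x = Eq (c ℤ.- + suc n)
  y = Eq (c ℤ.+ -1ℤ ℤ.- + suc n)

-- The branching rule of Schur functions: `D` is evaluated at 1, q, q², ... and `DQ` at q, q², ...,
-- and giving up the variable 1 removes a vertical strip from λ.
es-DQ : ∀ r (β : Vec ℤ n) → es -1ℤ (λ _ → DQ) r β ≃ D β
es-DQ r β = ≃-trans (≃-sym (alt-es -1ℤ (λ _ → prod Eq) r β)) (alt-cong β _ _ (es-prod-Eq r))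

-- Homogeneity: passing from E(x) to E(qx) multiplies e_r by q^r, and the indices r add up to s. The
-- first alternative covers a negative index somewhere, where both products vanish and the total
-- degree may fail to be a natural number.
prod-Eq : ∀ (γ : Vec ℤ n) → (prod Ez γ ≃ 0# × prod Eq γ ≃ 0#) ⊎
                            ∃ λ s → sum γ ≡ + s ℤ.+ sum (ρ n) × prod Eq γ ≃ qp s * prod Ez γ
prod-Eq [] = inj₂ (0 , refl , ≃-sym (*-identityˡ _))
prod-Eq {suc n} (c ∷ γ) with c ℤ.- + suc n in eq | prod-Eq γ
... | -[1+ _ ] | _              = inj₁ (zeroˡ _ , zeroˡ _)
... | + r      | inj₁ (p , p′)  = inj₁ (annihilateʳ p , annihilateʳ p′)
... | + r      | inj₂ (s , p , p′) = inj₂ (r ℕ.+ s , total , (begin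
  qp r * e r * prod Eq γ               ≈⟨ *-congˡ p′ ⟩
  qp r * e r * (qp s * prod Ez γ)      ≈⟨ solve 4 (λ a b c d → a :* b :* (c :* d) := a :* c :* (b :* d)) ≃-refl (qp r) (e r) (qp s) (prod Ez γ) ⟩
  qp r * qp s * (e r * prod Ez γ)      ≈⟨ *-congʳ (pow-+ q r s) ⟨
  qp (r ℕ.+ s) * (e r * prod Ez γ)     ∎))
  where
  total : c ℤ.+ sum γ ≡ + (r ℕ.+ s) ℤ.+ (+ suc n ℤ.+ sum (ρ n))
  total = trans (cong₂ ℤ._+_ (trans (sym (ℤ.+-identityʳ c)) (trans (cong (λ z → c ℤ.+ z) (sym (ℤ.+-inverseˡ (+ suc n))))
                  (trans (sym (ℤ.+-assoc c _ _)) (cong (λ z → z ℤ.+ + suc n) eq)))) p)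
    (IntSolver.solve 4 (λ r s x y → r ⊞ x ⊞ (s ⊞ y) ⊜ r ⊞ s ⊞ (x ⊞ y)) refl (+ r) (+ s) (+ suc n) (sum (ρ n)))

prod-Eq-qz : ∀ (γ : Vec ℤ n) z → sum γ ≡ z ℤ.+ sum (ρ n) → prod Eq γ ≃ qz z * prod Ez γ
prod-Eq-qz γ z h with prod-Eq γ
... | inj₁ (p , p′)     = ≃-trans p′ (≃-sym (annihilateʳ p))
... | inj₂ (s , p , p′) = ≃-trans p′ (*-congʳ (≃-reflexive (cong qz (+ℤ-cancelʳ (+ s) z _ (trans (sym p) h)))))

DQ≃qz*D : ∀ (β : Vec ℤ n) z → sum β ≡ z ℤ.+ sum (ρ n) → DQ β ≃ qz z * D β
DQ≃qz*D β z h = ≃-trans (alt-cong-sum β _ _ λ γ p → prod-Eq-qz γ z (trans p h)) (alt-* β (qz z) _)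

-- Column operations: E(x) = E(qx) + x E(qx), and x E(qx) is the next column
-- over.
alt-Eq∷Ez : ∀ (β : Vec ℤ (suc n)) → alt β (slot (λ c → Eq (c ℤ.- + suc n)) (prod Ez)) ≃ DQ β
alt-Eq∷Ez {zero} β = alt-cong β (slot (λ c → Eq (c ℤ.- 1ℤ)) (prod Ez)) (prod Eq) λ { (c ∷ []) → ≃-refl }
alt-Eq∷Ez {suc n} β = begin
  alt β (slot f (prod Ez))
    ≈⟨ alt-cong β (slot f (prod Ez)) (λ γ → slot f (slot g (prod Ez)) γ + slot f (slot f (prod Ez)) γ) (λ { (c ∷ d ∷ γ) → ≃-trans (*-congˡ (≃-trans (*-congʳ (≃-trans (Ez-split (d ℤ.- + suc n)) (+-congˡ (≃-reflexive (cong Eq (lower-ρ′ d (suc n)))))))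
          (distribʳ _ _ _))) (distribˡ _ _ _) }) ⟩
  alt β (λ γ → slot f (slot g (prod Ez)) γ + slot f (slot f (prod Ez)) γ)
    ≈⟨ alt-+ β (slot f (slot g (prod Ez))) (slot f (slot f (prod Ez))) ⟩
  alt β (slot f (slot g (prod Ez))) + alt β (slot f (slot f (prod Ez)))
    ≈⟨ +-cong (≃-trans (alt-slot β f (slot g (prod Ez))) (pick-cong β λ c γ → *-congˡ (alt-Eq∷Ez γ)))
              (alt-symmetric β (slot f (slot f (prod Ez))) λ b c γ →
                x∙yz≈y∙xz (f b) (f c) (prod Ez γ)) ⟩
  pick β (λ c γ → f c * DQ γ) + 0#
    ≈⟨ +-identityʳ _ ⟩
  pick β (λ c γ → f c * DQ γ)
    ≈⟨ ≃-sym (alt-slot β f (prod Eq)) ⟩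
  alt β (slot f (prod Eq))
    ≈⟨ alt-cong β (slot f (prod Eq)) (prod Eq) (λ { (c ∷ γ) → ≃-refl }) ⟩
  DQ β ∎
  where
  f g : ℤ → PS
  f c = Eq (c ℤ.- + suc (suc n))
  g c = Eq (c ℤ.- + suc n)

-- The first column equals a later one. `alt-flip` carries it past its neighbours until the two
-- equal columns are adjacent.
alt-repeated : ∀ (β : Vec ℤ (suc n)) j → j ℕ.< n → alt β (slot (λ c → Ez (c ℤ.- + suc j)) (prod Ez)) ≃ 0#
alt-repeated {suc n} β j (s≤s j≤n) with j ℕ.≟ n
... | yes refl = alt-symmetric β (slot (λ c → Ez (c ℤ.- + suc n)) (prod Ez)) λ b c γ →
  x∙yz≈y∙xz (Ez (b ℤ.- + suc n)) (Ez (c ℤ.- + suc n)) (prod Ez γ)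
... | no j≢n = begin
  alt β (slot f (prod Ez))
    ≈⟨ alt-flip β (slot f (prod Ez)) ⟩
  - alt β (flip₂ (slot f (prod Ez)))
    ≈⟨ -‿cong (alt-cong β (flip₂ (slot f (prod Ez))) (slot g (slot f (prod Ez))) λ { (b ∷ c ∷ γ) →
         x∙yz≈y∙xz (f c) (g b) (prod Ez γ) }) ⟩
  - alt β (slot g (slot f (prod Ez)))
    ≈⟨ -‿cong (alt-slot β g (slot f (prod Ez))) ⟩
  - pick β (λ c γ → g c * alt γ (slot f (prod Ez)))
    ≈⟨ -‿cong (pick-zero β λ c γ _ → annihilateʳ (alt-repeated γ j (ℕ.≤∧≢⇒< j≤n j≢n))) ⟩
  - 0#
    ≈⟨ solve 0 (:- con 0ℤ := con 0ℤ) ≃-refl ⟩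
  0# ∎
  where
  f g : ℤ → PS
  f c = Ez (c ℤ.- + suc j)
  g c = Ez (c ℤ.- + suc n)

-- The first column of D multiplied by x^{1-p}, with E replaced by E(qx) there.
B : ℕ → Vec ℤ (suc n) → PS
B {n} p β = alt β (slot (λ c → Eq (c ℤ.- + suc (suc n) ℤ.+ + p)) (prod Ez))

private
  B-sum : ∀ p (β : Vec ℤ (suc n)) →
    alt β (slot (λ c → Ez (c ℤ.- + suc (suc n) ℤ.+ + suc p)) (prod Ez)) ≃ B (suc p) β + B p β
  B-sum {n} p β = ≃-trans
    (alt-cong β (slot (λ c → Ez (x c ℤ.+ + suc p)) (prod Ez)) (λ γ → slot (λ c → Eq (x c ℤ.+ + suc p)) (prod Ez) γ + slot (λ c → Eq (x c ℤ.+ + p)) (prod Ez) γ) (λ { (c ∷ γ) → ≃-trans (*-congʳ (≃-trans (Ez-split (x c ℤ.+ + suc p))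
       (+-congˡ (≃-reflexive (cong Eq (ℤ.+-assoc (x c) (+ suc p) -1ℤ)))))) (distribʳ _ _ _) }))
    (alt-+ β (slot (λ c → Eq (x c ℤ.+ + suc p)) (prod Ez)) (slot (λ c → Eq (x c ℤ.+ + p)) (prod Ez)))
    where x = λ c → c ℤ.- + suc (suc n)

B-one : ∀ (β : Vec ℤ (suc n)) → B 1 β ≃ DQ β
B-one {n} β = ≃-trans (alt-slot-cong β {Φ = prod Ez} (λ c → ≃-reflexive (cong Eq (raise-ρ′ c (suc n)))) λ _ → ≃-refl)
  (alt-Eq∷Ez β)

B-zero : ∀ (β : Vec ℤ (suc n)) → B 0 β ≃ D β - DQ β
B-zero {n} β = begin
  B 0 β
    ≈⟨ solve 2 (λ x y → y := x :+ y :- x) ≃-refl (B 1 β) (B 0 β) ⟩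
  B 1 β + B 0 β - B 1 β
    ≈⟨ +-cong (≃-sym (B-sum 0 β)) (-‿cong (B-one β)) ⟩
  alt β (slot (λ c → Ez (c ℤ.- + suc (suc n) ℤ.+ 1ℤ)) (prod Ez)) - DQ β
    ≈⟨ +-congʳ (alt-cong β (slot (λ c → Ez (c ℤ.- + suc (suc n) ℤ.+ 1ℤ)) (prod Ez)) (prod Ez) λ { (c ∷ γ) → *-congʳ (≃-reflexive (cong Ez (raise-ρ′ c (suc n)))) }) ⟩
  D β - DQ β ∎

-- For 1 ≤ p ≤ n the left side of `B-sum` has a repeated column and vanishes, so `B (suc p)` is the
-- negative of `B p`. The start p = 0 is `B-one`.
B-suc : ∀ p (β : Vec ℤ (suc n)) → p ℕ.≤ n → B (suc p) β ≃ sgn p * DQ β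
B-suc zero    β _ = ≃-trans (B-one β) (≃-sym (*-identityˡ _))
B-suc {n} (suc p) β p<n = begin
  B (suc (suc p)) β
    ≈⟨ solve 2 (λ x y → x := x :+ y :- y) ≃-refl (B (suc (suc p)) β) (B (suc p) β) ⟩
  B (suc (suc p)) β + B (suc p) β - B (suc p) β
    ≈⟨ +-cong (≃-sym (B-sum (suc p) β)) (-‿cong (B-suc p β (ℕ.<⇒≤ p<n))) ⟩
  alt β (slot (λ c → Ez (c ℤ.- + suc (suc n) ℤ.+ + suc (suc p))) (prod Ez)) - sgn p * DQ β
    ≈⟨ +-congʳ (≃-trans (alt-slot-cong β {Φ = prod Ez} (λ c → ≃-reflexive (cong Ez (column c))) λ _ → ≃-refl)
         (alt-repeated β (n ℕ.∸ suc p) (ℕ.∸-monoʳ-< {o = 0} (s≤s z≤n) p<n))) ⟩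
  0# - sgn p * DQ β
    ≈⟨ solve 2 (λ s d → con 0ℤ :- s :* d := :- con 1ℤ :* s :* d) ≃-refl (sgn p) (DQ β) ⟩
  sgn (suc p) * DQ β ∎
  where
  column : ∀ c → c ℤ.- + suc (suc n) ℤ.+ + suc (suc p) ≡ c ℤ.- + suc (n ℕ.∸ suc p)
  column c = trans (cong (λ m → c ℤ.- + suc (suc m) ℤ.+ + suc (suc p)) (sym (ℕ.m∸n+n≡m p<n)))
    (IntSolver.solve 3 (λ c m p → c ⊟ (IntSolver.con (+ 2) ⊞ (m ⊞ (IntSolver.con 1ℤ ⊞ p))) ⊞ (IntSolver.con (+ 2) ⊞ p) ⊜ c ⊟ (IntSolver.con 1ℤ ⊞ m))
      refl c (+ (n ℕ.∸ suc p)) (+ p))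

prod₁ : Vec ℤ n → PS
prod₁ = prod (λ c → Ez (c ℤ.+ 1ℤ))

-- η r = det (e_{1-i+j}) of size r, so that Σ η r uʳ = 1/E(-u).
η : ℕ → PS
η r = alt (ρ r) prod₁

trailing : ∀ n → (ℕ → PS) → Vec ℤ n → PS
trailing zero    w γ       = w 0
trailing (suc n) w (c ∷ γ) = Ez (c ℤ.- + suc n) * trailing n w γ + w (suc n) * prod₁ (c ∷ γ)

-- If the columns j ∈ I are shifted and j + 1 ∉ I, then two columns
-- coincide; so only the final segments I contribute.
alt-es-trailing : ∀ (β : Vec ℤ n) w → alt β (es 1ℤ (λ r γ → w r * prod Ez γ) 0) ≃ alt β (trailing n w)
alt-es-trailing {zero} β w = *-identityʳ _
alt-es-trailing {suc n} β w = begin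
  alt β (es 1ℤ (λ r γ → w r * prod Ez γ) 0)
    ≈⟨ alt-cong β (es 1ℤ (λ r γ → w r * prod Ez γ) 0) (λ γ → slot f (W w) γ + slot g (W (w ∘ suc)) γ) (λ { (c ∷ γ) → +-cong
         (pull (f c) w γ) (pull (g c) (w ∘ suc) γ) }) ⟩
  alt β (λ γ → slot f (W w) γ + slot g (W (w ∘ suc)) γ)
    ≈⟨ alt-+ β (slot f (W w)) (slot g (W (w ∘ suc))) ⟩
  alt β (slot f (W w)) + alt β (slot g (W (w ∘ suc)))
    ≈⟨ +-cong (induct f w) (≃-trans (induct g (w ∘ suc)) (last n β)) ⟩
  alt β (slot f (trailing n w)) + alt β (λ γ → w (suc n) * prod₁ γ)
    ≈⟨ ≃-sym (alt-+ β (slot f (trailing n w)) (λ γ → w (suc n) * prod₁ γ)) ⟩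
  alt β (λ γ → slot f (trailing n w) γ + w (suc n) * prod₁ γ)
    ≈⟨ alt-cong β (λ γ → slot f (trailing n w) γ + w (suc n) * prod₁ γ) (trailing (suc n) w) (λ { (c ∷ γ) → ≃-refl }) ⟩
  alt β (trailing (suc n) w) ∎
  where
  f g : ℤ → PS
  f c = Ez (c ℤ.- + suc n)
  g c = Ez (c ℤ.+ 1ℤ ℤ.- + suc n)
  W : (ℕ → PS) → Vec ℤ n → PS
  W w = es 1ℤ (λ r γ → w r * prod Ez γ) 0
  pull : ∀ x w γ → es 1ℤ (λ r δ → w r * (x * prod Ez δ)) 0 γ ≃ x * W w γ
  pull x w γ = ≃-trans (es-cong 1ℤ {F′ = λ r δ → x * (w r * prod Ez δ)} 0 γ λ r δ →
    x∙yz≈y∙xz (w r) x (prod Ez δ)) (es-* 1ℤ x _ 0 γ)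
  induct : ∀ h w → alt β (slot h (W w)) ≃ alt β (slot h (trailing n w))
  induct h w = ≃-trans (alt-slot β h (W w)) (≃-trans (pick-cong β λ c γ → *-congˡ (alt-es-trailing γ w))
    (≃-sym (alt-slot β h (trailing n w))))
  -- Once the first column is shifted, a term with unshifted second column has two equal columns;
  -- only the term with all columns shifted survives.
  last : ∀ n (β : Vec ℤ (suc n)) → alt β (slot (λ c → Ez (c ℤ.+ 1ℤ ℤ.- + suc n)) (trailing n (w ∘ suc)))
                                 ≃ alt β (λ γ → w (suc n) * prod₁ γ)
  last zero    β = alt-cong β (slot (λ c → Ez (c ℤ.+ 1ℤ ℤ.- 1ℤ)) (trailing 0 (w ∘ suc))) (λ γ → w 1 * prod₁ γ) λ { (c ∷ []) →
    ≃-trans (*-comm _ _) (*-congˡ (≃-sym (≃-trans (*-identityʳ _) (≃-reflexive (cong Ez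
      (IntSolver.solve 1 (λ c → c ⊟ IntSolver.con 1ℤ ⊞ IntSolver.con 1ℤ ⊜ c ⊞ IntSolver.con 1ℤ ⊟ IntSolver.con 1ℤ) refl c)))))) }
  last (suc m) β = begin
    alt β (slot h (trailing (suc m) (w ∘ suc)))
      ≈⟨ alt-cong β (slot h (trailing (suc m) (w ∘ suc))) (λ γ → slot h (slot h (trailing m (w ∘ suc))) γ + w (suc (suc m)) * prod₁ γ)
           (λ { (c ∷ d ∷ γ) → ≃-trans (distribˡ _ _ _) (+-cong
             (*-congˡ (*-congʳ (≃-reflexive (cong Ez (sym (raise-ρ d (suc m)))))))
             (≃-trans (x∙yz≈y∙xz (h c) (w (suc (suc m))) (prod₁ (d ∷ γ)))
                (*-congˡ (*-congʳ (≃-reflexive (cong Ez (shift c))))))) }) ⟩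
    alt β (λ γ → slot h (slot h (trailing m (w ∘ suc))) γ + w (suc (suc m)) * prod₁ γ)
      ≈⟨ alt-+ β (slot h (slot h (trailing m (w ∘ suc)))) (λ γ → w (suc (suc m)) * prod₁ γ) ⟩
    alt β (slot h (slot h (trailing m (w ∘ suc)))) + alt β (λ γ → w (suc (suc m)) * prod₁ γ)
      ≈⟨ +-congʳ (alt-symmetric β (slot h (slot h (trailing m (w ∘ suc)))) λ b c γ →
           x∙yz≈y∙xz (h b) (h c) (trailing m (w ∘ suc) γ)) ⟩
    0# + alt β (λ γ → w (suc (suc m)) * prod₁ γ)
      ≈⟨ +-identityˡ _ ⟩
    alt β (λ γ → w (suc (suc m)) * prod₁ γ) ∎
    where
    h : ℤ → PS
    h c = Ez (c ℤ.+ 1ℤ ℤ.- + suc (suc m))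
    shift : ∀ c → c ℤ.+ 1ℤ ℤ.- + suc (suc m) ≡ c ℤ.- + suc (suc m) ℤ.+ 1ℤ
    shift c = IntSolver.solve 2 (λ c x → c ⊞ IntSolver.con 1ℤ ⊟ x ⊜ c ⊟ x ⊞ IntSolver.con 1ℤ) refl c (+ suc (suc m))

-- λ has at least z vanishing parts, for β = λ + ρ.
data Trailing (z : ℕ) : Vec ℤ n → Set where
  base : Trailing z (ρ z)
  _∷_  : ∀ b {β : Vec ℤ n} → Trailing z β → Trailing z (b ∷ β)

ρ≤ : ∀ n → All (ℤ._≤ + n) (ρ n)
ρ≤ zero    = []
ρ≤ (suc n) = ℤ.≤-refl ∷ All.map (λ p → ℤ.≤-trans p (ℤ.+≤+ (ℕ.n≤1+n n))) (ρ≤ n)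

Picks-All : ∀ {P : ℤ → Set} {β : Vec ℤ (suc n)} {c γ} → Picks β c γ → All P β → P c × All P γ
Picks-All here      (p ∷ ps) = p , ps
Picks-All (there x) (p ∷ ps) with Picks-All x ps
... | r , rs = r , p ∷ rs

Trailing-≤ : ∀ {z} {β : Vec ℤ n} → Trailing z β → z ℕ.≤ n
Trailing-≤ base    = ℕ.≤-refl
Trailing-≤ (b ∷ x) = ℕ.m≤n⇒m≤1+n (Trailing-≤ x)

-- An entry taken out of the final block `ρ z` is at most z ≤ n, and then the factor e_{c-n-1} in
-- front of it is zero. So only the expansions that leave the block intact count.
Picks-Trailing : ∀ {z b c} {β γ : Vec ℤ n} → Trailing z β → Picks (b ∷ β) c γ → Trailing z γ ⊎ c ℤ.≤ + z
Picks-Trailing x here = inj₁ x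
Picks-Trailing base (there y) = inj₂ (proj₁ (Picks-All y (ρ≤ _)))
Picks-Trailing (_ ∷ x) (there {b = b} y) with Picks-Trailing x y
... | inj₁ t = inj₁ (b ∷ t)
... | inj₂ p = inj₂ p

Ez-negative : ∀ {c m} → c ℤ.< + m → Ez (c ℤ.- + m) ≃ 0#
Ez-negative {c} {m} p = negative (c ℤ.- + m) (subst (c ℤ.- + m ℤ.<_) (ℤ.+-inverseʳ (+ m)) (ℤ.+-monoˡ-< (ℤ.- (+ m)) p))
  where
  negative : ∀ x → x ℤ.< 0ℤ → Ez x ≃ 0#
  negative -[1+ _ ] _ = ≃-refl
  negative (+ _) (ℤ.+<+ ())

Ez-zero : ∀ m → Ez (+ m ℤ.- + m) ≃ 1#
Ez-zero m = ≃-reflexive (cong Ez (ℤ.+-inverseʳ (+ m)))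

pick-head : ∀ {P : ℤ → Set} {b} (β : Vec ℤ n) k → All P β → (∀ c γ → P c → k c γ ≃ 0#) →
            pick (b ∷ β) k ≃ k b β
pick-head {zero}  []      k _ p = ≃-refl
pick-head {suc n} {b = b} β k a p = ≃-trans
  (+-congˡ (-‿cong (pick-zero β λ c γ x → p c (b ∷ γ) (proj₁ (Picks-All x a)))))
  (solve 1 (λ x → x :- con 0ℤ := x) ≃-refl (k b β))

pick-ρ : ∀ n (Φ : Vec ℤ n → PS) → pick (ρ (suc n)) (λ c γ → Ez (c ℤ.- + suc n) * alt γ Φ) ≃ alt (ρ n) Φ
pick-ρ n Φ = ≃-trans
  (pick-head (ρ n) (λ c γ → Ez (c ℤ.- + suc n) * alt γ Φ) (ρ≤ n) λ c γ p →
    annihilateˡ (Ez-negative (ℤ.≤-<-trans p (ℤ.+<+ ℕ.≤-refl))))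
  (≃-trans (*-congʳ (Ez-zero (suc n))) (*-identityˡ _))

alt-slot-Ez : ∀ (β : Vec ℤ (suc n)) Φ → alt β (slot (λ c → Ez (c ℤ.- + suc n)) Φ) ≃
                                        pick β (λ c γ → Ez (c ℤ.- + suc n) * alt γ Φ)
alt-slot-Ez β Φ = alt-slot β _ Φ

D-cons : ∀ (β : Vec ℤ (suc n)) → D β ≃ pick β (λ c γ → Ez (c ℤ.- + suc n) * D γ)
D-cons {n} β = ≃-trans (alt-cong β (prod Ez) (slot (λ c → Ez (c ℤ.- + suc n)) (prod Ez)) λ { (c ∷ γ) → ≃-refl })
  (alt-slot-Ez β (prod Ez))

trailing-cons : ∀ (β : Vec ℤ (suc n)) w → alt β (trailing (suc n) w) ≃
  pick β (λ c γ → Ez (c ℤ.- + suc n) * alt γ (trailing n w)) + w (suc n) * alt β prod₁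
trailing-cons {n} β w = begin
  alt β (trailing (suc n) w)
    ≈⟨ alt-cong β (trailing (suc n) w) (λ γ → slot f (trailing n w) γ + w (suc n) * prod₁ γ) (λ { (c ∷ γ) → ≃-refl }) ⟩
  alt β (λ γ → slot f (trailing n w) γ + w (suc n) * prod₁ γ)
    ≈⟨ alt-+ β (slot f (trailing n w)) (λ γ → w (suc n) * prod₁ γ) ⟩
  alt β (slot f (trailing n w)) + alt β (λ γ → w (suc n) * prod₁ γ)
    ≈⟨ +-cong (alt-slot-Ez β (trailing n w)) (alt-* β (w (suc n)) prod₁) ⟩
  _ ∎
  where f = λ c → Ez (c ℤ.- + suc n)

D-ρ : ∀ n → D (ρ n) ≃ 1#
D-ρ zero    = ≃-refl
D-ρ (suc n) = ≃-trans (D-cons (ρ (suc n))) (≃-trans (pick-ρ n (prod Ez)) (D-ρ n))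

alt-ρ-trailing : ∀ z w → alt (ρ z) (trailing z w) ≃ dot z w η
alt-ρ-trailing zero    w = ≃-sym (*-identityʳ _)
alt-ρ-trailing (suc z) w = begin
  alt (ρ (suc z)) (trailing (suc z) w)
    ≈⟨ trailing-cons (ρ (suc z)) w ⟩
  pick (ρ (suc z)) (λ c γ → Ez (c ℤ.- + suc z) * alt γ (trailing z w)) + w (suc z) * η (suc z)
    ≈⟨ +-congʳ (≃-trans (pick-ρ z (trailing z w)) (alt-ρ-trailing z w)) ⟩
  dot z w η + w (suc z) * η (suc z)
    ≈⟨ ≃-sym (dot-snoc z w η) ⟩
  dot (suc z) w η ∎

-- Laplace expansion peels off rows until only `ρ z` is left, where λ is empty and the sum is Σ w r
-- η r. The terms with more than z shifted columns reach beyond that block, and the hypothesis on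
-- `w` removes them.
alt-trailing : ∀ {z} {β : Vec ℤ n} w → Trailing z β → (∀ r → z ℕ.< r → w r ≃ 0#) →
               alt β (trailing n w) ≃ dot z w η * D β
alt-trailing {n} w base p = ≃-trans (alt-ρ-trailing n w) (≃-sym (≃-trans (*-congˡ (D-ρ n)) (*-identityʳ _)))
alt-trailing {suc n} {z} {b ∷ β} w (b ∷ x) p = begin
  alt (b ∷ β) (trailing (suc n) w)
    ≈⟨ trailing-cons (b ∷ β) w ⟩
  pick (b ∷ β) (λ c γ → Ez (c ℤ.- + suc n) * alt γ (trailing n w)) + w (suc n) * alt (b ∷ β) prod₁
    ≈⟨ +-cong (pick-cong∈ (b ∷ β) step₁) (annihilateˡ (p (suc n) (s≤s (Trailing-≤ x)))) ⟩
  pick (b ∷ β) (λ c γ → dot z w η * (Ez (c ℤ.- + suc n) * D γ)) + 0#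
    ≈⟨ +-identityʳ _ ⟩
  pick (b ∷ β) (λ c γ → dot z w η * (Ez (c ℤ.- + suc n) * D γ))
    ≈⟨ pick-* (b ∷ β) (dot z w η) _ ⟩
  dot z w η * pick (b ∷ β) (λ c γ → Ez (c ℤ.- + suc n) * D γ)
    ≈⟨ *-congˡ (≃-sym (D-cons (b ∷ β))) ⟩
  dot z w η * D (b ∷ β) ∎
  where
  step₁ : ∀ c γ → Picks (b ∷ β) c γ → Ez (c ℤ.- + suc n) * alt γ (trailing n w) ≃ dot z w η * (Ez (c ℤ.- + suc n) * D γ)
  step₁ c γ y with Picks-Trailing x y
  ... | inj₁ t = ≃-trans (*-congˡ (alt-trailing w t p))
          (x∙yz≈y∙xz (Ez (c ℤ.- + suc n)) (dot z w η) (D γ))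
  ... | inj₂ c≤z = ≃-trans (annihilateˡ vanish) (≃-sym (annihilateʳ (annihilateˡ vanish)))
    where vanish = Ez-negative (ℤ.≤-<-trans c≤z (ℤ.+<+ (s≤s (Trailing-≤ x))))

-- Strictly decreasing sequences of positive integers, i.e. λ + ρ for
-- partitions λ.
data StrictPos : Vec ℤ n → Set where
  []   : StrictPos []
  cons : ∀ {b} {β : Vec ℤ n} → 0ℤ ℤ.< b → All (ℤ._< b) β → StrictPos β → StrictPos (b ∷ β)

Picks-StrictPos : ∀ {β : Vec ℤ (suc n)} {c γ} → StrictPos β → Picks β c γ → StrictPos γ
Picks-StrictPos (cons _ _ s) here = s
Picks-StrictPos (cons p a s) (there x) = cons p (proj₂ (Picks-All x a)) (Picks-StrictPos s x)

Trailing-weaken : ∀ {z z′} {β : Vec ℤ n} → Trailing z β → z′ ℕ.≤ z → Trailing z′ β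
Trailing-weaken {z = z} {z′} base p with z ℕ.≟ z′
... | yes refl = base
Trailing-weaken {z = zero} base z≤n | no ¬p = ⊥-elim (¬p refl)
Trailing-weaken {z = suc z} base p | no ¬p = (+ suc z) ∷ Trailing-weaken base (ℕ.≤-pred (ℕ.≤∧≢⇒< p (¬p ∘ sym)))
Trailing-weaken (b ∷ x) p = b ∷ Trailing-weaken x p

StrictPos-≥ : ∀ {b} {β : Vec ℤ n} → StrictPos (b ∷ β) → + suc n ℤ.≤ b
StrictPos-≥ (cons p [] s) = ℤ.i<j⇒suc[i]≤j p
StrictPos-≥ (cons p (a ∷ as) s) = ℤ.≤-trans (ℤ.suc-mono (StrictPos-≥ s)) (ℤ.i<j⇒suc[i]≤j a)

StrictPos-ρ : ∀ {β : Vec ℤ n} → StrictPos β → All (ℤ._< + suc n) β → β ≡ ρ n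
StrictPos-ρ [] _ = refl
StrictPos-ρ {suc n} {b ∷ β} s@(cons _ a s′) (p ∷ _) = cong₂ _∷_ b≡n (StrictPos-ρ s′ (subst (λ z → All (ℤ._< z) β) b≡n a))
  where
  b≡n : b ≡ + suc n
  b≡n = ℤ.≤-antisym (subst (b ℤ.≤_) refl (ℤ.i<j⇒i≤pred[j] p)) (StrictPos-≥ s)

-- A partition of n - Θ has at most n - Θ non-zero parts. In the induction, a first part k + 1 uses
-- up one row but k + 1 boxes, so the remaining rows have k zero parts to spare; a first part 0
-- means λ = 0.
Trailing-StrictPos : ∀ {β : Vec ℤ n} Θ → StrictPos β → sum β ℤ.+ + Θ ≡ + n ℤ.+ sum (ρ n) → Trailing Θ β
Trailing-StrictPos {zero} {[]} zero [] _ = base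
Trailing-StrictPos {zero} {[]} (suc Θ) [] ()
Trailing-StrictPos {suc n} {b ∷ β} Θ s@(cons p a s′) h = go (b ℤ.- + suc n) refl
  where
  shape : ∀ k → b ℤ.- + suc n ≡ k → sum β ℤ.+ (+ Θ ℤ.+ (k ℤ.- 1ℤ)) ≡ + n ℤ.+ sum (ρ n)
  shape k refl = trans
    (IntSolver.solve 4 (λ b β Θ n → β ⊞ (Θ ⊞ ((b ⊟ (IntSolver.con 1ℤ ⊞ n)) ⊟ IntSolver.con 1ℤ))
        ⊜ (b ⊞ β ⊞ Θ) ⊟ (IntSolver.con (+ 2) ⊞ n)) refl b (sum β) (+ Θ) (+ n))
    (trans (cong (λ z → z ℤ.- (+ 2 ℤ.+ + n)) h)
      (IntSolver.solve 2 (λ n r → (IntSolver.con 1ℤ ⊞ n) ⊞ (IntSolver.con 1ℤ ⊞ n ⊞ r) ⊟ (IntSolver.con (+ 2) ⊞ n)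
         ⊜ n ⊞ r) refl (+ n) (sum (ρ n))))
  recover : ∀ k → b ℤ.- + suc n ≡ k → b ≡ + suc n ℤ.+ k
  recover k refl = IntSolver.solve 2 (λ b n → b ⊜ n ⊞ (b ⊟ n)) refl b (+ suc n)
  go : ∀ k → b ℤ.- + suc n ≡ k → Trailing Θ (b ∷ β)
  go (+ suc k) eq = b ∷ Trailing-weaken (Trailing-StrictPos (Θ ℕ.+ k) s′ (shape (+ suc k) eq)) (ℕ.m≤m+n Θ k)
  go -[1+ k ]  eq = ⊥-elim (ℤ.<⇒≱ (subst (ℤ._< + suc n) (sym (recover -[1+ k ] eq))
    (subst (+ suc n ℤ.+ -[1+ k ] ℤ.<_) (ℤ.+-identityʳ (+ suc n)) (ℤ.+-monoʳ-< (+ suc n) (ℤ.-<+ {k} {0})))) (StrictPos-≥ s))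
  go (+ zero)  eq = whole Θ (trans (recover (+ 0) eq) (ℤ.+-identityʳ (+ suc n))) h
    where
    whole : ∀ Θ → b ≡ + suc n → sum (b ∷ β) ℤ.+ + Θ ≡ + suc n ℤ.+ sum (ρ (suc n)) → Trailing Θ (b ∷ β)
    whole Θ refl h with refl ← StrictPos-ρ s′ a =
      subst (λ z → Trailing z (ρ (suc n))) (sym (ℤ.+-injective (+ℤ-cancelʳ (+ Θ) (+ suc n) (sum (ρ (suc n))) (trans (ℤ.+-comm (+ Θ) (sum (ρ (suc n)))) h)))) base

-- ∏ (1 + u/xⱼ) acts on D as multiplication by Σ η r uʳ.
es-D : ∀ {β : Vec ℤ n} Θ w → StrictPos β → sum β ℤ.+ + Θ ≡ + n ℤ.+ sum (ρ n) →
       (∀ r → Θ ℕ.< r → w r ≃ 0#) → es 1ℤ (λ r δ → w r * D δ) 0 β ≃ dot Θ w η * D β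
es-D {n} {β} Θ w s h p = begin
  es 1ℤ (λ r δ → w r * D δ) 0 β
    ≈⟨ es-cong 1ℤ {F′ = λ r δ → alt δ (λ γ → w r * prod Ez γ)} 0 β (λ r δ → ≃-sym (alt-* δ (w r) (prod Ez))) ⟩
  es 1ℤ (λ r δ → alt δ (λ γ → w r * prod Ez γ)) 0 β
    ≈⟨ ≃-sym (alt-es 1ℤ (λ r γ → w r * prod Ez γ) 0 β) ⟩
  alt β (es 1ℤ (λ r γ → w r * prod Ez γ) 0)
    ≈⟨ alt-es-trailing β w ⟩
  alt β (trailing n w)
    ≈⟨ alt-trailing w (Trailing-StrictPos Θ s h) p ⟩
  dot Θ w η * D β ∎

-- For k ≥ 1 this is det (e_{νᵢ-i+j}) for the hook ν = (k, 1^m). The case k = 1 is `η (suc m)`, and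
-- expanding along the row of the arm trades a box of the leg for a box of the arm; iterating gives
-- the relation between `e` and `η`.
τ : ℕ → ℕ → PS
τ k m = alt (+ (m ℕ.+ k) ∷ ρ m) prod₁

private
  first-row : ∀ m k → + (suc m ℕ.+ k) ℤ.- + suc (suc m) ℤ.+ 1ℤ ≡ + k
  first-row m k = IntSolver.solve 2 (λ m k → (IntSolver.con 1ℤ ⊞ (m ⊞ k)) ⊟ (IntSolver.con (+ 2) ⊞ m) ⊞ IntSolver.con 1ℤ ⊜ k) refl (+ m) (+ k)

τ-suc : ∀ k m → τ k (suc m) ≃ e k * η (suc m) - τ (suc k) m
τ-suc k m = begin
  τ k (suc m)
    ≈⟨ alt-cong (x ∷ ρ (suc m)) prod₁ (slot f prod₁) (λ { (c ∷ γ) → ≃-refl }) ⟩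
  alt (x ∷ ρ (suc m)) (slot f prod₁)
    ≈⟨ alt-slot (x ∷ ρ (suc m)) f prod₁ ⟩
  f x * η (suc m) - pick (ρ (suc m)) (λ c γ → f c * alt (x ∷ γ) prod₁)
    ≈⟨ +-cong (*-congʳ (≃-reflexive (cong Ez (first-row m k)))) (-‿cong
         (pick-head (ρ m) (λ c γ → f c * alt (x ∷ γ) prod₁) (ρ≤ m) λ c γ p →
            annihilateˡ (≃-trans (≃-reflexive (cong Ez (raise-ρ′ c (suc m)))) (Ez-negative (ℤ.≤-<-trans p (ℤ.+<+ ℕ.≤-refl)))))) ⟩
  e k * η (suc m) - f (+ suc m) * alt (x ∷ ρ m) prod₁
    ≈⟨ +-congˡ (-‿cong (≃-trans (*-cong (≃-trans (≃-reflexive (cong Ez (raise-ρ′ (+ suc m) (suc m)))) (Ez-zero (suc m)))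
         (≃-reflexive (cong (λ z → alt (+ z ∷ ρ m) prod₁) (sym (ℕ.+-suc m k))))) (*-identityˡ _))) ⟩
  e k * η (suc m) - τ (suc k) m ∎
  where
  x = + (suc m ℕ.+ k)
  f : ℤ → PS
  f c = Ez (c ℤ.- + suc (suc m) ℤ.+ 1ℤ)

τ-conv : ∀ k m → τ k m ≃ conv (λ i → sgn i * e (k ℕ.+ i)) η m
τ-conv k zero = ≃-trans (*-identityʳ _) (≃-trans (≃-reflexive (trans
    (cong Ez (IntSolver.solve 1 (λ k → k ⊟ IntSolver.con 1ℤ ⊞ IntSolver.con 1ℤ ⊜ k) refl (+ k)))
    (cong e (sym (ℕ.+-identityʳ k)))))
  (≃-sym (≃-trans (*-identityʳ _) (*-identityˡ _))))
τ-conv k (suc m) = begin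
  τ k (suc m)
    ≈⟨ τ-suc k m ⟩
  e k * η (suc m) - τ (suc k) m
    ≈⟨ +-cong (*-congʳ (≃-trans (≃-reflexive (cong e (sym (ℕ.+-identityʳ k)))) (≃-sym (*-identityˡ _)))) (≃-trans
         (-‿cong (τ-conv (suc k) m)) negate) ⟩
  conv (λ i → sgn i * e (k ℕ.+ i)) η (suc m) ∎
  where
  negate : - conv (λ i → sgn i * e (suc k ℕ.+ i)) η m ≃ conv (λ i → sgn (suc i) * e (k ℕ.+ suc i)) η m
  negate = ≃-sym (≃-trans
    (conv-cong {g = η} (λ i → ≃-trans (*-assoc _ _ _) (*-congˡ {x = - 1#} (*-congˡ (≃-reflexive (cong e (ℕ.+-suc k i)))))) (λ _ → ≃-refl) m)
    (≃-trans (conv-scale (- 1#) (λ i → sgn i * e (suc k ℕ.+ i)) η m)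
      (solve 1 (λ x → :- con 1ℤ :* x := :- x) ≃-refl (conv (λ i → sgn i * e (suc k ℕ.+ i)) η m))))

ē : ℕ → PS
ē r = sgn r * e r

conv-ē-η : ∀ n → conv ē η n ≃ δ₀ n
conv-ē-η zero    = solve 0 (con 1ℤ :* con 1ℤ :* con 1ℤ := con 1ℤ) ≃-refl
conv-ē-η (suc m) = begin
  1# * 1# * η (suc m) + conv (λ i → sgn (suc i) * e (suc i)) η m
    ≈⟨ +-congˡ (≃-trans (conv-cong {g = η} (λ i → *-assoc (- 1#) (sgn i) (e (suc i))) (λ _ → ≃-refl) m)
         (≃-trans (conv-scale (- 1#) (λ i → sgn i * e (1 ℕ.+ i)) η m) (*-congˡ (≃-sym (τ-conv 1 m))))) ⟩
  1# * 1# * η (suc m) + - 1# * τ 1 m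
    ≈⟨ +-congˡ (*-congˡ (≃-reflexive (cong (λ z → alt (+ z ∷ ρ m) prod₁) (ℕ.+-comm m 1)))) ⟩
  1# * 1# * η (suc m) + - 1# * η (suc m)
    ≈⟨ solve 1 (λ x → con 1ℤ :* con 1ℤ :* x :+ :- con 1ℤ :* x := con 0ℤ) ≃-refl (η (suc m)) ⟩
  0# ∎

-- The scalar factor

-- Comparing coefficients in C′(z) = C(z) Σ η r z^{2r} with C(z) = C′(qz) gives (1 - q^l) C′_l =
-- Σ_{r ≥ 1} η r C_{l-2r}. Seen from l + 1, the index 2(r+1) lies r + (r+1) steps back from l; steps
-- beyond the start get the default 0.
C-history : ℕ → ℕ → PS
C-history = hist 1# 0# λ l h → qp (suc l) * (recip l * dot l (η ∘ suc) (λ r → h (r ℕ.+ suc r)))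

-- Generating functions: ∑ C′ k zᵏ = ∏_{i ≤ j} 1/(1 - z² q^{i+j}), and
-- C k = qᵏ C′ k.
C C′ : ℕ → PS
C l = C-history l 0
C′ zero    = 1#
C′ (suc l) = recip l * dot l (η ∘ suc) (λ r → C-history l (r ℕ.+ suc r))

Cz C′z Kz : ℤ → PS
Cz (+ n)     = C n
Cz -[1+ _ ]  = 0#
C′z (+ n)    = C′ n
C′z -[1+ _ ] = 0#
Kz (+ n)     = qp n * C n
Kz -[1+ _ ]  = 0#

C≃q*C′ : ∀ n → C n ≃ qp n * C′ n
C≃q*C′ zero    = ≃-sym (*-identityˡ 1#)
C≃q*C′ (suc n) = ≃-refl

down : ℤ → ℕ → ℤ
down z r = z ℤ.- + (r ℕ.+ r)

down-+ : ∀ z r t → down (down z r) t ≡ down z (r ℕ.+ t)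
down-+ z r t = IntSolver.solve 3 (λ z r t → z ⊟ (r ⊞ r) ⊟ (t ⊞ t) ⊜ z ⊟ ((r ⊞ t) ⊞ (r ⊞ t))) refl z (+ r) (+ t)

down-zero : ∀ z → down z 0 ≡ z
down-zero = ℤ.+-identityʳ

negative-cases : ∀ {f : ℤ → PS} → (∀ k → f -[1+ k ] ≃ 0#) → ∀ z → z ℤ.< 0ℤ → f z ≃ 0#
negative-cases p -[1+ k ] _ = p k
negative-cases p (+ _) (ℤ.+<+ ())

Cz-negative : ∀ {z} → z ℤ.< 0ℤ → Cz z ≃ 0#
Cz-negative = negative-cases {Cz} (λ _ → ≃-refl) _

Eq-negative : ∀ {z} → z ℤ.< 0ℤ → Eq z ≃ 0#
Eq-negative = negative-cases {Eq} (λ _ → ≃-refl) _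

down-negative : ∀ z T r → z ℤ.≤ + T → T ℕ.< r → down z r ℤ.< 0ℤ
down-negative z T r p T<r = subst (down z r ℤ.<_) (ℤ.+-inverseʳ (+ (r ℕ.+ r)))
  (ℤ.+-monoˡ-< (ℤ.- + (r ℕ.+ r)) (ℤ.≤-<-trans p (ℤ.+<+ (ℕ.<-≤-trans T<r (ℕ.m≤m+n r r)))))

down-≤ : ∀ z r → down z r ℤ.≤ z
down-≤ z r = subst (down z r ℤ.≤_) (ℤ.+-identityʳ z) (ℤ.+-monoʳ-≤ z (ℤ.neg-mono-≤ (ℤ.+≤+ (z≤n {r ℕ.+ r}))))

Cz-down-zero : ∀ z T → z ℤ.≤ + T → ∀ r → T ℕ.< r → Cz (down z r) ≃ 0#
Cz-down-zero z T p r T<r = Cz-negative (down-negative z T r p T<r)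

C-history-Cz : ∀ l s → C-history l s ≡ Cz (l ℤ.⊖ s)
C-history-Cz l s with s ℕ.≤? l
... | yes s≤l = trans (hist-≤ _ _ _ l s s≤l) (cong Cz (sym (ℤ.⊖-≥ s≤l)))
... | no  s≰l = trans (hist-> _ _ _ l s (ℕ.≰⇒> s≰l)) (sym (lemma (s ℕ.∸ l) (ℕ.m<n⇒0<n∸m (ℕ.≰⇒> s≰l))
                   (ℤ.⊖-< (ℕ.≰⇒> s≰l))))
  where
  lemma : ∀ m → 0 ℕ.< m → l ℤ.⊖ s ≡ ℤ.- (+ m) → Cz (l ℤ.⊖ s) ≡ 0#
  lemma (suc m) _ eq = cong Cz eq

private
  C′-dot-suc : ∀ l → C′ (suc l) ≃ dot (suc l) η (λ r → Cz (down (+ suc l) r))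
  C′-dot-suc l = ≃-sym (begin
    1# * Cz (down (+ suc l) 0) + dot l (η ∘ suc) (λ r → Cz (down (+ suc l) (suc r)))
      ≈⟨ +-cong (≃-trans (*-identityˡ _) (≃-reflexive (cong Cz (down-zero (+ suc l)))))
           (dot-cong l λ r → *-congˡ (≃-reflexive (sym (trans (C-history-Cz l (r ℕ.+ suc r)) (cong Cz (index r)))))) ⟩
    q * qp l * (recip l * s) + s
      ≈⟨ +-congˡ (≃-trans (≃-sym (*-identityˡ s)) (*-congʳ (≃-sym (recip-inverse l)))) ⟩
    q * qp l * (recip l * s) + (1# - q * qp l) * recip l * s
      ≈⟨ solve 4 (λ o x i s → x :* (i :* s) :+ (o :- x) :* i :* s := o :* (i :* s)) ≃-refl 1# (q * qp l) (recip l) s ⟩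
    1# * (recip l * s)
      ≈⟨ *-identityˡ _ ⟩
    C′ (suc l) ∎)
    where
    s = dot l (η ∘ suc) (λ r → C-history l (r ℕ.+ suc r))
    index : ∀ r → l ℤ.⊖ (r ℕ.+ suc r) ≡ down (+ suc l) (suc r)
    index r = sym (ℤ.[1+m]⊖[1+n]≡m⊖n l (r ℕ.+ suc r))

C′-dot : ∀ z T → z ℤ.≤ + T → C′z z ≃ dot T η (λ r → Cz (down z r))
C′-dot -[1+ k ] T p = ≃-sym (dot-zero T _ _ λ r _ → annihilateʳ (Cz-negative
  (ℤ.≤-<-trans (down-≤ -[1+ k ] r) (ℤ.-<+ {n = 0}))))
C′-dot (+ zero) T p = ≃-sym (≃-trans (dot-extend 0 T η (λ r → Cz (down 0ℤ r)) z≤n λ r 0<r →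
  annihilateʳ (Cz-down-zero 0ℤ 0 (ℤ.+≤+ z≤n) r 0<r)) (*-identityˡ _))
C′-dot (+ suc l) T (ℤ.+≤+ p) = ≃-trans (C′-dot-suc l) (≃-sym (dot-extend (suc l) T η (λ r → Cz (down (+ suc l) r)) p λ r l<r →
  annihilateʳ (Cz-down-zero (+ suc l) (suc l) ℤ.≤-refl r l<r)))

C-dot : ∀ z T → z ℤ.≤ + T → Cz z ≃ dot T ē (λ r → C′z (down z r))
C-dot z T p = ≃-sym (begin
  dot T ē (λ r → C′z (down z r))
    ≈⟨ dot-cong T (λ r → *-congˡ (≃-trans (C′-dot (down z r) T (ℤ.≤-trans (down-≤ z r) p))
         (dot-cong T λ t → *-congˡ {x = η t} (≃-reflexive (cong Cz (down-+ z r t)))))) ⟩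
  dot T ē (λ r → dot T η (λ t → Cz (down z (r ℕ.+ t))))
    ≈⟨ dot-dot T ē η (λ r → Cz (down z r)) (Cz-down-zero z T p) ⟩
  dot T (conv ē η) (λ r → Cz (down z r))
    ≈⟨ dot-δ₀ T (conv ē η) (λ r → Cz (down z r)) conv-ē-η ⟩
  Cz (down z 0)
    ≈⟨ ≃-reflexive (cong Cz (down-zero z)) ⟩
  Cz z ∎)

-- The coefficients of E(-qy) and E(-q²y) in y = z². The relation `ēqq-suc` is E(-qy) = (1 - qy)
-- E(-q²y).
ēq ēqq : ℕ → PS
ēq  r = sgn r * (qp r * e r)
ēqq r = ē r * qp (r ℕ.+ r)

ēqq-suc : ∀ r → ēqq (suc r) ≃ ēq (suc r) + q * ēqq r
ēqq-suc r = begin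
  m * s * e′ * (q * qp (r ℕ.+ suc r))
    ≈⟨ *-congˡ (*-congˡ (≃-trans (≃-reflexive (cong qp (ℕ.+-suc r r))) (*-congˡ (pow-+ q r r)))) ⟩
  m * s * e′ * (q * (q * (p * p)))
    ≈⟨ solve 5 (λ s p q e e′ → :- con 1ℤ :* s :* e′ :* (q :* (q :* (p :* p)))
         := :- con 1ℤ :* s :* (q :* p :* (q :* p :* e′ :+ p :* e)) :+ q :* (s :* e :* (p :* p))) ≃-refl s p q (e r) e′ ⟩
  m * s * (q * p * (q * p * e′ + p * e r)) + q * (s * e r * (p * p))
    ≈⟨ +-congʳ (*-congˡ (*-congˡ (≃-sym (e-suc r)))) ⟩
  m * s * (q * p * e′) + q * (s * e r * (p * p))
    ≈⟨ +-congˡ (*-congˡ (*-congˡ (pow-+ q r r))) ⟨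
  m * s * (q * p * e′) + q * (s * e r * qp (r ℕ.+ r)) ∎
  where
  m = - 1#
  s = sgn r
  p = qp r
  e′ = e (suc r)

dot-ēqq : ∀ T a → dot (suc T) ēqq a ≃ dot (suc T) ēq a + q * dot T ēqq (a ∘ suc)
dot-ēqq T a = begin
  ēqq 0 * a 0 + dot T (ēqq ∘ suc) (a ∘ suc)
    ≈⟨ +-cong (*-congʳ (solve 0 (con 1ℤ :* con 1ℤ :* con 1ℤ := con 1ℤ :* (con 1ℤ :* con 1ℤ)) ≃-refl))
         (≃-trans (dot-cong T {a = a ∘ suc} λ r → *-congʳ (ēqq-suc r)) (dot-+ˡ T (ēq ∘ suc) (λ r → q * ēqq r) (a ∘ suc))) ⟩
  ēq 0 * a 0 + (dot T (ēq ∘ suc) (a ∘ suc) + dot T (λ r → q * ēqq r) (a ∘ suc))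
    ≈⟨ ≃-sym (+-assoc _ _ _) ⟩
  dot (suc T) ēq a + dot T (λ r → q * ēqq r) (a ∘ suc)
    ≈⟨ +-congˡ (dot-scale T q ēqq (a ∘ suc)) ⟩
  dot (suc T) ēq a + q * dot T ēqq (a ∘ suc) ∎

-- Replacing z by qz in C(z) = C′(z) E(-z²) gives C(qz) = C(z) E(-q²z²), and `Kz` lists the
-- coefficients of C(qz).
K-dot : ∀ z T → z ℤ.≤ + T → Kz z ≃ dot T ēqq (λ r → Cz (down z r))
K-dot -[1+ k ] T p = ≃-sym (dot-zero T _ _ λ r _ → annihilateʳ (Cz-negative
  (ℤ.≤-<-trans (down-≤ -[1+ k ] r) (ℤ.-<+ {n = 0}))))
K-dot (+ n) T p = begin
  qp n * C n
    ≈⟨ *-congˡ (C-dot (+ n) T p) ⟩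
  qp n * dot T ē (λ r → C′z (down (+ n) r))
    ≈⟨ ≃-sym (dot-scale T (qp n) ē _) ⟩
  dot T (λ r → qp n * ē r) (λ r → C′z (down (+ n) r))
    ≈⟨ dot-cong T (λ r → scale (down (+ n) r) r refl) ⟩
  dot T ēqq (λ r → Cz (down (+ n) r)) ∎
  where
  scale : ∀ z r → down (+ n) r ≡ z → qp n * ē r * C′z z ≃ ēqq r * Cz z
  scale -[1+ k ] r eq = ≃-trans (zeroʳ _) (≃-sym (zeroʳ _))
  scale (+ m) r eq = begin
    qp n * ē r * C′ m
      ≈⟨ *-congʳ (*-congʳ (≃-trans (≃-reflexive (cong qp n≡)) (pow-+ q (r ℕ.+ r) m))) ⟩
    qp (r ℕ.+ r) * qp m * ē r * C′ m
      ≈⟨ solve 4 (λ a b c d → a :* b :* c :* d := c :* a :* (b :* d)) ≃-refl (qp (r ℕ.+ r)) (qp m) (ē r) (C′ m) ⟩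
    ē r * qp (r ℕ.+ r) * (qp m * C′ m)
      ≈⟨ *-congˡ (≃-sym (C≃q*C′ m)) ⟩
    ē r * qp (r ℕ.+ r) * C m ∎
    where
    n≡ : n ≡ r ℕ.+ r ℕ.+ m
    n≡ = ℤ.+-injective (trans (IntSolver.solve 2 (λ n r → n ⊜ r ⊞ (n ⊟ r)) refl (+ n) (+ (r ℕ.+ r)))
           (cong (λ x → + (r ℕ.+ r) ℤ.+ x) eq))

-- C(qz) = C(z) E(-qz²) + q z² C(qz). The step by 2 with a factor q is the one produced by 1/(1 -
-- q/x₁²) on the side of U, which is why `Kz` solves the recursion there.
K-recursion : ∀ z T → z ℤ.≤ + T → Kz z ≃ dot T ēq (λ r → Cz (down z r)) + q * Kz (down z 1)
K-recursion z T p = begin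
  Kz z
    ≈⟨ K-dot z (suc T) (ℤ.≤-trans p (ℤ.+≤+ (ℕ.n≤1+n T))) ⟩
  dot (suc T) ēqq a
    ≈⟨ dot-ēqq T a ⟩
  dot (suc T) ēq a + q * dot T ēqq (a ∘ suc)
    ≈⟨ +-cong (dot-extend T (suc T) ēq a (ℕ.n≤1+n T) λ r T<r → annihilateʳ (Cz-down-zero z T p r T<r))
         (*-congˡ (≃-sym (≃-trans (K-dot (down z 1) T (ℤ.≤-trans (down-≤ z 1) p))
           (dot-cong T λ r → *-congˡ {x = ēqq r} (≃-reflexive (cong Cz (down-+ z 1 r))))))) ⟩
  dot T ēq a + q * Kz (down z 1) ∎
  where
  a : ℕ → PS
  a r = Cz (down z r)

-- The generating series

open import Data.Bool.Base using (Bool; true; false; if_then_else_; _∧_)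
open import Data.Fin.Base as Fin using (Fin; zero; suc; toℕ)
import Data.Fin.Properties as Fin
open import Data.List.Base as List using (List; []; _∷_; _++_; _∷ʳ_)
import Data.List.Properties as List
open import Data.List.Relation.Binary.Permutation.Propositional as ↭ using (_↭_; ↭-reflexive; ↭-trans)
import Data.List.Relation.Binary.Permutation.Propositional.Properties as ↭
import Data.Vec.Properties as Vec
open import Relation.Nullary.Negation using (contradiction; ¬_)
open import Relation.Unary using (Pred; Decidable)

private
  variable
    S S′ : Set

inv : Weight n → Series n → Series n
inv = [1-qx^_]⁻¹*_

at : Series n → Weight n → PS
at f β m = f m β

at-inv : ∀ (α : Weight n) f β → at (inv α f) β ≃ at f β + q * at (inv α f) (β ⊖ α)
at-inv α f β = ≡⇒≃ λ where
  zero    → trans (sym (ℤ.+-identityʳ (f 0 β))) (trans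
    (cong (λ z → f 0 β ℤ.+ z) (sym (q*-zero (at (inv α f) (β ⊖ α))))) (sym (add-coeff _ _ 0)))
  (suc m) → trans (cong (λ z → f (suc m) β ℤ.+ z) (sym (q*-suc (at (inv α f) (β ⊖ α)) m))) (sym (add-coeff _ _ (suc m)))

infix 4 _≐_
_≐_ : Series n → Series n → Set
f ≐ g = ∀ m β → f m β ≡ g m β

inv-cong : ∀ (α : Weight n) {f g} → f ≐ g → inv α f ≐ inv α g
inv-cong α p zero    β = p 0 β
inv-cong α p (suc m) β = cong₂ ℤ._+_ (p (suc m) β) (inv-cong α p m (β ⊖ α))

⊖-comm : ∀ (γ α β : Weight n) → γ ⊖ α ⊖ β ≡ γ ⊖ β ⊖ α
⊖-comm []      []      []      = refl
⊖-comm (c ∷ γ) (a ∷ α) (b ∷ β) = cong₂ _∷_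
  (IntSolver.solve 3 (λ c a b → c ⊟ a ⊟ b ⊜ c ⊟ b ⊟ a) refl c a b) (⊖-comm γ α β)

inv-comm : ∀ (α β : Weight n) f → inv α (inv β f) ≐ inv β (inv α f)
inv-comm α β f zero    γ = refl
inv-comm α β f (suc zero) γ =
  IntSolver.solve 3 (λ x y z → x ⊞ y ⊞ z ⊜ x ⊞ z ⊞ y) refl (f 1 γ) (f 0 (γ ⊖ β)) (f 0 (γ ⊖ α))
inv-comm α β f (suc (suc m)) γ = trans
  (cong (λ z → f (suc (suc m)) γ ℤ.+ x ℤ.+ z) (inv-comm α β f (suc m) (γ ⊖ α)))
  (trans (cong (λ z → f (suc (suc m)) γ ℤ.+ x ℤ.+ (y ℤ.+ z)) (trans (cong (inv β (inv α f) m) (⊖-comm γ α β)) (sym (inv-comm α β f m (γ ⊖ β ⊖ α)))))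
  (trans (IntSolver.solve 4 (λ t x y w → t ⊞ x ⊞ (y ⊞ w) ⊜ t ⊞ y ⊞ (x ⊞ w)) refl (f (suc (suc m)) γ) x y w)
         (cong (λ z → f (suc (suc m)) γ ℤ.+ y ℤ.+ z) (inv-comm α β f (suc m) (γ ⊖ β)))))
  where
  x = inv β f (suc m) (γ ⊖ β)
  y = inv α f (suc m) (γ ⊖ α)
  w = inv α (inv β f) m (γ ⊖ β ⊖ α)

invs : List (Weight n) → Series n → Series n
invs αs f = List.foldr inv f αs

invs-↭ : ∀ {αs βs : List (Weight n)} f → αs ↭ βs → invs αs f ≐ invs βs f
invs-↭ f ↭.refl m γ = refl
invs-↭ f (↭.prep α p) m γ = inv-cong α (invs-↭ f p) m γ
invs-↭ f (↭.swap {xs} {ys} α β p) m γ = trans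
  (inv-cong α (inv-cong β (invs-↭ f p)) m γ) (inv-comm α β (invs ys f) m γ)
invs-↭ f (↭.trans p r) m γ = trans (invs-↭ f p m γ) (invs-↭ f r m γ)

filter-map : ∀ {P : Pred S′ 0ℓ} {Q : Pred S 0ℓ} (P? : Decidable P) (Q? : Decidable Q) (f : S → S′) →
             (∀ x → does (P? (f x)) ≡ does (Q? x)) → ∀ xs →
             List.filter P? (List.map f xs) ≡ List.map f (List.filter Q? xs)
filter-map P? Q? f h []       = refl
filter-map P? Q? f h (x ∷ xs) with does (P? (f x)) | does (Q? x) | h x
... | true  | true  | _ = cong (f x ∷_) (filter-map P? Q? f h xs)
... | false | false | _ = filter-map P? Q? f h xs

filter-all-map : ∀ {Z : Set} {P : Pred S′ 0ℓ} (P? : Decidable P) (f : S → S′) (g : Z → S) →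
                 (∀ z → does (P? (f (g z))) ≡ true) → ∀ zs →
                 List.filter P? (List.map f (List.map g zs)) ≡ List.map f (List.map g zs)
filter-all-map P? f g h []       = refl
filter-all-map P? f g h (z ∷ zs) with does (P? (f (g z))) | h z
... | true | _ = cong (f (g z) ∷_) (filter-all-map P? f g h zs)

≤ᵇ-suc : ∀ m n → (m ℕ.<ᵇ suc n) ≡ (m ℕ.≤ᵇ n)
≤ᵇ-suc zero    n = refl
≤ᵇ-suc (suc m) n = refl

sucs : Fin n × Fin n → Fin (suc n) × Fin (suc n)
sucs (i , j) = suc i , suc j

allFin-suc : ∀ n → List.allFin (suc n) ≡ zero ∷ List.map suc (List.allFin n)
allFin-suc n = cong (zero ∷_) (sym (List.map-tabulate id suc))

filter-pairs : ∀ {P : Pred (Fin (suc n) × Fin (suc n)) 0ℓ} {Q : Pred (Fin n × Fin n) 0ℓ}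
               (P? : Decidable P) (Q? : Decidable Q) →
               (∀ i → does (P? (suc i , zero)) ≡ false) →
               (∀ x → does (P? (sucs x)) ≡ does (Q? x)) →
               List.filter P? (pairs (suc n)) ≡
               List.filter P? (List.map (zero ,_) (zero ∷ List.map suc (List.allFin n))) ++
               List.map sucs (List.filter Q? (pairs n))
filter-pairs {n} P? Q? h₀ h₁ = trans
  (cong (λ l → List.filter P? (List.cartesianProduct l l)) (allFin-suc n))
  (trans (List.filter-++ P? (List.map (zero ,_) ys) _) (cong (List.filter P? (List.map (zero ,_) ys) ++_) (rows (List.allFin n))))
  where
  ys = zero ∷ List.map suc (List.allFin n)
  row : ∀ i → List.filter P? (List.map (suc i ,_) ys) ≡ List.map sucs (List.filter Q? (List.map (i ,_) (List.allFin n)))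
  row i with does (P? (suc i , zero)) | h₀ i
  ... | false | _ = trans (cong (List.filter P?) (trans (sym (List.map-∘ (List.allFin n))) (List.map-∘ (List.allFin n))))
                          (filter-map P? Q? sucs h₁ (List.map (i ,_) (List.allFin n)))
  rows : ∀ is → List.filter P? (List.cartesianProduct (List.map suc is) ys) ≡
                List.map sucs (List.filter Q? (List.cartesianProduct is (List.allFin n)))
  rows []       = refl
  rows (i ∷ is) = trans (List.filter-++ P? (List.map (suc i ,_) ys) _) (trans (cong₂ _++_ (row i) (rows is))
    (trans (sym (List.map-++ sucs (List.filter Q? (List.map (i ,_) (List.allFin n))) _))
           (cong (List.map sucs) (sym (List.filter-++ Q? (List.map (i ,_) (List.allFin n)) _)))))

-- The exponent of x₁^s/xⱼ with xⱼ among the other variables; s is 1 or -1 for the two families of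
-- roots that join x₁ to another variable.
axisRoot : ℤ → Fin n → Weight (suc n)
axisRoot {n} s j = s ∷ 𝟘 n ⊖ ε j

𝟘⊕ : ∀ (β : Weight n) → 𝟘 n ⊕ β ≡ β
𝟘⊕ []      = refl
𝟘⊕ (b ∷ β) = cong₂ _∷_ (ℤ.+-identityˡ b) (𝟘⊕ β)

doubleRoot : ∀ n → Weight (suc n)
doubleRoot n = -[1+ 1 ] ∷ 𝟘 n ⊖ (𝟘 n ⊕ 𝟘 n)

private
  A-root C-root : Fin n × Fin n → Weight n
  A-root     (i , j) = ε i ⊖ ε j
  C-root {n} (r , s) = 𝟘 n ⊖ (ε r ⊕ ε s)

  A-roots C-roots : ∀ n → List (Weight n)
  A-roots n = List.map A-root (List.filter (λ (i , j) → i Fin.<? j) (pairs n))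
  C-roots n = List.map C-root (List.filter (λ (r , s) → r Fin.≤? s) (pairs n))

  map-sucs : ∀ (f : Fin (suc n) × Fin (suc n) → Weight (suc n)) (g : Fin n × Fin n → Weight n) →
             (∀ x → f (sucs x) ≡ 0ℤ ∷ g x) → ∀ xs → List.map f (List.map sucs xs) ≡ List.map (0ℤ ∷_) (List.map g xs)
  map-sucs f g h xs = trans (sym (List.map-∘ xs)) (trans (List.map-cong h xs) (List.map-∘ xs))

  map-zero : ∀ (f : Fin (suc n) × Fin (suc n) → Weight (suc n)) (g : Fin n → Weight (suc n)) →
             (∀ j → f (zero , suc j) ≡ g j) → ∀ xs → List.map f (List.map (zero ,_) (List.map suc xs)) ≡ List.map g xs
  map-zero f g h xs = trans (cong (List.map f) (sym (List.map-∘ xs))) (trans (sym (List.map-∘ xs)) (List.map-cong h xs))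

  A-roots-suc : ∀ n → A-roots (suc n) ≡ List.map (axisRoot 1ℤ) (List.allFin n) ++ List.map (0ℤ ∷_) (A-roots n)
  A-roots-suc n = trans (cong (List.map A-root) (trans
      (filter-pairs (λ (i , j) → i Fin.<? j) (λ (i , j) → i Fin.<? j) (λ _ → refl) (λ _ → refl))
      (cong (_++ List.map sucs (List.filter (λ (i , j) → i Fin.<? j) (pairs n))) (filter-all-map (λ (i , j) → i Fin.<? j) (zero ,_) suc (λ _ → refl) (List.allFin n)))))
    (trans (List.map-++ A-root (List.map (zero ,_) (List.map suc (List.allFin n))) _)
      (cong₂ _++_ (map-zero A-root (axisRoot 1ℤ) (λ _ → refl) (List.allFin n))
                  (map-sucs A-root A-root (λ _ → refl) (List.filter (λ (i , j) → i Fin.<? j) (pairs n)))))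

  C-roots-suc : ∀ n → C-roots (suc n) ≡
    doubleRoot n ∷ List.map (axisRoot -1ℤ) (List.allFin n) ++ List.map (0ℤ ∷_) (C-roots n)
  C-roots-suc n = trans (cong (List.map C-root) (trans
      (filter-pairs (λ (i , j) → i Fin.≤? j) (λ (i , j) → i Fin.≤? j) (λ _ → refl) (λ (i , j) → ≤ᵇ-suc (Fin.toℕ i) (Fin.toℕ j)))
      (cong (_++ List.map sucs (List.filter (λ (i , j) → i Fin.≤? j) (pairs n))) (cong ((zero , zero) ∷_) (filter-all-map (λ (i , j) → i Fin.≤? j) (zero ,_) suc (λ _ → refl) (List.allFin n))))))
    (trans (List.map-++ C-root (List.map (zero ,_) (zero ∷ List.map suc (List.allFin n))) _)
      (cong₂ _++_ (cong (doubleRoot n ∷_) (map-zero C-root (axisRoot -1ℤ) (λ j → cong (λ z → -1ℤ ∷ 𝟘 n ⊖ z) (𝟘⊕ (ε j))) (List.allFin n)))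
                  (map-sucs C-root C-root (λ _ → refl) (List.filter (λ (i , j) → i Fin.≤? j) (pairs n)))))

roots-suc : ∀ n → roots (suc n) ↭
  doubleRoot n ∷ List.map (axisRoot -1ℤ) (List.allFin n)
    ++ List.map (axisRoot 1ℤ) (List.allFin n) ++ List.map (0ℤ ∷_) (roots n)
roots-suc n = ↭-trans (↭-reflexive (trans (cong₂ _++_ (A-roots-suc n) (C-roots-suc n)) (List.++-assoc a a′ _)))
  (↭-trans (↭.++⁺ˡ a (↭.shifts a′ c))
  (↭-trans (↭.shifts a c)
    (↭-reflexive (cong (λ l → c ++ a ++ l) (sym (List.map-++ (0ℤ ∷_) (A-roots n) (C-roots n)))))))
  where
  a  = List.map (axisRoot 1ℤ) (List.allFin n)
  a′ = List.map (0ℤ ∷_) (A-roots n)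
  c  = doubleRoot n ∷ List.map (axisRoot -1ℤ) (List.allFin n)

inc : Fin n → Vec ℤ n → Vec ℤ n
inc j γ = Vec.updateAt γ j (ℤ._+ 1ℤ)

⊖-axis : ∀ (j : Fin n) γ → γ ⊖ (𝟘 n ⊖ ε j) ≡ inc j γ
⊖-axis zero (c ∷ γ) = cong (c ℤ.+ 1ℤ ∷_) (⊖-𝟘𝟘 γ)
  where
  ⊖-𝟘𝟘 : ∀ {n} (γ : Vec ℤ n) → γ ⊖ (𝟘 n ⊖ 𝟘 n) ≡ γ
  ⊖-𝟘𝟘 []      = refl
  ⊖-𝟘𝟘 (c ∷ γ) = cong₂ _∷_ (ℤ.+-identityʳ c) (⊖-𝟘𝟘 γ)
⊖-axis (suc j) (c ∷ γ) = cong₂ _∷_ (ℤ.+-identityʳ c) (⊖-axis j γ)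

-- Multiplication by ∏_{j ∈ js} (1 - q x₁^s/xⱼ), acting on coefficients: the monomial x₁^s/xⱼ refers
-- to the coefficient at b - s and γⱼ + 1.
expand : ℤ → List (Fin n) → (ℤ → Vec ℤ n → PS) → ℤ → Vec ℤ n → PS
expand s []       g = g
expand s (j ∷ js) g = expand s js (λ b γ → g b γ - q * g (b ℤ.- s) (inc j γ))

expand-cong : ∀ s (js : List (Fin n)) {g h} → (∀ b γ → g b γ ≃ h b γ) → ∀ b γ → expand s js g b γ ≃ expand s js h b γ
expand-cong s []       p b γ = p b γ
expand-cong s (j ∷ js) p b γ = expand-cong s js
  (λ b γ → +-cong (p b γ) (-‿cong (*-congˡ (p (b ℤ.- s) (inc j γ))))) b γ

expand-invs : ∀ s (js : List (Fin n)) (f : Series (suc n)) b γ →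
  expand s js (λ b γ → at (invs (List.map (axisRoot s) js) f) (b ∷ γ)) b γ ≃ at f (b ∷ γ)
expand-invs s []       f b γ = ≃-refl
expand-invs s (j ∷ js) f b γ = ≃-trans (expand-cong s js cancel b γ) (expand-invs s js f b γ)
  where
  h = invs (List.map (axisRoot s) js) f
  cancel : ∀ b γ → at (inv (axisRoot s j) h) (b ∷ γ) - q * at (inv (axisRoot s j) h) (b ℤ.- s ∷ inc j γ) ≃ at h (b ∷ γ)
  cancel b γ = ≃-trans
    (+-cong (at-inv (axisRoot s j) h (b ∷ γ)) (-‿cong (*-congˡ (≃-reflexive (cong (λ δ → at (inv (axisRoot s j) h) (b ℤ.- s ∷ δ)) (sym (⊖-axis j γ)))))))
    (solve 2 (λ x y → x :+ y :- y := x) ≃-refl (at h (b ∷ γ)) _)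

expand-suc : ∀ s (js : List (Fin n)) g b c γ →
  expand s (List.map suc js) g b (c ∷ γ) ≡ expand s js (λ b γ → g b (c ∷ γ)) b γ
expand-suc s []       g b c γ = refl
expand-suc s (j ∷ js) g b c γ = expand-suc s js _ b c γ

expand-es : ∀ s (g : ℤ → Vec ℤ n → PS) b γ →
  expand s (List.allFin n) g b γ ≃ es 1ℤ (λ r γ → pow (- q) r * g (b ℤ.- s ℤ.* + r) γ) 0 γ
expand-es {zero} s g b [] = ≃-sym (≃-trans (*-identityˡ _)
  (≃-reflexive (cong (λ z → g z []) (trans (cong (λ z → b ℤ.- z) (ℤ.*-zeroʳ s)) (ℤ.+-identityʳ b)))))
expand-es {suc n} s g b (c ∷ γ) = begin
  expand s (List.allFin (suc n)) g b (c ∷ γ)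
    ≈⟨ ≃-reflexive (trans (cong (λ l → expand s l g b (c ∷ γ)) (allFin-suc n)) (expand-suc s (List.allFin n) _ b c γ)) ⟩
  expand s (List.allFin n) (λ b γ → g b (c ∷ γ) - q * g (b ℤ.- s) (c ℤ.+ 1ℤ ∷ γ)) b γ
    ≈⟨ expand-es s _ b γ ⟩
  es 1ℤ (λ r γ → pow (- q) r * (g (h r) (c ∷ γ) - q * g (h r ℤ.- s) (c ℤ.+ 1ℤ ∷ γ))) 0 γ
    ≈⟨ es-cong 1ℤ {F′ = λ r γ → pow (- q) r * g (h r) (c ∷ γ) + pow (- q) (suc r) * g (h (suc r)) (c ℤ.+ 1ℤ ∷ γ)} 0 γ (λ r γ →
         ≃-trans (solve 4 (λ p q x y → p :* (x :- q :* y) := p :* x :+ :- q :* p :* y) ≃-refl (pow (- q) r) q (g (h r) (c ∷ γ)) (g (h r ℤ.- s) (c ℤ.+ 1ℤ ∷ γ)))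
           (+-congˡ (*-congˡ (≃-reflexive (cong (λ z → g z (c ℤ.+ 1ℤ ∷ γ)) (next r)))))) ⟩
  es 1ℤ (λ r γ → pow (- q) r * g (h r) (c ∷ γ) + pow (- q) (suc r) * g (h (suc r)) (c ℤ.+ 1ℤ ∷ γ)) 0 γ
    ≈⟨ es-+ 1ℤ (λ r γ → pow (- q) r * g (h r) (c ∷ γ)) (λ r γ → pow (- q) (suc r) * g (h (suc r)) (c ℤ.+ 1ℤ ∷ γ)) 0 γ ⟩
  _ ∎
  where
  h : ℕ → ℤ
  h r = b ℤ.- s ℤ.* + r
  next : ∀ r → h r ℤ.- s ≡ h (suc r)
  next r = IntSolver.solve 3 (λ b s r → b ⊟ s ⊠ r ⊟ s ⊜ b ⊟ s ⊠ (IntSolver.con 1ℤ ⊞ r)) refl b s (+ r)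

es-invs : ∀ s (f : Series (suc n)) b γ →
  es 1ℤ (λ r γ → pow (- q) r * at (invs (List.map (axisRoot s) (List.allFin n)) f) (b ℤ.- s ℤ.* + r ∷ γ)) 0 γ ≃ at f (b ∷ γ)
es-invs {n} s f b γ = ≃-trans
  (≃-sym (expand-es s (λ b γ → at (invs (List.map (axisRoot s) (List.allFin n)) f) (b ∷ γ)) b γ))
  (expand-invs s (List.allFin n) f b γ)

δz : ℤ → PS
δz (+ zero)  = 1#
δz (+ suc _) = 0#
δz -[1+ _ ]  = 0#

𝟏[_] : ∀ {P : Set} → Dec P → ℤ
𝟏[ d ] = if does d then 1ℤ else 0ℤ

𝟏[]-no : ∀ {P : Set} (d : Dec P) → ¬ P → 𝟏[ d ] ≡ 0ℤ
𝟏[]-no (yes p) ¬p = contradiction p ¬p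
𝟏[]-no (no _)  ¬p = refl

𝟏[]-⇔ : ∀ {P Q : Set} (d : Dec P) (d′ : Dec Q) → (P → Q) → (Q → P) → 𝟏[ d ] ≡ 𝟏[ d′ ]
𝟏[]-⇔ (yes p) (yes _)  f g = refl
𝟏[]-⇔ (yes p) (no ¬r)  f g = contradiction (f p) ¬r
𝟏[]-⇔ (no ¬p) (yes r)  f g = contradiction (g r) ¬p
𝟏[]-⇔ (no _)  (no _)   f g = refl

private
  invs-zero : ∀ (αs : List (Weight n)) m γ → invs (List.map (0ℤ ∷_) αs) one m (0ℤ ∷ γ) ≡ invs αs one m γ
  invs-zero [] zero γ = 𝟏[]-⇔ ((0ℤ ∷ γ) ≟ʷ 𝟘 _) (γ ≟ʷ 𝟘 _) (cong Vec.tail) (cong (0ℤ ∷_))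
  invs-zero [] (suc m) γ = refl
  invs-zero (α ∷ αs) zero    γ = invs-zero αs 0 γ
  invs-zero (α ∷ αs) (suc m) γ = cong₂ ℤ._+_ (invs-zero αs (suc m) γ) (invs-zero (α ∷ αs) m (γ ⊖ α))

  invs-nonzero : ∀ (αs : List (Weight n)) b m γ → b ≢ 0ℤ → invs (List.map (0ℤ ∷_) αs) one m (b ∷ γ) ≡ 0ℤ
  invs-nonzero [] b zero γ ¬p = 𝟏[]-no ((b ∷ γ) ≟ʷ 𝟘 _) (¬p ∘ cong Vec.head)
  invs-nonzero [] b (suc m) γ ¬p = refl
  invs-nonzero (α ∷ αs) b zero    γ ¬p = invs-nonzero αs b 0 γ ¬p
  invs-nonzero (α ∷ αs) b (suc m) γ ¬p = cong₂ ℤ._+_ (invs-nonzero αs b (suc m) γ ¬p)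
    (trans (cong (λ z → invs (List.map (0ℤ ∷_) (α ∷ αs)) one m (z ∷ γ ⊖ α)) (ℤ.+-identityʳ b)) (invs-nonzero (α ∷ αs) b m (γ ⊖ α) ¬p))

at-invs-zero : ∀ (αs : List (Weight n)) b γ → at (invs (List.map (0ℤ ∷_) αs) one) (b ∷ γ) ≃ δz b * at (invs αs one) γ
at-invs-zero αs (+ zero)  γ = ≃-trans (≡⇒≃ λ m → invs-zero αs m γ) (≃-sym (*-identityˡ _))
at-invs-zero αs (+ suc b) γ = ≃-trans (≡⇒≃ λ m → trans (invs-nonzero αs (+ suc b) m γ λ ()) (sym (const-zero m))) (≃-sym (zeroˡ _))
at-invs-zero αs -[1+ b ]  γ = ≃-trans (≡⇒≃ λ m → trans (invs-nonzero αs -[1+ b ] m γ λ ()) (sym (const-zero m))) (≃-sym (zeroˡ _))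

-- The factors with x₁ are attached to the generating series of rank n in stages, ∏ 1/(1 - q x₁/xⱼ)
-- and then ∏ 1/(1 - q/(x₁xⱼ)), so that each stage can be undone by one finite product.
level₁ level₂ : ∀ n → Series (suc n)
level₁ n = invs (List.map (axisRoot 1ℤ) (List.allFin n)) (invs (List.map (0ℤ ∷_) (roots n)) one)
level₂ n = invs (List.map (axisRoot -1ℤ) (List.allFin n)) (level₁ n)

generating-suc : ∀ n → generating (suc n) ≐ inv (doubleRoot n) (level₂ n)
generating-suc n m β = trans (invs-↭ one (roots-suc n) m β)
  (inv-cong (doubleRoot n) (λ m β → cong (λ f → f m β) (trans
     (List.foldr-++ inv one (List.map (axisRoot -1ℤ) (List.allFin n)) _)
     (cong (invs (List.map (axisRoot -1ℤ) (List.allFin n))) (List.foldr-++ inv one (List.map (axisRoot 1ℤ) (List.allFin n)) _)))) m β)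

base-point : Vec ℤ n → Vec ℤ n
base-point {n} γ = γ ⊖ 𝟙 n ⊖ ρ n

es-base-point : ∀ (F : Family n) r γ → es 1ℤ (λ r δ → F r (base-point δ)) r γ ≃ es 1ℤ F r (base-point γ)
es-base-point F r []      = ≃-refl
es-base-point {suc n} F r (c ∷ γ) = +-cong (es-base-point _ r γ)
  (≃-trans (es-cong 1ℤ r γ λ r δ → ≃-reflexive (cong (λ z → F (suc r) (z ∷ base-point δ))
     (IntSolver.solve 2 (λ c x → c ⊞ IntSolver.con 1ℤ ⊟ IntSolver.con 1ℤ ⊟ x ⊜ c ⊟ IntSolver.con 1ℤ ⊟ x ⊞ IntSolver.con 1ℤ) refl c (+ suc n))))
   (es-base-point (λ r δ → F (suc r) (c ℤ.- 1ℤ ℤ.- + suc n ℤ.+ 1ℤ ∷ δ)) r γ))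

Û : Vec ℤ n → PS
Û {n} β = alt β (λ γ → at (generating n) (base-point γ))

-- The exponent of x₁ is held fixed while the other variables are antisymmetrized; this is a single
-- term of the expansion of `Û` along x₁.
partial : Series (suc n) → ℤ → Vec ℤ n → PS
partial f b γ = alt γ (λ δ → at f (b ∷ base-point δ))

private
  es-partial : ∀ (f : Series (suc n)) (σ : ℕ → ℤ) γ →
    es 1ℤ (λ r δ → pow (- q) r * partial f (σ r) δ) 0 γ ≃
    alt γ (λ δ → es 1ℤ (λ r δ → pow (- q) r * at f (σ r ∷ δ)) 0 (base-point δ))
  es-partial f σ γ = begin
    es 1ℤ (λ r δ → pow (- q) r * partial f (σ r) δ) 0 γ
      ≈⟨ es-cong 1ℤ {F′ = λ r δ → alt δ (λ ζ → pow (- q) r * at f (σ r ∷ base-point ζ))} 0 γ (λ r δ → ≃-sym (alt-* δ (pow (- q) r) _)) ⟩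
    es 1ℤ (λ r δ → alt δ (λ ζ → pow (- q) r * at f (σ r ∷ base-point ζ))) 0 γ
      ≈⟨ ≃-sym (alt-es 1ℤ (λ r ζ → pow (- q) r * at f (σ r ∷ base-point ζ)) 0 γ) ⟩
    alt γ (es 1ℤ (λ r ζ → pow (- q) r * at f (σ r ∷ base-point ζ)) 0)
      ≈⟨ alt-cong γ _ _ (es-base-point (λ r δ → pow (- q) r * at f (σ r ∷ δ)) 0) ⟩
    alt γ (λ δ → es 1ℤ (λ r δ → pow (- q) r * at f (σ r ∷ δ)) 0 (base-point δ)) ∎

es-level₁ : ∀ b (γ : Vec ℤ n) → es 1ℤ (λ r δ → pow (- q) r * partial (level₁ n) (b ℤ.- + r) δ) 0 γ ≃ δz b * Û γ
es-level₁ {n} b γ = begin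
  _ ≈⟨ es-partial (level₁ n) (λ r → b ℤ.- + r) γ ⟩
  alt γ (λ δ → es 1ℤ (λ r δ → pow (- q) r * at (level₁ n) (b ℤ.- + r ∷ δ)) 0 (base-point δ))
    ≈⟨ alt-cong γ _ (λ δ → δz b * at (generating n) (base-point δ)) (λ δ → ≃-trans (es-cong 1ℤ 0 (base-point δ) λ r ζ → *-congˡ (≃-reflexive
         (cong (λ z → at (level₁ n) (b ℤ.- z ∷ ζ)) (sym (ℤ.*-identityˡ (+ r))))))
         (≃-trans (es-invs 1ℤ (invs (List.map (0ℤ ∷_) (roots n)) one) b (base-point δ)) (at-invs-zero (roots n) b (base-point δ)))) ⟩
  alt γ (λ δ → δz b * at (generating n) (base-point δ))
    ≈⟨ alt-* γ (δz b) _ ⟩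
  δz b * Û γ ∎

es-level₂ : ∀ b (γ : Vec ℤ n) → es 1ℤ (λ r δ → pow (- q) r * partial (level₂ n) (b ℤ.+ + r) δ) 0 γ ≃ partial (level₁ n) b γ
es-level₂ {n} b γ = ≃-trans (es-partial (level₂ n) (λ r → b ℤ.+ + r) γ)
  (alt-cong γ _ _ λ δ → ≃-trans (es-cong 1ℤ 0 (base-point δ) λ r ζ → *-congˡ (≃-reflexive
         (cong (λ z → at (level₂ n) (z ∷ ζ)) (IntSolver.solve 2 (λ b r → b ⊞ r ⊜ b ⊟ IntSolver.con -1ℤ ⊠ r) refl b (+ r)))))
         (es-invs -1ℤ (level₁ n) b (base-point δ)))

partial-generating : ∀ b (γ : Vec ℤ n) → partial (generating (suc n)) b γ ≃
  partial (level₂ n) b γ + q * partial (generating (suc n)) (b ℤ.+ + 2) γ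
partial-generating {n} b γ = begin
  partial (generating (suc n)) b γ
    ≈⟨ alt-cong γ _ (λ δ → at (level₂ n) (b ∷ base-point δ) + q * at (generating (suc n)) (b ℤ.+ + 2 ∷ base-point δ)) (λ δ →
        ≃-trans (≡⇒≃ λ m → generating-suc n m (b ∷ base-point δ)) (≃-trans (at-inv (doubleRoot n) (level₂ n) (b ∷ base-point δ))
          (+-congˡ (*-congˡ (≡⇒≃ λ m → trans (cong (λ z → inv (doubleRoot n) (level₂ n) m (b ℤ.+ + 2 ∷ z)) (⊖𝟘 (base-point δ)))
             (sym (generating-suc n m (b ℤ.+ + 2 ∷ base-point δ)))))))) ⟩
  alt γ (λ δ → at (level₂ n) (b ∷ base-point δ) + q * at (generating (suc n)) (b ℤ.+ + 2 ∷ base-point δ))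
    ≈⟨ alt-+ γ _ _ ⟩
  partial (level₂ n) b γ + alt γ (λ δ → q * at (generating (suc n)) (b ℤ.+ + 2 ∷ base-point δ))
    ≈⟨ +-congˡ (alt-* γ q _) ⟩
  _ ∎
  where
  ⊖𝟘 : ∀ {n} (γ : Vec ℤ n) → γ ⊖ (𝟘 n ⊖ (𝟘 n ⊕ 𝟘 n)) ≡ γ
  ⊖𝟘 []      = refl
  ⊖𝟘 (c ∷ γ) = cong₂ _∷_ (ℤ.+-identityʳ c) (⊖𝟘 γ)

Û-suc : ∀ (β : Vec ℤ (suc n)) → Û β ≃ pick β (λ c γ → partial (generating (suc n)) (c ℤ.- 1ℤ ℤ.- + suc n) γ)
Û-suc β = ≃-refl

-- Evaluation of U

record Divisible (k : ℕ) (x : PS) : Set where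
  constructor divides
  field
    quotient : PS
    equality : x ≃ qp k * quotient

Divisible-+ : ∀ {k x y} → Divisible k x → Divisible k y → Divisible k (x + y)
Divisible-+ (divides u p) (divides v r) = divides (u + v) (≃-trans (+-cong p r) (≃-sym (distribˡ _ u v)))

Divisible-* : ∀ {k x} y → Divisible k x → Divisible k (y * x)
Divisible-* {k} y (divides u p) = divides (y * u) (≃-trans (*-congˡ p)
  (x∙yz≈y∙xz y (qp k) u))

Divisible-cong : ∀ {k x y} → x ≃ y → Divisible k y → Divisible k x
Divisible-cong p (divides u r) = divides u (≃-trans p r)

es-Divisible : ∀ {k} s (F : Family n) r β → (∀ r′ γ → Shifted s r β r′ γ → Divisible k (F r′ γ)) → Divisible k (es s F r β)
es-Divisible s F r []      p = p r [] []
es-Divisible s F r (b ∷ β) p = Divisible-+ (es-Divisible s _ r β λ r′ γ x → p r′ (b ∷ γ) (keep x))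
  (Divisible-cong (es-suc s (λ r γ → F r (b ℤ.+ s ∷ γ)) r β)
    (es-Divisible s _ (suc r) β λ r′ γ x → p r′ (b ℤ.+ s ∷ γ) (step x)))

es-Divisible-head : ∀ {k} s (F : Family n) r β →
  (∀ r′ γ → r ℕ.< r′ → Shifted s r β r′ γ → Divisible k (F r′ γ)) → Divisible k (es s F r β - F r β)
es-Divisible-head {k = k} s F r [] p = divides 0# (≃-trans (-‿inverseʳ _) (≃-sym (zeroʳ _)))
es-Divisible-head s F r (b ∷ β) p = Divisible-cong
  (solve 3 (λ x y z → x :+ y :- z := x :- z :+ y) ≃-refl _ _ (F r (b ∷ β)))
  (Divisible-+ (es-Divisible-head s (λ r γ → F r (b ∷ γ)) r β λ r′ γ l x → p r′ (b ∷ γ) l (keep x))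
    (Divisible-cong (es-suc s (λ r γ → F r (b ℤ.+ s ∷ γ)) r β)
      (es-Divisible s _ (suc r) β λ r′ γ x → p r′ (b ℤ.+ s ∷ γ) (Shifted-≤ x) (step x))))

nq : ℕ → PS
nq = pow (- q)

private
  All-Shifted : ∀ {b r r′} {β γ : Vec ℤ n} → All (ℤ._< b) β → Shifted 1ℤ r β r′ γ → All (ℤ._≤ b) γ
  All-Shifted []       []       = []
  All-Shifted (p ∷ ps) (keep x) = ℤ.<⇒≤ p ∷ All-Shifted ps x
  All-Shifted {b = b} (p ∷ ps) (step {b = c} x) = subst (ℤ._≤ b) (ℤ.+-comm 1ℤ c) (ℤ.i<j⇒suc[i]≤j p) ∷ All-Shifted ps x

StrictPos-cons : ∀ {b} {γ : Vec ℤ n} → 0ℤ ℤ.< b → All (ℤ._≤ b) γ → StrictPos γ → StrictPos (b ∷ γ) ⊎ AdjEq (b ∷ γ)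
StrictPos-cons p [] s = inj₁ (cons p [] s)
StrictPos-cons {b = b} {c ∷ γ} p (c≤b ∷ _) s@(cons _ a _) with c ℤ.≟ b
... | yes refl = inj₂ here
... | no c≢b   = inj₁ (cons p (c<b ∷ All.map (λ y → ℤ.<-trans y c<b) a) s)
  where c<b = ℤ.≤∧≢⇒< c≤b c≢b

-- Entries differ by at least 1 and rise by at most 1, so strictness can only be lost by a tie of
-- neighbours, and there alternating functions vanish.
StrictPos-Shifted : ∀ {r r′} {β γ : Vec ℤ n} → StrictPos β → Shifted 1ℤ r β r′ γ → StrictPos γ ⊎ AdjEq γ
StrictPos-Shifted [] [] = inj₁ []
StrictPos-Shifted (cons p a s) (keep x) with StrictPos-Shifted s x
... | inj₁ s′ = StrictPos-cons p (All-Shifted a x) s′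
... | inj₂ y  = inj₂ (there y)
StrictPos-Shifted (cons {b = b} p a s) (step x) with StrictPos-Shifted s x
... | inj₁ s′ = StrictPos-cons (ℤ.<-trans p b<b+1) (All.map (λ y → ℤ.<⇒≤ (ℤ.≤-<-trans y b<b+1)) (All-Shifted a x)) s′
  where
  b<b+1 : b ℤ.< b ℤ.+ 1ℤ
  b<b+1 = subst (b ℤ.<_) (ℤ.+-comm 1ℤ b) (ℤ.suc[i]≤j⇒i<j ℤ.≤-refl)
... | inj₂ y  = inj₂ (there y)

-- The operator ∏ (1 - q x₁^{±1}/xⱼ) is the identity modulo q, hence
-- injective on functions that alternate.
es-injective : ∀ (σ : ℤ → ℕ → ℤ) → (∀ b → σ b 0 ≡ b) → ∀ (f g : ℤ → Vec ℤ n → PS) →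
  (∀ b {γ} → AdjEq γ → f b γ ≃ g b γ) →
  (∀ b γ → StrictPos γ → es 1ℤ (λ r δ → nq r * f (σ b r) δ) 0 γ ≃ es 1ℤ (λ r δ → nq r * g (σ b r) δ) 0 γ) →
  ∀ b γ → StrictPos γ → f b γ ≃ g b γ
es-injective {n} σ σ₀ f g adj h b γ s = ≃-trans
  (solve 2 (λ x y → x := x :- y :+ y) ≃-refl (f b γ) (g b γ))
  (≃-trans (+-congʳ (separated (f b γ - g b γ) λ k → let divides y p = divisible k b γ s in y , p)) (+-identityˡ _))
  where
  F : ℤ → Family n
  F b r δ = nq r * (f (σ b r) δ - g (σ b r) δ)
  total : ∀ b γ → StrictPos γ → es 1ℤ (F b) 0 γ ≃ 0#
  total b γ s = begin
    es 1ℤ (F b) 0 γ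
      ≈⟨ es-cong 1ℤ {F′ = λ r δ → nq r * f (σ b r) δ + - (nq r * g (σ b r) δ)} 0 γ (λ r δ →
           solve 3 (λ p x y → p :* (x :- y) := p :* x :- p :* y) ≃-refl (nq r) (f (σ b r) δ) (g (σ b r) δ)) ⟩
    es 1ℤ (λ r δ → nq r * f (σ b r) δ + - (nq r * g (σ b r) δ)) 0 γ
      ≈⟨ es-+ 1ℤ (λ r δ → nq r * f (σ b r) δ) (λ r δ → - (nq r * g (σ b r) δ)) 0 γ ⟩
    es 1ℤ (λ r δ → nq r * f (σ b r) δ) 0 γ + es 1ℤ (λ r δ → - (nq r * g (σ b r) δ)) 0 γ
      ≈⟨ +-cong (h b γ s) (es-neg 1ℤ (λ r δ → nq r * g (σ b r) δ) 0 γ) ⟩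
    es 1ℤ (λ r δ → nq r * g (σ b r) δ) 0 γ - es 1ℤ (λ r δ → nq r * g (σ b r) δ) 0 γ
      ≈⟨ -‿inverseʳ _ ⟩
    0# ∎
  -- The summand of the empty subset is the difference itself. All others carry a factor q from `nq`
  -- and, by induction, q^k from the difference at a shifted point.
  divisible : ∀ k b γ → StrictPos γ → Divisible k (f b γ - g b γ)
  divisible zero    b γ s = divides _ (≃-sym (*-identityˡ _))
  divisible (suc k) b γ s = Divisible-cong
    (begin
      f b γ - g b γ
        ≈⟨ ≃-reflexive (cong (λ z → f z γ - g z γ) (sym (σ₀ b))) ⟩
      f (σ b 0) γ - g (σ b 0) γ
        ≈⟨ solve 1 (λ x → x := :- con 1ℤ :* (con 0ℤ :- con 1ℤ :* x)) ≃-refl _ ⟩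
      - 1# * (0# - F b 0 γ)
        ≈⟨ *-congˡ (+-congʳ (≃-sym (total b γ s))) ⟩
      - 1# * (es 1ℤ (F b) 0 γ - F b 0 γ) ∎)
    (Divisible-* (- 1#) (es-Divisible-head 1ℤ (F b) 0 γ term))
    where
    difference : ∀ b δ → StrictPos δ ⊎ AdjEq δ → Divisible k (f b δ - g b δ)
    difference b δ (inj₁ s) = divisible k b δ s
    difference b δ (inj₂ a) = divides 0# (≃-trans (+-congʳ (adj b a)) (≃-trans (-‿inverseʳ _) (≃-sym (zeroʳ _))))
    term : ∀ r δ → 0 ℕ.< r → Shifted 1ℤ 0 γ r δ → Divisible (suc k) (F b r δ)
    term (suc r) δ _ x with difference (σ b (suc r)) δ (StrictPos-Shifted s x)
    ... | divides y p = divides (- (nq r * y)) (≃-trans (*-congˡ p)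
      (solve 4 (λ q n k y → :- q :* n :* (k :* y) := q :* k :* :- (n :* y)) ≃-refl q (nq r) (qp k) y))

-- For γ = λ + ρ this is n - |λ|, the degree in z at which coefficients are taken. Each added box
-- lowers it by 1.
θ : Vec ℤ n → ℤ
θ {n} γ = + n ℤ.+ sum (ρ n) ℤ.- sum γ

θ-Shifted : ∀ {r r′} {β γ : Vec ℤ n} → Shifted 1ℤ r β r′ γ → θ γ ≡ θ β ℤ.+ + r ℤ.- + r′
θ-Shifted {n} {r} {r′} {β} {γ} x = trans
  (IntSolver.solve 3 (λ u γ r → u ⊟ γ ⊜ u ⊟ (γ ⊞ r) ⊞ r) refl u (sum γ) (+ r))
  (trans (cong (λ z → u ℤ.- z ℤ.+ + r) (Shifted-sum x))
    (IntSolver.solve 4 (λ u β r r′ → u ⊟ (β ⊞ r′) ⊞ r ⊜ u ⊟ β ⊞ r ⊟ r′) refl u (sum β) (+ r) (+ r′)))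
  where u = + n ℤ.+ sum (ρ n)

θ-complement : ∀ (β : Vec ℤ n) {z} → θ β ≡ z → sum β ℤ.+ z ≡ + n ℤ.+ sum (ρ n)
θ-complement {n} β refl = IntSolver.solve 2 (λ β u → β ⊞ (u ⊟ β) ⊜ u) refl (sum β) (+ n ℤ.+ sum (ρ n))

θ≤ : ∀ {β : Vec ℤ n} → StrictPos β → θ β ℤ.≤ + n
θ≤ {n} {β} s = bound (θ β) refl
  where
  bound : ∀ z → θ β ≡ z → z ℤ.≤ + n
  bound -[1+ _ ] _ = ℤ.-≤+
  bound (+ Θ) eq = ℤ.+≤+ (Trailing-≤ (Trailing-StrictPos Θ s (θ-complement β eq)))

es-D-θ : ∀ {β : Vec ℤ n} w → StrictPos β → (∀ r → θ β ℤ.< + r → w r ≃ 0#) →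
         es 1ℤ (λ r δ → w r * D δ) 0 β ≃ dot n w η * D β
es-D-θ {n} {β} w s p = go (θ β) refl
  where
  go : ∀ z → θ β ≡ z → es 1ℤ (λ r δ → w r * D δ) 0 β ≃ dot n w η * D β
  go -[1+ k ] eq = ≃-trans
    (es-zero 1ℤ _ 0 β λ r δ _ → annihilateˡ (vanish r))
    (≃-sym (annihilateˡ (dot-zero n w η λ r _ → annihilateˡ (vanish r))))
    where
    vanish : ∀ r → w r ≃ 0#
    vanish r = p r (subst (ℤ._< + r) (sym eq) ℤ.-<+)
  go (+ Θ) eq = ≃-trans (es-D Θ w s (θ-complement β eq) vanish)
    (*-congʳ (≃-sym (dot-extend Θ n w η Θ≤n λ r l → annihilateˡ (vanish r l))))
    where
    vanish : ∀ r → Θ ℕ.< r → w r ≃ 0#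
    vanish r l = p r (subst (ℤ._< + r) (sym eq) (ℤ.+<+ l))
    Θ≤n : Θ ℕ.≤ n
    Θ≤n = ℤ.drop‿+≤+ (subst (ℤ._≤ + n) eq (θ≤ s))

Eq*-zero : ∀ b {x} → (0ℤ ℤ.≤ b → x ≃ 0#) → Eq b * x ≃ 0#
Eq*-zero (+ n)    p = annihilateʳ (p (ℤ.+≤+ z≤n))
Eq*-zero -[1+ _ ] p = zeroˡ _

Eqn : ℕ → PS
Eqn r = Eq (+ r)

-- E(qu) and its inverse: substituting -qu for u in Σ η r u^r = 1/E(-u) produces the factor (-q)^r.
conv-nqη-Eqn : ∀ p → conv (λ r → nq r * η r) Eqn p ≃ δ₀ p
conv-nqη-Eqn p = begin
  conv (λ r → nq r * η r) Eqn p
    ≈⟨ conv-cong {g = Eqn} (λ r → ≃-trans (*-congʳ (≃-trans (pow-cong r (solve 1 (λ q → :- q := q :* :- con 1ℤ) ≃-refl q)) (pow-* q (- 1#) r))) (*-assoc _ _ _))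
         (λ _ → ≃-refl) p ⟩
  conv (λ r → qp r * (sgn r * η r)) (λ r → qp r * e r) p
    ≈⟨ conv-pow q (λ r → sgn r * η r) e p ⟩
  qp p * conv (λ r → sgn r * η r) e p
    ≈⟨ *-congˡ (conv-cong {f = λ r → sgn r * η r} {g = e} {g′ = λ r → sgn r * ē r} (λ _ → ≃-refl) (λ r → ≃-trans (≃-sym (*-identityˡ (e r)))
         (≃-trans (*-congʳ (≃-sym (sgn² r))) (*-assoc _ _ _))) p) ⟩
  qp p * conv (λ r → sgn r * η r) (λ r → sgn r * ē r) p
    ≈⟨ *-congˡ (≃-trans (conv-pow (- 1#) η ē p) (*-congˡ (≃-trans (conv-comm η ē p) (conv-ē-η p)))) ⟩
  qp p * (sgn p * δ₀ p)
    ≈⟨ unit p ⟩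
  δ₀ p ∎
  where
  sgn² : ∀ r → sgn r * sgn r ≃ 1#
  sgn² zero    = *-identityˡ 1#
  sgn² (suc r) = ≃-trans (solve 1 (λ s → :- con 1ℤ :* s :* (:- con 1ℤ :* s) := s :* s) ≃-refl (sgn r)) (sgn² r)
  unit : ∀ p → qp p * (sgn p * δ₀ p) ≃ δ₀ p
  unit zero    = solve 0 (con 1ℤ :* (con 1ℤ :* con 1ℤ) := con 1ℤ) ≃-refl
  unit (suc p) = annihilateʳ (zeroʳ _)

-- A₁ n b z and A₂ n b z are the coefficients of xᵇ zᶻ in C(z) E(qzx) and
-- C(z) E(qzx) E(qz/x).
A₁ A₂ : ℕ → ℤ → ℤ → PS
A₁ n b z = Eq b * Cz (z ℤ.- b)
A₂ n b z = dot n Eqn (λ t → Eq (b ℤ.+ + t) * Cz (down (z ℤ.- b) t))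

-- The product ∏ (1 - q x₁/xⱼ) has eigenvalue 1/E(qzx), where z records that each added box lowers
-- `θ`. It cancels the factor E(qzx) and leaves C(z), which has only the power x^0.
A₁-dot : ∀ n b z → z ℤ.≤ + n → dot n (λ r → nq r * A₁ n (b ℤ.- + r) (z ℤ.- + r)) η ≃ δz b * Cz z
A₁-dot n b z z≤n′ = ≃-trans (dot-cong n {a′ = λ _ → Cz (z ℤ.- b)} λ r → ≃-trans (*-congʳ (*-congˡ (*-congˡ (≃-reflexive (cong Cz (cancel r))))))
    (solve 4 (λ p x c h → p :* (x :* c) :* h := p :* h :* x :* c) ≃-refl (nq r) (Eq (b ℤ.- + r)) (Cz (z ℤ.- b)) (η r)))
  (by-cases b refl)
  where
  cancel : ∀ r → z ℤ.- + r ℤ.- (b ℤ.- + r) ≡ z ℤ.- b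
  cancel r = IntSolver.solve 3 (λ z b r → z ⊟ r ⊟ (b ⊟ r) ⊜ z ⊟ b) refl z b (+ r)
  f : ℤ → ℕ → PS
  f b r = nq r * η r * Eq (b ℤ.- + r)
  constant : ∀ m f x → dot m f (λ _ → x) ≃ dot m f (λ _ → 1#) * x
  constant m f x = ≃-trans (dot-cong m {f} {λ r → x * f r} {λ _ → x} {λ _ → 1#} λ r → solve 2 (λ f x → f :* x := x :* f :* con 1ℤ) ≃-refl (f r) x)
    (≃-trans (dot-scale m x f (λ _ → 1#)) (*-comm _ _))
  by-cases : ∀ b′ → b ≡ b′ → dot n (f b) (λ _ → Cz (z ℤ.- b)) ≃ δz b * Cz z
  by-cases -[1+ k ] refl = ≃-trans (dot-zero n _ _ λ r _ → annihilateˡ (annihilateʳ (below r))) (≃-sym (zeroˡ _))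
    where
    below : ∀ r → Eq (-[1+ k ] ℤ.- + r) ≃ 0#
    below r = Eq-negative (ℤ.≤-<-trans (ℤ.i≤j⇒i-k≤j (+ r) (ℤ.≤-refl { -[1+ k ]})) (ℤ.-<+ {n = 0}))
  by-cases (+ p) refl with p ℕ.≤? n
  ... | no p≰n = ≃-trans (dot-zero n _ _ λ r _ → annihilateʳ high) (≃-sym (annihilateˡ (positive p (ℕ.≤-<-trans z≤n (ℕ.≰⇒> p≰n)))))
    where
    high : Cz (z ℤ.- + p) ≃ 0#
    high = Cz-negative (subst (z ℤ.- + p ℤ.<_) (ℤ.+-inverseʳ (+ p))
      (ℤ.+-monoˡ-< (ℤ.- + p) (ℤ.≤-<-trans z≤n′ (ℤ.+<+ (ℕ.≰⇒> p≰n)))))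
    positive : ∀ p → 0 ℕ.< p → δz (+ p) ≃ 0#
    positive (suc p) _ = ≃-refl
  ... | yes p≤n = begin
    dot n (f (+ p)) (λ _ → Cz (z ℤ.- + p))
      ≈⟨ dot-extend p n (f (+ p)) (λ _ → Cz (z ℤ.- + p)) p≤n (λ r l → annihilateˡ (annihilateʳ (beyond r l))) ⟩
    dot p (f (+ p)) (λ _ → Cz (z ℤ.- + p))
      ≈⟨ constant p (f (+ p)) (Cz (z ℤ.- + p)) ⟩
    dot p (f (+ p)) (λ _ → 1#) * Cz (z ℤ.- + p)
      ≈⟨ *-congʳ (≃-trans (dot-cong≤ p λ r r≤p → ≃-trans (*-identityʳ _) (*-congˡ (≃-reflexive (cong Eq (difference r r≤p)))))
           (≃-trans (≃-reflexive (sym (conv-dot (λ r → nq r * η r) Eqn p))) (conv-nqη-Eqn p))) ⟩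
    δ₀ p * Cz (z ℤ.- + p)
      ≈⟨ final p ⟩
    δz (+ p) * Cz z ∎
    where
    beyond : ∀ r → p ℕ.< r → Eq (+ p ℤ.- + r) ≃ 0#
    beyond r l = Eq-negative (subst (+ p ℤ.- + r ℤ.<_) (ℤ.+-inverseʳ (+ r)) (ℤ.+-monoˡ-< (ℤ.- + r) (ℤ.+<+ l)))
    difference : ∀ r → r ℕ.≤ p → + p ℤ.- + r ≡ + (p ℕ.∸ r)
    difference r r≤p = trans (ℤ.m-n≡m⊖n p r) (ℤ.⊖-≥ r≤p)
    final : ∀ p → δ₀ p * Cz (z ℤ.- + p) ≃ δz (+ p) * Cz z
    final zero    = *-congˡ (≃-reflexive (cong Cz (ℤ.+-identityʳ z)))
    final (suc p) = ≃-trans (zeroˡ _) (≃-sym (zeroˡ _))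

-- As for `A₁`, now with eigenvalue 1/E(qz/x). The vanishing beyond n holds because E(qzx) excludes
-- negative powers of x and C excludes negative powers of z.
A₂-dot : ∀ n b z → z ℤ.≤ + n → dot n (λ r → nq r * A₂ n (b ℤ.+ + r) (z ℤ.- + r)) η ≃ A₁ n b z
A₂-dot n b z z≤n′ = begin
  dot n (λ r → nq r * A₂ n (b ℤ.+ + r) (z ℤ.- + r)) η
    ≈⟨ dot-cong n (λ r → ≃-trans (solve 3 (λ p x h → p :* x :* h := p :* h :* x) ≃-refl (nq r) (A₂ n (b ℤ.+ + r) (z ℤ.- + r)) (η r))
         (*-congˡ (dot-cong n λ t → *-congˡ {x = Eqn t} (≃-reflexive (cong₂ (λ x y → Eq x * Cz y) (index₁ r t) (index₂ r t)))))) ⟩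
  dot n (λ r → nq r * η r) (λ r → dot n Eqn (λ t → a (r ℕ.+ t)))
    ≈⟨ dot-dot n (λ r → nq r * η r) Eqn a (λ r n<r → Eq*-zero (b ℤ.+ + r) λ p → Cz-negative (small r n<r p)) ⟩
  dot n (conv (λ r → nq r * η r) Eqn) a
    ≈⟨ dot-δ₀ n _ a conv-nqη-Eqn ⟩
  Eq (b ℤ.+ 0ℤ) * Cz (down (z ℤ.- b) 0)
    ≈⟨ ≃-reflexive (cong₂ (λ x y → Eq x * Cz y) (ℤ.+-identityʳ b) (ℤ.+-identityʳ (z ℤ.- b))) ⟩
  A₁ n b z ∎
  where
  a : ℕ → PS
  a r = Eq (b ℤ.+ + r) * Cz (down (z ℤ.- b) r)
  index₁ : ∀ r t → b ℤ.+ + r ℤ.+ + t ≡ b ℤ.+ + (r ℕ.+ t)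
  index₁ r t = ℤ.+-assoc b (+ r) (+ t)
  index₂ : ∀ r t → down (z ℤ.- + r ℤ.- (b ℤ.+ + r)) t ≡ down (z ℤ.- b) (r ℕ.+ t)
  index₂ r t = IntSolver.solve 4 (λ z b r t → z ⊟ r ⊟ (b ⊞ r) ⊟ (t ⊞ t) ⊜ z ⊟ b ⊟ ((r ⊞ t) ⊞ (r ⊞ t))) refl z b (+ r) (+ t)
  small : ∀ r → n ℕ.< r → 0ℤ ℤ.≤ b ℤ.+ + r → down (z ℤ.- b) r ℤ.< 0ℤ
  small r n<r p = subst₂ ℤ._<_
    (IntSolver.solve 3 (λ z b r → z ⊟ r ⊟ (b ⊞ r) ⊜ z ⊟ b ⊟ (r ⊞ r)) refl z b (+ r)) refl
    (ℤ.+-mono-<-≤ (subst (z ℤ.- + r ℤ.<_) (ℤ.+-inverseʳ (+ r)) (ℤ.+-monoˡ-< (ℤ.- + r) (ℤ.≤-<-trans z≤n′ (ℤ.+<+ n<r))))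
                  (ℤ.neg-mono-≤ p))

Closed : ℕ → Set
Closed n = ∀ (γ : Vec ℤ n) → StrictPos γ → Û γ ≃ pochhammer n * (Cz (θ γ) * D γ)

private
  weights : ∀ (A : ℤ → ℤ → PS) (σ : ℕ → ℤ) x (γ : Vec ℤ n) →
    es 1ℤ (λ r δ → nq r * (x * (A (σ r) (θ δ) * D δ))) 0 γ ≃
    x * es 1ℤ (λ r δ → nq r * A (σ r) (θ γ ℤ.- + r) * D δ) 0 γ
  weights A σ x γ = ≃-trans
    (es-cong∈ 1ℤ {F′ = λ r δ → x * (nq r * A (σ r) (θ γ ℤ.- + r) * D δ)} 0 γ λ r δ y → ≃-trans
      (*-congˡ (*-congˡ (*-congʳ (≃-reflexive (cong (A (σ r)) (trans (θ-Shifted y) (cong (λ z → z ℤ.- + r) (ℤ.+-identityʳ (θ γ)))))))))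
      (solve 4 (λ p x a d → p :* (x :* (a :* d)) := x :* (p :* a :* d)) ≃-refl (nq r) x (A (σ r) (θ γ ℤ.- + r)) (D δ)))
    (es-* 1ℤ x (λ r δ → nq r * A (σ r) (θ γ ℤ.- + r) * D δ) 0 γ)

  zero-on-AdjEq : ∀ x y {γ : Vec ℤ n} → AdjEq γ → x * (y * D γ) ≃ 0#
  zero-on-AdjEq x y a = annihilateʳ (annihilateʳ (D-AdjEq a))

-- By `es-injective` the two sides may be compared after multiplication by ∏ (1 - q x₁/xⱼ). The
-- Pieri rule applies to the right side, as a strip larger than `θ` would require a negative power
-- of x or of z.
partial-level₁ : ∀ n → Closed n → ∀ b (γ : Vec ℤ n) → StrictPos γ →
  partial (level₁ n) b γ ≃ pochhammer n * (A₁ n b (θ γ) * D γ)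
partial-level₁ n closed = es-injective (λ b r → b ℤ.- + r) (λ b → ℤ.+-identityʳ b)
  (partial (level₁ n)) (λ b γ → pochhammer n * (A₁ n b (θ γ) * D γ))
  (λ b {γ} a → ≃-trans (alt-AdjEq _ a) (≃-sym (zero-on-AdjEq (pochhammer n) (A₁ n b (θ γ)) a)))
  λ b γ s → ≃-trans (es-level₁ b γ) (≃-sym (begin
    es 1ℤ (λ r δ → nq r * (pochhammer n * (A₁ n (b ℤ.- + r) (θ δ) * D δ))) 0 γ
      ≈⟨ weights (A₁ n) (λ r → b ℤ.- + r) (pochhammer n) γ ⟩
    pochhammer n * es 1ℤ (λ r δ → nq r * A₁ n (b ℤ.- + r) (θ γ ℤ.- + r) * D δ) 0 γ
      ≈⟨ *-congˡ (es-D-θ (λ r → nq r * A₁ n (b ℤ.- + r) (θ γ ℤ.- + r)) s λ r l →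
           annihilateʳ (Eq*-zero (b ℤ.- + r) λ p → Cz-negative (small b γ r l p))) ⟩
    pochhammer n * (dot n (λ r → nq r * A₁ n (b ℤ.- + r) (θ γ ℤ.- + r)) η * D γ)
      ≈⟨ *-congˡ (*-congʳ (A₁-dot n b (θ γ) (θ≤ s))) ⟩
    pochhammer n * (δz b * Cz (θ γ) * D γ)
      ≈⟨ solve 4 (λ p x c d → p :* (x :* c :* d) := x :* (p :* (c :* d))) ≃-refl (pochhammer n) (δz b) (Cz (θ γ)) (D γ) ⟩
    δz b * (pochhammer n * (Cz (θ γ) * D γ))
      ≈⟨ *-congˡ (≃-sym (closed γ s)) ⟩
    δz b * Û γ ∎))
  where
  small : ∀ b (γ : Vec ℤ n) r → θ γ ℤ.< + r → 0ℤ ℤ.≤ b ℤ.- + r → θ γ ℤ.- + r ℤ.- (b ℤ.- + r) ℤ.< 0ℤ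
  small b γ r l p = ℤ.+-mono-<-≤ {θ γ ℤ.- + r} {0ℤ} (subst (θ γ ℤ.- + r ℤ.<_) (ℤ.+-inverseʳ (+ r)) (ℤ.+-monoˡ-< (ℤ.- + r) l)) (ℤ.neg-mono-≤ p)

partial-level₂ : ∀ n → Closed n → ∀ b (γ : Vec ℤ n) → StrictPos γ →
  partial (level₂ n) b γ ≃ pochhammer n * (A₂ n b (θ γ) * D γ)
partial-level₂ n closed = es-injective (λ b r → b ℤ.+ + r) (λ b → ℤ.+-identityʳ b)
  (partial (level₂ n)) (λ b γ → pochhammer n * (A₂ n b (θ γ) * D γ))
  (λ b {γ} a → ≃-trans (alt-AdjEq _ a) (≃-sym (zero-on-AdjEq (pochhammer n) (A₂ n b (θ γ)) a)))
  λ b γ s → ≃-trans (es-level₂ b γ) (≃-trans (partial-level₁ n closed b γ s) (≃-sym (begin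
    es 1ℤ (λ r δ → nq r * (pochhammer n * (A₂ n (b ℤ.+ + r) (θ δ) * D δ))) 0 γ
      ≈⟨ weights (A₂ n) (λ r → b ℤ.+ + r) (pochhammer n) γ ⟩
    pochhammer n * es 1ℤ (λ r δ → nq r * A₂ n (b ℤ.+ + r) (θ γ ℤ.- + r) * D δ) 0 γ
      ≈⟨ *-congˡ (es-D-θ (λ r → nq r * A₂ n (b ℤ.+ + r) (θ γ ℤ.- + r)) s λ r l →
           annihilateʳ (dot-zero n _ _ λ t _ → annihilateʳ (Eq*-zero (b ℤ.+ + r ℤ.+ + t) λ p →
              Cz-negative (small b γ r t l p)))) ⟩
    pochhammer n * (dot n (λ r → nq r * A₂ n (b ℤ.+ + r) (θ γ ℤ.- + r)) η * D γ)
      ≈⟨ *-congˡ (*-congʳ (A₂-dot n b (θ γ) (θ≤ s))) ⟩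
    pochhammer n * (A₁ n b (θ γ) * D γ) ∎)))
  where
  small : ∀ b (γ : Vec ℤ n) r t → θ γ ℤ.< + r → 0ℤ ℤ.≤ b ℤ.+ + r ℤ.+ + t → down (θ γ ℤ.- + r ℤ.- (b ℤ.+ + r)) t ℤ.< 0ℤ
  small b γ r t l p = subst₂ ℤ._<_
    (IntSolver.solve 4 (λ z b r t → z ⊟ (r ⊞ t) ⊟ (b ⊞ r ⊞ t) ⊜ z ⊟ r ⊟ (b ⊞ r) ⊟ (t ⊞ t)) refl (θ γ) b (+ r) (+ t)) refl
    (ℤ.+-mono-<-≤ (subst (θ γ ℤ.- + (r ℕ.+ t) ℤ.<_) (ℤ.+-inverseʳ (+ (r ℕ.+ t)))
        (ℤ.+-monoˡ-< (ℤ.- + (r ℕ.+ t)) (ℤ.<-≤-trans l (ℤ.+≤+ (ℕ.m≤m+n r t))))) (ℤ.neg-mono-≤ p))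

pick-dot : ∀ (β : Vec ℤ (suc n)) m f (a : ℕ → ℤ → Vec ℤ n → PS) →
  pick β (λ c γ → dot m f (λ t → a t c γ)) ≃ dot m f (λ t → pick β (a t))
pick-dot β zero    f a = pick-* β (f 0) (a 0)
pick-dot β (suc m) f a = ≃-trans (pick-+ β _ _) (+-cong (pick-* β (f 0) (a 0)) (pick-dot β m (f ∘ suc) (a ∘ suc)))

module _ (n : ℕ) (closed : Closed n) (β : Vec ℤ (suc n)) (s : StrictPos β) where
  private
    z : ℤ
    z = θ β

    origin : ℤ → ℤ
    origin c = c ℤ.- 1ℤ ℤ.- + suc n

    -- `V 0` is `Û β`. The shift k is carried along because the factor 1/(1 - q/x₁²) ties k to k +
    -- 2.
    V W : ℕ → PS
    V k = pick β (λ c γ → partial (generating (suc n)) (origin c ℤ.+ + k) γ)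
    W k = pick β (λ c γ → partial (level₂ n) (origin c ℤ.+ + k) γ)

    P = pochhammer n

    V-step : ∀ k → V k ≃ W k + q * V (suc (suc k))
    V-step k = ≃-trans
      (pick-cong β λ c γ → ≃-trans (partial-generating (origin c ℤ.+ + k) γ) (+-congˡ (*-congˡ (≃-reflexive
        (cong (λ b → partial (generating (suc n)) b γ) (IntSolver.solve 2 (λ b k → b ⊞ k ⊞ IntSolver.con (+ 2) ⊜ b ⊞ (IntSolver.con (+ 2) ⊞ k)) refl (origin c) (+ k)))))))
      (≃-trans (pick-+ β (λ c γ → partial (level₂ n) (origin c ℤ.+ + k) γ) (λ c γ → q * partial (generating (suc n)) (origin c ℤ.+ + suc (suc k)) γ))
        (+-congˡ (pick-* β q (λ c γ → partial (generating (suc n)) (origin c ℤ.+ + suc (suc k)) γ))))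

    -- Of the two factors in `A₂`, E(qzx) becomes the first column of the determinant `B`, and
    -- E(qz/x) supplies the summation index t, which shifts that column further.
    W-closed : ∀ k → W k ≃ P * dot n Eqn (λ t → Cz (down (z ℤ.- + k) t) * B (k ℕ.+ t) β)
    W-closed k = begin
      W k
        ≈⟨ pick-cong∈ β (λ c γ x → ≃-trans (partial-level₂ n closed (origin c ℤ.+ + k) γ (Picks-StrictPos s x)) (*-congˡ (term c γ x))) ⟩
      pick β (λ c γ → P * dot n Eqn (λ t → C′′ t * (Eq (column t c) * D γ)))
        ≈⟨ pick-* β P _ ⟩
      P * pick β (λ c γ → dot n Eqn (λ t → C′′ t * (Eq (column t c) * D γ)))
        ≈⟨ *-congˡ (pick-dot β n Eqn (λ t c γ → C′′ t * (Eq (column t c) * D γ))) ⟩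
      P * dot n Eqn (λ t → pick β (λ c γ → C′′ t * (Eq (column t c) * D γ)))
        ≈⟨ *-congˡ (dot-cong n λ t → *-congˡ {x = Eqn t} (≃-trans (pick-* β (C′′ t) (λ c γ → Eq (column t c) * D γ))
             (*-congˡ (≃-sym (alt-slot β (column-entry t) (prod Ez)))))) ⟩
      P * dot n Eqn (λ t → C′′ t * B (k ℕ.+ t) β) ∎
      where
      C′′ : ℕ → PS
      C′′ t = Cz (down (z ℤ.- + k) t)
      column : ℕ → ℤ → ℤ
      column t c = c ℤ.- + suc (suc n) ℤ.+ + (k ℕ.+ t)
      column-entry : ℕ → ℤ → PS
      column-entry t c = Eq (column t c)
      term : ∀ c γ → Picks β c γ → A₂ n (origin c ℤ.+ + k) (θ γ) * D γ ≃ dot n Eqn (λ t → C′′ t * (Eq (column t c) * D γ))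
      term c γ x = ≃-trans (*-comm _ _) (≃-trans (≃-sym (dot-scale n (D γ) Eqn _)) (dot-cong n λ t → ≃-trans
        (*-congˡ (*-cong (≃-reflexive (cong Eq (IntSolver.solve 4 (λ c n k t → c ⊟ IntSolver.con 1ℤ ⊟ (IntSolver.con 1ℤ ⊞ n) ⊞ k ⊞ t ⊜ c ⊟ (IntSolver.con (+ 2) ⊞ n) ⊞ (k ⊞ t)) refl c (+ n) (+ k) (+ t))))
                         (≃-reflexive (cong (λ y → Cz (down y t)) (index c γ x)))))
        (solve 4 (λ d q e c → d :* q :* (e :* c) := q :* (c :* (e :* d))) ≃-refl (D γ) (Eqn t) (Eq (column t c)) (C′′ t))))
        where
        index : ∀ c γ → Picks β c γ → θ γ ℤ.- (origin c ℤ.+ + k) ≡ z ℤ.- + k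
        index c γ x = trans
          (IntSolver.solve 5 (λ n r γ c k → n ⊞ r ⊟ γ ⊟ (c ⊟ IntSolver.con 1ℤ ⊟ (IntSolver.con 1ℤ ⊞ n) ⊞ k)
              ⊜ (IntSolver.con 1ℤ ⊞ n) ⊞ (IntSolver.con 1ℤ ⊞ n ⊞ r) ⊟ (c ⊞ γ) ⊟ k) refl (+ n) (sum (ρ n)) (sum γ) c (+ k))
          (cong (λ y → + suc n ℤ.+ sum (ρ (suc n)) ℤ.- y ℤ.- + k) (sym (Picks-sum x)))

    z≤ : z ℤ.≤ + suc n
    z≤ = θ≤ s

    -- Coefficients of C(z) E(-qz²), with the sum cut at t ≤ n. The signs of `B-suc` turn the
    -- coefficients of E(qy) into those of E(-qy).
    J : ℤ → PS
    J y = dot n ēq (λ t → Cz (down y t))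

    -- Only the B p with p ≤ n + 1 meet a nonzero coefficient of C.
    B-restricted : ∀ k t → Cz (down (z ℤ.- + suc k) t) * B (suc k ℕ.+ t) β ≃
                           Cz (down (z ℤ.- + suc k) t) * (sgn (k ℕ.+ t) * DQ β)
    B-restricted k t with k ℕ.+ t ℕ.≤? n
    ... | yes p = *-congˡ (B-suc (k ℕ.+ t) β p)
    ... | no ¬p = ≃-trans (*-congʳ vanish) (≃-trans (zeroˡ _) (≃-sym (annihilateˡ vanish)))
      where
      vanish : Cz (down (z ℤ.- + suc k) t) ≃ 0#
      vanish = Cz-negative (ℤ.≤-<-trans
        (subst (down (z ℤ.- + suc k) t ℤ.≤_) refl (subst₂ ℤ._≤_
          (IntSolver.solve 3 (λ z k t → z ⊟ ((IntSolver.con 1ℤ ⊞ k) ⊞ t) ⊟ t ⊜ z ⊟ (IntSolver.con 1ℤ ⊞ k) ⊟ (t ⊞ t)) refl z (+ k) (+ t)) refl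
          (ℤ.i≤j⇒i-k≤j (+ t) ℤ.≤-refl)))
        (subst (z ℤ.- + suc (k ℕ.+ t) ℤ.<_) (ℤ.+-inverseʳ (+ suc (k ℕ.+ t)))
          (ℤ.+-monoˡ-< (ℤ.- + suc (k ℕ.+ t)) (ℤ.≤-<-trans z≤ (ℤ.+<+ (s≤s (ℕ.≰⇒> ¬p)))))))

    W-suc : ∀ k → W (suc k) ≃ sgn k * DQ β * (P * J (z ℤ.- + suc k))
    W-suc k = begin
      W (suc k)
        ≈⟨ W-closed (suc k) ⟩
      P * dot n Eqn (λ t → Cz (down y t) * B (suc k ℕ.+ t) β)
        ≈⟨ *-congˡ (dot-cong n {f′ = λ t → sgn k * DQ β * ēq t} {a′ = λ t → Cz (down y t)} λ t → ≃-trans (*-congˡ (≃-trans (B-restricted k t) (*-congˡ (*-congʳ (pow-+ (- 1#) k t)))))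
             (solve 5 (λ e c s s′ d → e :* (c :* (s :* s′ :* d)) := s :* d :* (s′ :* e) :* c) ≃-refl (Eqn t) (Cz (down y t)) (sgn k) (sgn t) (DQ β))) ⟩
      P * dot n (λ t → sgn k * DQ β * ēq t) (λ t → Cz (down y t))
        ≈⟨ *-congˡ (dot-scale n (sgn k * DQ β) ēq _) ⟩
      P * (sgn k * DQ β * J y)
        ≈⟨ x∙yz≈y∙xz P (sgn k * DQ β) (J y) ⟩
      sgn k * DQ β * (P * J y) ∎
      where y = z ℤ.- + suc k

    K-step : ∀ k → Kz (z ℤ.- + suc k) ≃ J (z ℤ.- + suc k) + q * Kz (z ℤ.- + suc (suc (suc k)))
    K-step k = ≃-trans (K-recursion (z ℤ.- + suc k) n (ℤ.≤-trans (ℤ.+-monoˡ-≤ (ℤ.- + suc k) z≤) bound))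
      (+-congˡ (*-congˡ (≃-reflexive (cong Kz (IntSolver.solve 2 (λ z k → z ⊟ (IntSolver.con 1ℤ ⊞ k) ⊟ IntSolver.con (+ 2) ⊜ z ⊟ (IntSolver.con (+ 3) ⊞ k)) refl z (+ k))))))
      where
      bound : + suc n ℤ.- + suc k ℤ.≤ + n
      bound = subst₂ ℤ._≤_ (IntSolver.solve 2 (λ n k → n ⊟ k ⊜ IntSolver.con 1ℤ ⊞ n ⊟ (IntSolver.con 1ℤ ⊞ k)) refl (+ n) (+ k)) refl
        (ℤ.i≤j⇒i-k≤j (+ k) ℤ.≤-refl)

    -- `V` and the claimed value obey the same recursion, so the error at k is q times the error at
    -- k + 2. Repeating this makes it divisible by every power of q.
    V-suc : ∀ k → V (suc k) ≃ sgn k * DQ β * (P * Kz (z ℤ.- + suc k))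
    V-suc k = ≃-trans (solve 2 (λ x y → x := x :- y :+ y) ≃-refl (V (suc k)) (claim k))
      (≃-trans (+-congʳ (separated _ (λ m → error (m ℕ.+ m ℕ.+ k) , divisible m k))) (+-identityˡ _))
      where
      claim error : ℕ → PS
      claim k = sgn k * DQ β * (P * Kz (z ℤ.- + suc k))
      error k = V (suc k) - claim k
      error-step : ∀ k → error k ≃ q * error (suc (suc k))
      error-step k = begin
        V (suc k) - claim k
          ≈⟨ +-cong (≃-trans (V-step (suc k)) (+-congʳ (W-suc k))) (-‿cong (*-congˡ (*-congˡ (K-step k)))) ⟩
        sgn k * DQ β * (P * J y) + q * V (suc (suc (suc k))) - sgn k * DQ β * (P * (J y + q * Kz y′))
          ≈⟨ solve 7 (λ s d p j q v k → s :* d :* (p :* j) :+ q :* v :- s :* d :* (p :* (j :+ q :* k))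
               := q :* (v :- :- con 1ℤ :* (:- con 1ℤ :* s) :* d :* (p :* k))) ≃-refl (sgn k) (DQ β) P (J y) q (V (suc (suc (suc k)))) (Kz y′) ⟩
        q * error (suc (suc k)) ∎
        where
        y  = z ℤ.- + suc k
        y′ = z ℤ.- + suc (suc (suc k))
      divisible : ∀ m k → error k ≃ qp m * error (m ℕ.+ m ℕ.+ k)
      divisible zero    k = ≃-sym (*-identityˡ _)
      divisible (suc m) k = ≃-trans (error-step k) (≃-trans (*-congˡ (divisible m (suc (suc k))))
        (≃-trans (≃-sym (*-assoc q (qp m) _)) (*-congˡ (≃-reflexive (cong error (index m k))))))
        where
        index : ∀ m k → m ℕ.+ m ℕ.+ suc (suc k) ≡ suc m ℕ.+ suc m ℕ.+ k
        index m k = trans (ℕ.+-suc (m ℕ.+ m) (suc k)) (cong suc (trans (ℕ.+-suc (m ℕ.+ m) k) (cong (ℕ._+ k) (sym (ℕ.+-suc m m)))))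

    B-any : ∀ t → t ℕ.≤ n → B t β ≃ δ₀ t * D β - sgn t * DQ β
    B-any zero    _ = ≃-trans (B-zero β) (solve 2 (λ d d′ → d :- d′ := con 1ℤ :* d :- con 1ℤ :* d′) ≃-refl (D β) (DQ β))
    B-any (suc t) l = ≃-trans (B-suc t β (ℕ.<⇒≤ l)) (solve 3 (λ s d d′ → s :* d′ := con 0ℤ :* d :- :- con 1ℤ :* s :* d′) ≃-refl (sgn t) (D β) (DQ β))

    -- Among the determinants `B t` only `B 0`, equal to D - DQ, departs from the sign pattern of
    -- `B-suc`. It contributes the extra term C(z) D, the only one free of DQ.
    W-zero : W 0 ≃ P * (Cz z * D β - DQ β * J z)
    W-zero = ≃-trans (W-closed 0) (*-congˡ (begin
      dot n Eqn (λ t → Cz (down (z ℤ.- 0ℤ) t) * B t β)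
        ≈⟨ dot-cong≤ n {f′ = λ t → D β * δ₀ t + (- DQ β) * ēq t} {a′ = λ t → Cz (down z t)} (λ t l → ≃-trans
             (*-congˡ (*-cong (≃-reflexive (cong (λ y → Cz (down y t)) (ℤ.+-identityʳ z))) (B-any t l)))
             (≃-trans (solve 6 (λ e c δ d s d′ → e :* (c :* (δ :* d :- s :* d′)) := (d :* (δ :* e) :+ :- d′ :* (s :* e)) :* c) ≃-refl
               (Eqn t) (Cz (down z t)) (δ₀ t) (D β) (sgn t) (DQ β)) (*-congʳ (+-congʳ (*-congˡ (only t)))))) ⟩
      dot n (λ t → D β * δ₀ t + (- DQ β) * ēq t) (λ t → Cz (down z t))
        ≈⟨ dot-+ˡ n (λ t → D β * δ₀ t) (λ t → (- DQ β) * ēq t) (λ t → Cz (down z t)) ⟩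
      dot n (λ t → D β * δ₀ t) (λ t → Cz (down z t)) + dot n (λ t → (- DQ β) * ēq t) (λ t → Cz (down z t))
        ≈⟨ +-cong (≃-trans (dot-scale n (D β) δ₀ _) (*-congˡ (≃-trans (dot-δ₀ n δ₀ _ (λ _ → ≃-refl)) (≃-reflexive (cong Cz (down-zero z))))))
                  (dot-scale n (- DQ β) ēq _) ⟩
      D β * Cz z + (- DQ β) * J z
        ≈⟨ solve 4 (λ d c d′ j → d :* c :+ (:- d′) :* j := c :* d :- d′ :* j) ≃-refl (D β) (Cz z) (DQ β) (J z) ⟩
      Cz z * D β - DQ β * J z ∎))
      where
      only : ∀ t → δ₀ t * Eqn t ≃ δ₀ t
      only zero    = solve 0 (con 1ℤ :* (con 1ℤ :* con 1ℤ) := con 1ℤ) ≃-refl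
      only (suc t) = zeroˡ _

    -- DQ yields q^|λ| and C(qz) yields q^(n+1-|λ|); together they give the q^(n+1) in the new
    -- factor 1 - q^(n+1) of `pochhammer (suc n)`.
    DQ*K : DQ β * Kz z ≃ qp (suc n) * (Cz z * D β)
    DQ*K = go z refl
      where
      go : ∀ y → z ≡ y → DQ β * Kz y ≃ qp (suc n) * (Cz y * D β)
      go -[1+ k ] _  = ≃-trans (zeroʳ _) (≃-sym (annihilateʳ (zeroˡ _)))
      go (+ Θ)    eq = begin
        DQ β * (qp Θ * C Θ)
          ≈⟨ *-congʳ (DQ≃qz*D β (+ (suc n ℕ.∸ Θ)) total) ⟩
        qp (suc n ℕ.∸ Θ) * D β * (qp Θ * C Θ)
          ≈⟨ solve 4 (λ a d b c → a :* d :* (b :* c) := a :* b :* (c :* d)) ≃-refl (qp (suc n ℕ.∸ Θ)) (D β) (qp Θ) (C Θ) ⟩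
        qp (suc n ℕ.∸ Θ) * qp Θ * (C Θ * D β)
          ≈⟨ *-congʳ (≃-trans (≃-sym (pow-+ q (suc n ℕ.∸ Θ) Θ)) (≃-reflexive (cong qp (ℕ.m∸n+n≡m Θ≤)))) ⟩
        qp (suc n) * (C Θ * D β) ∎
        where
        Θ≤ : Θ ℕ.≤ suc n
        Θ≤ = ℤ.drop‿+≤+ (subst (ℤ._≤ + suc n) eq z≤)
        total : sum β ≡ + (suc n ℕ.∸ Θ) ℤ.+ sum (ρ (suc n))
        total = +ℤ-cancelʳ (sum β) _ (+ Θ) (trans (θ-complement β eq) (trans (cong (λ m → + m ℤ.+ sum (ρ (suc n))) (sym (ℕ.m∸n+n≡m Θ≤)))
          (IntSolver.solve 3 (λ a t r → a ⊞ t ⊞ r ⊜ a ⊞ r ⊞ t) refl (+ (suc n ℕ.∸ Θ)) (+ Θ) (sum (ρ (suc n))))))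

    K-whole : Kz z ≃ J z + q * Kz (z ℤ.- + 2)
    K-whole = ≃-trans (K-recursion z (suc n) z≤) (+-congʳ (dot-extend n (suc n) ēq (λ t → Cz (down z t)) (ℕ.n≤1+n n) λ r l →
      annihilateʳ (Cz-negative (small r l))))
      where
      small : ∀ r → n ℕ.< r → down z r ℤ.< 0ℤ
      small (suc r) l = subst (down z (suc r) ℤ.<_) (ℤ.+-inverseʳ (+ (suc r ℕ.+ suc r))) (ℤ.+-monoˡ-< (ℤ.- + (suc r ℕ.+ suc r))
        (ℤ.≤-<-trans z≤ (ℤ.+<+ (ℕ.≤-<-trans l (ℕ.m<m+n (suc r) (s≤s z≤n))))))

  Û-closed-suc : Û β ≃ pochhammer (suc n) * (Cz (θ β) * D β)
  Û-closed-suc = begin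
    Û β
      ≈⟨ Û-suc β ⟩
    pick β (λ c γ → partial (generating (suc n)) (origin c) γ)
      ≈⟨ pick-cong β (λ c γ → ≃-reflexive (cong (λ b → partial (generating (suc n)) b γ) (sym (ℤ.+-identityʳ (origin c))))) ⟩
    V 0
      ≈⟨ ≃-trans (V-step 0) (+-cong W-zero (*-congˡ (V-suc 1))) ⟩
    P * (Cz z * D β - DQ β * J z) + q * (sgn 1 * DQ β * (P * Kz (z ℤ.- + 2)))
      ≈⟨ solve 6 (λ p x d j q k → p :* (x :- d :* j) :+ q :* (:- con 1ℤ :* con 1ℤ :* d :* (p :* k)) := p :* (x :- d :* (j :+ q :* k))) ≃-refl
           P (Cz z * D β) (DQ β) (J z) q (Kz (z ℤ.- + 2)) ⟩
    P * (Cz z * D β - DQ β * (J z + q * Kz (z ℤ.- + 2)))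
      ≈⟨ *-congˡ (+-congˡ (-‿cong (≃-trans (*-congˡ (≃-sym K-whole)) DQ*K))) ⟩
    P * (Cz z * D β - qp (suc n) * (Cz z * D β))
      ≈⟨ solve 3 (λ p x q → p :* (x :- q :* x) := p :* (con 1ℤ :- q) :* x) ≃-refl P (Cz z * D β) (qp (suc n)) ⟩
    pochhammer (suc n) * (Cz z * D β) ∎

Û-closed : ∀ n → Closed n
Û-closed zero [] s = ≃-trans (≡⇒≃ λ m → unit m) (solve 0 (con 1ℤ := con 1ℤ :* (con 1ℤ :* con 1ℤ)) ≃-refl)
  where
  unit : ∀ m → at (generating 0) [] m ≡ 1# m
  unit zero    = sym (const-head 1ℤ)
  unit (suc m) = sym (const-tail 1ℤ m)
Û-closed (suc n) β s = Û-closed-suc n (Û-closed n) β s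

-- The alternating extension of the Kronecker delta

open import Relation.Binary.Definitions using (tri<; tri≈; tri>)

-- g is the extension of the Kronecker delta on positive integers that is odd
-- in both arguments; so G (λ + ρ) (μ + ρ) is the extension of the Kronecker
-- delta on partitions that is alternating under the hyperoctahedral group.
g : ℤ → ℤ → PS
g a b = δz (a ℤ.- b) - δz (a ℤ.+ b)

Gp : Vec ℤ n → Vec ℤ n → PS
Gp []      []      = 1#
Gp (a ∷ γ) (b ∷ β) = g a b * Gp γ β

G : Vec ℤ n → Vec ℤ n → PS
G a b = alt a (λ γ → Gp γ b)

δz-even : ∀ x → δz (ℤ.- x) ≡ δz x
δz-even (+ zero)  = refl
δz-even (+ suc _) = refl
δz-even -[1+ _ ]  = refl

g-comm : ∀ a b → g a b ≃ g b a
g-comm a b = +-cong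
  (≃-reflexive (trans (sym (δz-even (a ℤ.- b))) (cong δz (IntSolver.solve 2 (λ a b → ⊝ (a ⊟ b) ⊜ b ⊟ a) refl a b ))))
  (-‿cong (≃-reflexive (cong δz (ℤ.+-comm a b))))

g-zero : ∀ b → g 0ℤ b ≃ 0#
g-zero b = ≃-trans (+-congʳ (≃-reflexive (trans (sym (δz-even (0ℤ ℤ.- b)))
  (cong δz (IntSolver.solve 1 (λ b → ⊝ (IntSolver.con 0ℤ ⊟ b) ⊜ IntSolver.con 0ℤ ⊞ b) refl b))))) (-‿inverseʳ _)

-- Self-adjointness of x + 1/x in one variable. Both δ-functions of `g` transfer separately, one
-- exchanging the two shifts and the other keeping them.
g-transfer : ∀ a b → g (a ℤ.+ -1ℤ) b + g (a ℤ.+ 1ℤ) b ≃ g a (b ℤ.+ -1ℤ) + g a (b ℤ.+ 1ℤ)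
g-transfer a b = ≃-trans
  (+-cong (+-cong (≃-reflexive (cong δz (e₁ a b))) (-‿cong (≃-reflexive (cong δz (e₂ a b)))))
          (+-cong (≃-reflexive (cong δz (e₃ a b))) (-‿cong (≃-reflexive (cong δz (e₄ a b))))))
  (solve 4 (λ x y u v → (x :- y) :+ (u :- v) := (u :- y) :+ (x :- v)) ≃-refl
    (δz (a ℤ.- (b ℤ.+ 1ℤ))) (δz (a ℤ.+ (b ℤ.+ -1ℤ))) (δz (a ℤ.- (b ℤ.+ -1ℤ))) (δz (a ℤ.+ (b ℤ.+ 1ℤ))))
  where
  e₁ : ∀ a b → a ℤ.+ -1ℤ ℤ.- b ≡ a ℤ.- (b ℤ.+ 1ℤ)
  e₁ = IntSolver.solve 2 (λ a b → a ⊞ IntSolver.con -1ℤ ⊟ b ⊜ a ⊟ (b ⊞ IntSolver.con 1ℤ)) refl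
  e₂ : ∀ a b → a ℤ.+ -1ℤ ℤ.+ b ≡ a ℤ.+ (b ℤ.+ -1ℤ)
  e₂ = IntSolver.solve 2 (λ a b → a ⊞ IntSolver.con -1ℤ ⊞ b ⊜ a ⊞ (b ⊞ IntSolver.con -1ℤ)) refl
  e₃ : ∀ a b → a ℤ.+ 1ℤ ℤ.- b ≡ a ℤ.- (b ℤ.+ -1ℤ)
  e₃ = IntSolver.solve 2 (λ a b → a ⊞ IntSolver.con 1ℤ ⊟ b ⊜ a ⊟ (b ⊞ IntSolver.con -1ℤ)) refl
  e₄ : ∀ a b → a ℤ.+ 1ℤ ℤ.+ b ≡ a ℤ.+ (b ℤ.+ 1ℤ)
  e₄ = IntSolver.solve 2 (λ a b → a ⊞ IntSolver.con 1ℤ ⊞ b ⊜ a ⊞ (b ⊞ IntSolver.con 1ℤ)) refl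

pick-fubini : ∀ {m} (α : Vec ℤ (suc n)) (β : Vec ℤ (suc m)) (k : ℤ → Vec ℤ n → ℤ → Vec ℤ m → PS) →
  pick α (λ c γ → pick β (k c γ)) ≃ pick β (λ d δ → pick α (λ c γ → k c γ d δ))
pick-fubini {zero}  (a ∷ []) β k = ≃-refl
pick-fubini {suc n} (a ∷ α)  β k = ≃-sym (≃-trans (pick-+ β _ _)
  (+-congˡ (≃-trans (pick-neg β _) (-‿cong (≃-sym (pick-fubini α β _))))))

G-cons : ∀ (α : Vec ℤ (suc n)) b β → G α (b ∷ β) ≃ pick α (λ x γ → g x b * G γ β)
G-cons α b β = pick-cong α λ x γ → alt-* γ (g x b) (λ δ → Gp δ β)

-- Expansion along the other side of the determinant (g(αᵢ, βⱼ)). Set against `G-cons` it gives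
-- invariance under transposition.
G-row : ∀ a (α : Vec ℤ n) (β : Vec ℤ (suc n)) → G (a ∷ α) β ≃ pick β (λ c γ → g a c * G α γ)
G-row {zero}  a []  (b ∷ []) = ≃-refl
G-row {suc n} a α (b ∷ β) = begin
  G (a ∷ α) (b ∷ β)
    ≈⟨ G-cons (a ∷ α) b β ⟩
  g a b * G α β - pick α (λ x γ → g x b * G (a ∷ γ) β)
    ≈⟨ +-congˡ (-‿cong (pick-cong α λ x γ → ≃-trans (*-congˡ (G-row a γ β)) (≃-trans (≃-sym (pick-* β (g x b) _))
         (pick-cong β λ d δ → x∙yz≈y∙xz (g x b) (g a d) (G γ δ))))) ⟩
  g a b * G α β - pick α (λ x γ → pick β (λ d δ → g a d * (g x b * G γ δ)))
    ≈⟨ +-congˡ (-‿cong (≃-trans (pick-fubini α β (λ x γ d δ → g a d * (g x b * G γ δ))) (pick-cong β λ d δ →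
         ≃-trans (pick-* α (g a d) _) (*-congˡ (≃-sym (G-cons α b δ)))))) ⟩
  g a b * G α β - pick β (λ d δ → g a d * G α (b ∷ δ)) ∎

G-comm : ∀ (α β : Vec ℤ n) → G α β ≃ G β α
G-comm []      []      = ≃-refl
G-comm (a ∷ α) β = ≃-trans (G-row a α β) (≃-trans
  (pick-cong β λ c γ → *-cong (g-comm a c) (G-comm α γ)) (≃-sym (G-cons β a α)))

G-AdjEq : ∀ {α : Vec ℤ n} β → AdjEq α → G α β ≃ 0#
G-AdjEq β = alt-AdjEq (λ γ → Gp γ β)

G-Swap : ∀ {α α′ : Vec ℤ n} β → Swap α α′ → G α β ≃ - G α′ β
G-Swap β = alt-Swap (λ γ → Gp γ β)

G-HasZero : ∀ {α : Vec ℤ n} β → HasZero α → G α β ≃ 0#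
G-HasZero β z = alt-HasZero (λ γ → Gp γ β) z λ γ z → vanish γ β z
  where
  vanish : ∀ {n} (γ β : Vec ℤ n) → HasZero γ → Gp γ β ≃ 0#
  vanish (.0ℤ ∷ γ) (b ∷ β) (here refl) = annihilateˡ (g-zero b)
  vanish (_ ∷ γ)   (b ∷ β) (there z)   = annihilateʳ (vanish γ β z)

private
  δz-< : ∀ {x} → x ℤ.< 0ℤ → δz x ≃ 0#
  δz-< { -[1+ _ ]} _ = ≃-refl
  δz-< {+ _} (ℤ.+<+ ())

  δz-> : ∀ {x} → 0ℤ ℤ.< x → δz x ≃ 0#
  δz-> {+ suc _} _ = ≃-refl
  δz-> {+ zero} (ℤ.+<+ ())

  g-off : ∀ {a b} → 0ℤ ℤ.< a → a ℤ.< b → g a b ≃ 0#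
  g-off {a} {b} p r = ≃-trans
    (+-cong (δz-< (subst (a ℤ.- b ℤ.<_) (ℤ.+-inverseʳ b) (ℤ.+-monoˡ-< (ℤ.- b) r)))
            (-‿cong (δz-> (ℤ.+-mono-< p (ℤ.<-trans p r)))))
    (-‿inverseʳ 0#)

  g-diagonal : ∀ {a} → 0ℤ ℤ.< a → g a a ≃ 1#
  g-diagonal {a} p = ≃-trans (+-cong (≃-reflexive (cong δz (ℤ.+-inverseʳ a))) (-‿cong (δz-> (ℤ.+-mono-< p p))))
    (solve 0 (con 1ℤ :- con 0ℤ := con 1ℤ) ≃-refl)

  StrictPos-All : ∀ {β : Vec ℤ n} → StrictPos β → All (0ℤ ℤ.<_) β
  StrictPos-All []           = []
  StrictPos-All (cons p _ s) = p ∷ StrictPos-All s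

  G-off : ∀ {a b} {α β : Vec ℤ n} → StrictPos (a ∷ α) → a ℤ.< b → G (a ∷ α) (b ∷ β) ≃ 0#
  G-off {a = a} {b} {α} {β} s@(cons p l t) a<b = ≃-trans (G-cons (a ∷ α) b β) (pick-zero (a ∷ α) λ x γ y →
    annihilateˡ (g-off (proj₁ (Picks-All y (StrictPos-All s))) (proj₁ (Picks-All y (a<b ∷ All.map (λ c<a → ℤ.<-trans c<a a<b) l)))))

  G-head : ∀ {a} {α β : Vec ℤ n} → StrictPos (a ∷ α) → G (a ∷ α) (a ∷ β) ≃ G α β
  G-head {a = a} {α} {β} (cons p l t) = ≃-trans (G-cons (a ∷ α) a β) (≃-trans
    (pick-head α (λ x γ → g x a * G γ β) (All.zip (StrictPos-All t , l)) λ c γ (0<c , c<a) → annihilateˡ (g-off 0<c c<a))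
    (≃-trans (*-congʳ (g-diagonal p)) (*-identityˡ _)))

G-refl : ∀ {β : Vec ℤ n} → StrictPos β → G β β ≃ 1#
G-refl []               = ≃-refl
G-refl s@(cons _ _ t) = ≃-trans (G-head s) (G-refl t)

G-≢ : ∀ {α β : Vec ℤ n} → StrictPos α → StrictPos β → α ≢ β → G α β ≃ 0#
G-≢ [] [] p = ⊥-elim (p refl)
G-≢ {α = a ∷ α} {b ∷ β} s@(cons _ _ s′) t@(cons _ _ t′) p with ℤ.<-cmp a b
... | tri< a<b _ _  = G-off s a<b
... | tri> _ _ b<a  = ≃-trans (G-comm (a ∷ α) (b ∷ β)) (G-off t b<a)
... | tri≈ _ refl _ = ≃-trans (G-head s) (G-≢ s′ t′ (p ∘ cong (a ∷_)))

-- Adding a vertical strip and then removing one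

T : Family n → Family n
T F = es 1ℤ (es -1ℤ F)

T-cong : ∀ {F F′ : Family n} r β → (∀ r γ → F r γ ≃ F′ r γ) → T F r β ≃ T F′ r β
T-cong r β p = es-cong 1ℤ r β λ r γ → es-cong -1ℤ r γ p

T-+ : ∀ (F F′ : Family n) r β → T (λ r γ → F r γ + F′ r γ) r β ≃ T F r β + T F′ r β
T-+ F F′ r β = ≃-trans (es-cong 1ℤ r β λ r γ → es-+ -1ℤ F F′ r γ) (es-+ 1ℤ (es -1ℤ F) (es -1ℤ F′) r β)

T-* : ∀ x (F : Family n) r β → T (λ r γ → x * F r γ) r β ≃ x * T F r β
T-* x F r β = ≃-trans (es-cong 1ℤ r β λ r γ → es-* -1ℤ x F r γ) (es-* 1ℤ x (es -1ℤ F) r β)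

T-neg : ∀ (F : Family n) r β → T (λ r γ → - F r γ) r β ≃ - T F r β
T-neg F r β = ≃-trans (es-cong 1ℤ r β λ r γ → es-neg -1ℤ F r γ) (es-neg 1ℤ (es -1ℤ F) r β)

T-zero : ∀ {F : Family n} r β → (∀ r γ → F r γ ≃ 0#) → T F r β ≃ 0#
T-zero {F = F} r β p = es-zero 1ℤ (es -1ℤ F) r β λ r γ _ → es-zero -1ℤ F r γ λ r δ _ → p r δ

-- With u counting boxes, a single coordinate contributes 1 + u/x + ux + u². The invariance under x
-- ↦ 1/x is the source of self-adjointness.
T-cons : ∀ (F : Family (suc n)) r b β → T F r (b ∷ β) ≃
  (T (λ r γ → F r (b ∷ γ)) r β + T (λ r γ → F (suc r) (b ℤ.+ -1ℤ ∷ γ)) r β) +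
  (T (λ r γ → F (suc r) (b ℤ.+ 1ℤ ∷ γ)) r β + T (λ r γ → F (suc (suc r)) (b ∷ γ)) r β)
T-cons F r b β = +-cong
  (es-+ 1ℤ (es -1ℤ λ r γ → F r (b ∷ γ)) (es -1ℤ λ r γ → F (suc r) (b ℤ.+ -1ℤ ∷ γ)) r β)
  (≃-trans (es-cong 1ℤ {F′ = λ r γ → es -1ℤ (λ r γ → F (suc r) (b ℤ.+ 1ℤ ∷ γ)) r γ + es -1ℤ (λ r γ → F (suc (suc r)) (b ∷ γ)) r γ} r β (λ r γ →
      +-cong (≃-sym (es-suc -1ℤ (λ r γ → F r (b ℤ.+ 1ℤ ∷ γ)) r γ))
        (≃-trans (≃-sym (es-suc -1ℤ (λ r γ → F (suc r) (b ℤ.+ 1ℤ ℤ.+ -1ℤ ∷ γ)) r γ))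
          (es-cong -1ℤ r γ λ r δ → ≃-reflexive (cong (λ z → F (suc (suc r)) (z ∷ δ))
            (trans (ℤ.+-assoc b 1ℤ -1ℤ) (ℤ.+-identityʳ b)))))))
    (es-+ 1ℤ (es -1ℤ λ r γ → F (suc r) (b ℤ.+ 1ℤ ∷ γ)) (es -1ℤ λ r γ → F (suc (suc r)) (b ∷ γ)) r β))

private
  T-weighted : ∀ (w₁ w₂ w₃ w₄ : ℕ → PS) (f : Vec ℤ n → PS) r β →
    (T (λ r γ → w₁ r * f γ) r β + T (λ r γ → w₂ r * f γ) r β) + (T (λ r γ → w₃ r * f γ) r β + T (λ r γ → w₄ r * f γ) r β)
    ≃ T (λ r γ → ((w₁ r + w₂ r) + (w₃ r + w₄ r)) * f γ) r β
  T-weighted w₁ w₂ w₃ w₄ f r β = ≃-sym (≃-trans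
    (T-cong r β λ r γ → solve 5 (λ a b c d f → (a :+ b :+ (c :+ d)) :* f := (a :* f :+ b :* f) :+ (c :* f :+ d :* f)) ≃-refl (w₁ r) (w₂ r) (w₃ r) (w₄ r) (f γ))
    (≃-trans (T-+ (λ r γ → w₁ r * f γ + w₂ r * f γ) (λ r γ → w₃ r * f γ + w₄ r * f γ) r β)
      (+-cong (T-+ (λ r γ → w₁ r * f γ) (λ r γ → w₂ r * f γ) r β) (T-+ (λ r γ → w₃ r * f γ) (λ r γ → w₄ r * f γ) r β))))

-- The weight is arbitrary so that the induction over coordinates can absorb the contribution of the
-- first one into it. There `g-transfer` moves the single shifts from one argument to the other,
-- while the terms 1 and u² shift nothing.
T-Gp : ∀ (w : ℕ → PS) r (γ β : Vec ℤ n) → T (λ r γ → w r * Gp γ β) r γ ≃ T (λ r β → w r * Gp γ β) r β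
T-Gp w r []      []      = ≃-refl
T-Gp w r (c ∷ γ) (b ∷ β) = begin
  T (λ r γ → w r * Gp γ (b ∷ β)) r (c ∷ γ)
    ≈⟨ T-cons (λ r γ → w r * Gp γ (b ∷ β)) r c γ ⟩
  _ ≈⟨ +-cong (+-cong (pull w (g c b)) (pull (w ∘ suc) (g (c ℤ.+ -1ℤ) b))) (+-cong (pull (w ∘ suc) (g (c ℤ.+ 1ℤ) b)) (pull (λ r → w (suc (suc r))) (g c b))) ⟩
  _ ≈⟨ T-weighted (λ r → w r * g c b) (λ r → w (suc r) * g (c ℤ.+ -1ℤ) b) (λ r → w (suc r) * g (c ℤ.+ 1ℤ) b) (λ r → w (suc (suc r)) * g c b) (λ γ → Gp γ β) r γ ⟩
  T (λ r γ → weight (g (c ℤ.+ -1ℤ) b) (g (c ℤ.+ 1ℤ) b) r * Gp γ β) r γ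
    ≈⟨ T-Gp (weight (g (c ℤ.+ -1ℤ) b) (g (c ℤ.+ 1ℤ) b)) r γ β ⟩
  T (λ r β → weight (g (c ℤ.+ -1ℤ) b) (g (c ℤ.+ 1ℤ) b) r * Gp γ β) r β
    ≈⟨ T-cong r β (λ r δ → *-congʳ (weight-cong r)) ⟩
  T (λ r β → weight (g c (b ℤ.+ -1ℤ)) (g c (b ℤ.+ 1ℤ)) r * Gp γ β) r β
    ≈⟨ ≃-sym (T-weighted (λ r → w r * g c b) (λ r → w (suc r) * g c (b ℤ.+ -1ℤ)) (λ r → w (suc r) * g c (b ℤ.+ 1ℤ)) (λ r → w (suc (suc r)) * g c b) (λ β → Gp γ β) r β) ⟩
  _ ≈⟨ +-cong (+-cong (push w (g c b)) (push (w ∘ suc) (g c (b ℤ.+ -1ℤ)))) (+-cong (push (w ∘ suc) (g c (b ℤ.+ 1ℤ))) (push (λ r → w (suc (suc r))) (g c b))) ⟩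
  _ ≈⟨ ≃-sym (T-cons (λ r β → w r * Gp (c ∷ γ) β) r b β) ⟩
  T (λ r β → w r * Gp (c ∷ γ) β) r (b ∷ β) ∎
  where
  pull : ∀ w x → T (λ r γ → w r * (x * Gp γ β)) r γ ≃ T (λ r γ → w r * x * Gp γ β) r γ
  pull w x = T-cong r γ λ r δ → ≃-sym (*-assoc (w r) x (Gp δ β))
  push : ∀ w x → T (λ r β → w r * x * Gp γ β) r β ≃ T (λ r β → w r * (x * Gp γ β)) r β
  push w x = T-cong r β λ r δ → *-assoc (w r) x (Gp γ δ)
  weight : PS → PS → ℕ → PS
  weight x y r = (w r * g c b + w (suc r) * x) + (w (suc r) * y + w (suc (suc r)) * g c b)
  weight-cong : ∀ r → weight (g (c ℤ.+ -1ℤ) b) (g (c ℤ.+ 1ℤ) b) r ≃ weight (g c (b ℤ.+ -1ℤ)) (g c (b ℤ.+ 1ℤ)) r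
  weight-cong r = ≃-trans (collect _ _) (≃-trans (+-congˡ (*-congˡ (g-transfer c b))) (≃-sym (collect _ _)))
    where
    collect : ∀ x y → weight x y r ≃ w r * g c b + w (suc (suc r)) * g c b + w (suc r) * (x + y)
    collect x y = solve 6 (λ a b c d x y → (a :* b :+ c :* x) :+ (c :* y :+ d :* b) := a :* b :+ d :* b :+ c :* (x :+ y)) ≃-refl
      (w r) (g c b) (w (suc r)) (w (suc (suc r))) x y

alt-es-out : ∀ {m} s (α : Vec ℤ m) (F : ℕ → Vec ℤ n → Vec ℤ m → PS) r β →
  alt α (λ γ → es s (λ r β → F r β γ) r β) ≃ es s (λ r β → alt α (F r β)) r β
alt-es-out s α F r []      = ≃-refl
alt-es-out s α F r (b ∷ β) = ≃-trans (alt-+ α _ _) (+-cong (alt-es-out s α _ r β) (alt-es-out s α _ r β))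

-- Self-adjointness of all T_r at once: the weight can single out any number of boxes, and it leaves
-- room for the scalars that the recursion of `ℓ` introduces.
Symmetric : (Vec ℤ n → Vec ℤ n → PS) → Set
Symmetric {n} f = ∀ (w : ℕ → PS) r α β → T (λ r α → w r * f α β) r α ≃ T (λ r β → w r * f α β) r β

G-Symmetric : Symmetric {n} G
G-Symmetric w r α β = begin
  T (λ r α → w r * G α β) r α
    ≈⟨ T-cong r α (λ r α → ≃-sym (alt-* α (w r) (λ γ → Gp γ β))) ⟩
  T (λ r α → alt α (λ γ → w r * Gp γ β)) r α
    ≈⟨ es-cong 1ℤ r α (λ r α → ≃-sym (alt-es -1ℤ (λ r γ → w r * Gp γ β) r α)) ⟩
  es 1ℤ (λ r α → alt α (es -1ℤ (λ r γ → w r * Gp γ β) r)) r α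
    ≈⟨ ≃-sym (alt-es 1ℤ (es -1ℤ (λ r γ → w r * Gp γ β)) r α) ⟩
  alt α (T (λ r γ → w r * Gp γ β) r)
    ≈⟨ alt-cong α _ (λ γ → T (λ r β → w r * Gp γ β) r β) (λ γ → T-Gp w r γ β) ⟩
  alt α (λ γ → T (λ r β → w r * Gp γ β) r β)
    ≈⟨ alt-es-out 1ℤ α (λ r β γ → es -1ℤ (λ r β → w r * Gp γ β) r β) r β ⟩
  es 1ℤ (λ r β → alt α (λ γ → es -1ℤ (λ r β → w r * Gp γ β) r β)) r β
    ≈⟨ es-cong 1ℤ r β (λ r β → alt-es-out -1ℤ α (λ r β γ → w r * Gp γ β) r β) ⟩
  T (λ r β → alt α (λ γ → w r * Gp γ β)) r β
    ≈⟨ T-cong r β (λ r β → alt-* α (w r) (λ γ → Gp γ β)) ⟩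
  T (λ r β → w r * G α β) r β ∎

T-fubini : ∀ {m} (F : ℕ → ℕ → Vec ℤ n → Vec ℤ m → PS) r u α β →
  T (λ r α → T (λ u β → F r u α β) u β) r α ≃ T (λ u β → T (λ r α → F r u α β) r α) u β
T-fubini {n} F r u α β = begin
  es 1ℤ (es -1ℤ λ r α → es 1ℤ (es -1ℤ λ u β → F r u α β) u β) r α
    ≈⟨ es-cong 1ℤ r α (λ r α → out -1ℤ 1ℤ (λ r u α β → es -1ℤ (λ u β → F r u α β) u β) r u α β) ⟩
  es 1ℤ (λ r α → es 1ℤ (λ u β → es -1ℤ (λ r α → es -1ℤ (λ u β → F r u α β) u β) r α) u β) r α
    ≈⟨ out 1ℤ 1ℤ (λ r u α β → es -1ℤ (λ r α → es -1ℤ (λ u β → F r u α β) u β) r α) r u α β ⟩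
  es 1ℤ (λ u β → es 1ℤ (λ r α → es -1ℤ (λ r α → es -1ℤ (λ u β → F r u α β) u β) r α) r α) u β
    ≈⟨ es-cong 1ℤ u β (λ u β → ≃-trans (es-cong 1ℤ r α λ r α → out -1ℤ -1ℤ F r u α β) (out 1ℤ -1ℤ (λ r u α β → es -1ℤ (λ r α → F r u α β) r α) r u α β)) ⟩
  T (λ u β → T (λ r α → F r u α β) r α) u β ∎
  where
  out : ∀ {n m} s t (F : ℕ → ℕ → Vec ℤ n → Vec ℤ m → PS) r u α β →
    es s (λ r α → es t (λ u β → F r u α β) u β) r α ≃ es t (λ u β → es s (λ r α → F r u α β) r α) u β
  out s t F r u []      β = ≃-refl
  out s t F r u (a ∷ α) β = ≃-trans (+-cong (out s t _ r u α β) (out s t _ r u α β)) (≃-sym (es-+ t _ _ u β))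

T-T-comm : ∀ (F : ℕ → ℕ → Vec ℤ n → PS) r u β →
  T (λ r γ → T (λ u → F r u) u γ) r β ≃ T (λ u γ → T (λ r → F r u) r γ) u β
T-T-comm F r u β = begin
  es 1ℤ (es -1ℤ λ r γ → es 1ℤ (es -1ℤ λ u → F r u) u γ) r β
    ≈⟨ es-cong 1ℤ r β (λ r γ → es-es-comm -1ℤ 1ℤ (λ r u → es -1ℤ (λ u → F r u) u) r u γ) ⟩
  es 1ℤ (λ r γ → es 1ℤ (λ u γ → es -1ℤ (λ r → es -1ℤ (λ u → F r u) u) r γ) u γ) r β
    ≈⟨ es-es-comm 1ℤ 1ℤ (λ r u γ → es -1ℤ (λ r → es -1ℤ (λ u → F r u) u) r γ) r u β ⟩
  es 1ℤ (λ u γ → es 1ℤ (λ r γ → es -1ℤ (λ r → es -1ℤ (λ u → F r u) u) r γ) r γ) u β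
    ≈⟨ es-cong 1ℤ u β (λ u γ → ≃-trans (es-cong 1ℤ r γ λ r δ → es-es-comm -1ℤ -1ℤ F r u δ)
         (es-es-comm 1ℤ -1ℤ (λ r u → es -1ℤ (λ r → F r u) r) r u γ)) ⟩
  T (λ u γ → T (λ r → F r u) r γ) u β ∎

es-δ₀ : ∀ s (f : Vec ℤ n → PS) r β → es s (λ r γ → δ₀ r * f γ) r β ≃ δ₀ r * f β
es-δ₀ s f r []      = ≃-refl
es-δ₀ s f r (b ∷ β) = ≃-trans (+-cong (es-δ₀ s (λ γ → f (b ∷ γ)) r β) (es-zero s _ r β λ r γ _ → zeroˡ _)) (+-identityʳ _)

T-δ₀ : ∀ (f : Vec ℤ n → PS) β → T (λ r γ → δ₀ r * f γ) 0 β ≃ f β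
T-δ₀ f β = ≃-trans (es-cong 1ℤ 0 β (es-δ₀ -1ℤ f)) (≃-trans (es-δ₀ 1ℤ f 0 β) (*-identityˡ _))

tail₀ : (ℕ → Vec ℤ n → PS) → Family n
tail₀ f zero    β = 0#
tail₀ f (suc r) β = f r β

T-head : ∀ (F : Family n) β → T F 0 β ≃ F 0 β + T (tail₀ (λ r → F (suc r))) 0 β
T-head F β = ≃-trans (T-cong {F′ = λ r γ → δ₀ r * F 0 γ + tail₀ (λ r → F (suc r)) r γ} 0 β λ where
    zero    γ → ≃-sym (≃-trans (+-identityʳ _) (*-identityˡ _))
    (suc r) γ → ≃-sym (≃-trans (+-congʳ (zeroˡ _)) (+-identityˡ _)))
  (≃-trans (T-+ (λ r γ → δ₀ r * F 0 γ) (tail₀ (λ r → F (suc r))) 0 β) (+-congʳ (T-δ₀ (F 0) β)))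

-- ℓ l solves (1 - qˡ) ℓ l = Σ_{r ≥ 1} q^{l-r} T_r ℓ (l - r), ℓ 0 = G; it is
-- the coefficient of zˡ in ∏ₖ T (z qᵏ) applied to G.
ℓ-step : ℕ → (ℕ → Vec ℤ n → Vec ℤ n → PS) → Vec ℤ n → Vec ℤ n → PS
ℓ-step l h α β = recip l * T (tail₀ λ r β → qp (l ℕ.∸ r) * h r α β) 0 β

ℓ-history : ℕ → ℕ → Vec ℤ n → Vec ℤ n → PS
ℓ-history = hist G (λ _ _ → 0#) ℓ-step

ℓ : ℕ → Vec ℤ n → Vec ℤ n → PS
ℓ l = ℓ-history l 0

-- The coefficient of z^{l-r} in ∏_{k≥1} T(zq^k) applied to `G`: what is left for the later runs
-- after a first run of r letters. It is 0 for r > l by the default of `hist`.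
K : ℕ → Vec ℤ n → Vec ℤ n → ℕ → PS
K l α β r = qp (l ℕ.∸ r) * ℓ-history l r α β

Symmetric-zero : Symmetric {n} (λ _ _ → 0#)
Symmetric-zero w r α β = ≃-trans (T-zero r α λ r γ → zeroʳ _) (≃-sym (T-zero r β λ r γ → zeroʳ _))

-- The step acts on β only. The operator on α passes through it, turns into the operator on β by
-- hypothesis, and then commutes with the one inside the step.
Symmetric-ℓ-step : ∀ l (h : ℕ → Vec ℤ n → Vec ℤ n → PS) → (∀ r → Symmetric (h r)) → Symmetric (ℓ-step l h)
Symmetric-ℓ-step l h p w r α β = begin
  T (λ r α → w r * (recip l * T (F α) 0 β)) r α
    ≈⟨ T-cong r α (λ r α → ≃-trans (x∙yz≈y∙xz (w r) (recip l) (T (F α) 0 β))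
         (*-congˡ (≃-sym (T-* (w r) (F α) 0 β)))) ⟩
  T (λ r α → recip l * T (λ u β → w r * F α u β) 0 β) r α
    ≈⟨ T-* (recip l) (λ r α → T (λ u β → w r * F α u β) 0 β) r α ⟩
  recip l * T (λ r α → T (λ u β → w r * F α u β) 0 β) r α
    ≈⟨ *-congˡ (T-fubini (λ r u α β → w r * F α u β) r 0 α β) ⟩
  recip l * T (λ u β → T (λ r α → w r * F α u β) r α) 0 β
    ≈⟨ *-congˡ (T-cong 0 β λ u β → inner u β) ⟩
  recip l * T (λ u β → T (λ r β → w r * F α u β) r β) 0 β
    ≈⟨ *-congˡ (T-T-comm (λ u r β → w r * F α u β) 0 r β) ⟩
  recip l * T (λ r β → T (λ u β → w r * F α u β) 0 β) r β
    ≈⟨ ≃-sym (T-* (recip l) (λ r β → T (λ u β → w r * F α u β) 0 β) r β) ⟩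
  T (λ r β → recip l * T (λ u β → w r * F α u β) 0 β) r β
    ≈⟨ T-cong r β (λ r β → ≃-sym (≃-trans (x∙yz≈y∙xz (w r) (recip l) (T (F α) 0 β))
         (*-congˡ (≃-sym (T-* (w r) (F α) 0 β))))) ⟩
  T (λ r β → w r * (recip l * T (F α) 0 β)) r β ∎
  where
  F : Vec ℤ _ → Family _
  F α = tail₀ λ r β → qp (l ℕ.∸ r) * h r α β
  inner : ∀ u β → T (λ r α → w r * F α u β) r α ≃ T (λ r β → w r * F α u β) r β
  inner zero    β = Symmetric-zero w r α β
  inner (suc u) β = ≃-trans (T-cong r α λ r α → ≃-sym (*-assoc _ _ _))
    (≃-trans (p u (λ r → w r * qp (l ℕ.∸ u)) r α β) (T-cong r β λ r β → *-assoc _ _ _))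

ℓ-history-Symmetric : ∀ l r → Symmetric {n} (ℓ-history l r)
ℓ-history-Symmetric zero    zero    = G-Symmetric
ℓ-history-Symmetric zero    (suc r) = Symmetric-zero
ℓ-history-Symmetric (suc l) zero    = Symmetric-ℓ-step l (ℓ-history l) (ℓ-history-Symmetric l)
ℓ-history-Symmetric (suc l) (suc r) = ℓ-history-Symmetric l r

ind : ℕ → ℕ → PS
ind zero    r       = δ₀ r
ind (suc m) zero    = 0#
ind (suc m) (suc r) = ind m r

-- A family of symmetric functions of bounded degree is a sum of weighted ones.
T-symmetric : ∀ m (f : ℕ → Vec ℤ n → Vec ℤ n → PS) → (∀ r → Symmetric (f r)) → (∀ r α β → m ℕ.≤ r → f r α β ≃ 0#) →
  ∀ r α β → T (λ r α → f r α β) r α ≃ T (λ r β → f r α β) r β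
T-symmetric zero    f s p r α β = ≃-trans (T-zero r α λ r γ → p r γ β z≤n) (≃-sym (T-zero r β λ r γ → p r α γ z≤n))
T-symmetric (suc m) f s p r α β = begin
  T (λ r α → f r α β) r α
    ≈⟨ T-cong r α (λ r α → split r α β) ⟩
  T (λ r α → f′ r α β + ind m r * f m α β) r α
    ≈⟨ T-+ (λ r α → f′ r α β) (λ r α → ind m r * f m α β) r α ⟩
  T (λ r α → f′ r α β) r α + T (λ r α → ind m r * f m α β) r α
    ≈⟨ +-cong (T-symmetric m f′ s′ p′ r α β) (s m (ind m) r α β) ⟩
  T (λ r β → f′ r α β) r β + T (λ r β → ind m r * f m α β) r β
    ≈⟨ ≃-sym (T-+ (λ r β → f′ r α β) (λ r β → ind m r * f m α β) r β) ⟩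
  T (λ r β → f′ r α β + ind m r * f m α β) r β
    ≈⟨ T-cong r β (λ r β → ≃-sym (split r α β)) ⟩
  T (λ r β → f r α β) r β ∎
  where
  f′ : ℕ → Vec ℤ _ → Vec ℤ _ → PS
  f′ r α β = (1# - ind m r) * f r α β
  ind-refl : ∀ m → ind m m ≃ 1#
  ind-refl zero    = ≃-refl
  ind-refl (suc m) = ind-refl m
  ind-≢ : ∀ m r → m ≢ r → ind m r ≃ 0#
  ind-≢ zero    zero    p = ⊥-elim (p refl)
  ind-≢ zero    (suc r) p = ≃-refl
  ind-≢ (suc m) zero    p = ≃-refl
  ind-≢ (suc m) (suc r) p = ind-≢ m r (p ∘ cong suc)
  split : ∀ r α β → f r α β ≃ f′ r α β + ind m r * f m α β
  split r α β with m ℕ.≟ r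
  ... | yes refl = solve 2 (λ i f → f := (con 1ℤ :- i) :* f :+ i :* f) ≃-refl (ind m m) (f m α β)
  ... | no m≢r   = ≃-sym (≃-trans (+-cong (*-congʳ (+-congˡ (-‿cong (ind-≢ m r m≢r)))) (*-congʳ (ind-≢ m r m≢r)))
                     (solve 2 (λ f g → (con 1ℤ :- con 0ℤ) :* f :+ con 0ℤ :* g := f) ≃-refl (f r α β) (f m α β)))
  s′ : ∀ r → Symmetric (f′ r)
  s′ r w u α β = ≃-trans (T-cong u α λ u α → ≃-sym (*-assoc _ _ _))
    (≃-trans (s r (λ u → w u * (1# - ind m r)) u α β) (T-cong u β λ u β → *-assoc _ _ _))
  p′ : ∀ r α β → m ℕ.≤ r → f′ r α β ≃ 0#
  p′ r α β m≤r with m ℕ.≟ r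
  ... | yes refl = annihilateˡ (≃-trans (+-congˡ (-‿cong (ind-refl m))) (-‿inverseʳ 1#))
  ... | no m≢r   = annihilateʳ (p r α β (ℕ.≤∧≢⇒< m≤r m≢r))

ℓ-history-> : ∀ l r (α β : Vec ℤ n) → l ℕ.< r → ℓ-history l r α β ≃ 0#
ℓ-history-> l r α β l<r = ≃-reflexive (cong (λ f → f α β) (hist-> G (λ _ _ → 0#) ℓ-step l r l<r))

private
  K-Symmetric : ∀ l r → Symmetric {n} (λ α β → K l α β r)
  K-Symmetric l r w u α β = ≃-trans (T-cong u α λ u α → ≃-sym (*-assoc _ _ _))
    (≃-trans (ℓ-history-Symmetric l r (λ u → w u * qp (l ℕ.∸ r)) u α β) (T-cong u β λ u β → *-assoc _ _ _))

T-K-symmetric : ∀ l (α β : Vec ℤ n) → T (λ r α → K l α β r) 0 α ≃ T (λ r β → K l α β r) 0 β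
T-K-symmetric l α β = T-symmetric (suc l) (λ r α β → K l α β r) (K-Symmetric l)
  (λ r α β p → annihilateʳ (ℓ-history-> l r α β p)) 0 α β

private
  T-tail-symmetric : ∀ l (α β : Vec ℤ n) →
    T (tail₀ λ r β → qp (l ℕ.∸ r) * ℓ-history l r α β) 0 β ≃ T (tail₀ λ r α → qp (l ℕ.∸ r) * ℓ-history l r α β) 0 α
  T-tail-symmetric {n} l α β = ≃-sym (≃-trans (T-cong 0 α λ { zero γ → ≃-refl ; (suc r) γ → ≃-refl })
    (≃-trans (T-symmetric (suc (suc l)) f s p 0 α β) (T-cong 0 β λ { zero γ → ≃-refl ; (suc r) γ → ≃-refl })))
    where
    f : ℕ → Vec ℤ n → Vec ℤ n → PS
    f zero    α β = 0#
    f (suc r) α β = K l α β r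
    s : ∀ r → Symmetric (f r)
    s zero    = Symmetric-zero
    s (suc r) = K-Symmetric l r
    p : ∀ r α β → suc (suc l) ℕ.≤ r → f r α β ≃ 0#
    p (suc r) α β (s≤s l<r) = annihilateʳ (ℓ-history-> l r α β l<r)

ℓ-history-comm : ∀ l r (α β : Vec ℤ n) → ℓ-history l r α β ≃ ℓ-history l r β α
ℓ-history-comm zero    zero    α β = G-comm α β
ℓ-history-comm zero    (suc r) α β = ≃-refl
ℓ-history-comm (suc l) zero    α β = *-congˡ (≃-trans (T-tail-symmetric l α β) (T-cong 0 α λ where
  zero    γ → ≃-refl
  (suc r) γ → *-congˡ (ℓ-history-comm l r γ β)))
ℓ-history-comm (suc l) (suc r) α β = ℓ-history-comm l r α β

-- T(z) ∏_{k≥1} T(zq^k) = ∏_{k≥0} T(zq^k). On the side of β this is the recursion, whose summand r =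
-- 0 is q^l times the unknown and was solved for by `recip`; symmetry carries it over to α.
ℓ-T : ∀ l (α β : Vec ℤ n) → T (λ r α → K l α β r) 0 α ≃ ℓ l α β
ℓ-T l α β = ≃-trans (T-K-symmetric l α β) (solution l)
  where
  solution : ∀ l → T (λ r β → K l α β r) 0 β ≃ ℓ l α β
  solution zero = ≃-trans (T-head (λ r β → K 0 α β r) β) (≃-trans
    (+-cong (*-identityˡ _) (T-zero 0 β λ { zero γ → ≃-refl ; (suc r) γ → zeroʳ _ })) (+-identityʳ _))
  solution (suc l) = begin
    T (λ r β → K (suc l) α β r) 0 β
      ≈⟨ T-head (λ r β → K (suc l) α β r) β ⟩
    qp (suc l) * (recip l * t) + t
      ≈⟨ +-congˡ (≃-trans (≃-sym (*-identityˡ t)) (*-congʳ (≃-sym (recip-inverse l)))) ⟩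
    qp (suc l) * (recip l * t) + (1# - qp (suc l)) * recip l * t
      ≈⟨ solve 4 (λ o x i s → x :* (i :* s) :+ (o :- x) :* i :* s := o :* (i :* s)) ≃-refl 1# (qp (suc l)) (recip l) t ⟩
    1# * (recip l * t)
      ≈⟨ *-identityˡ _ ⟩
    ℓ (suc l) α β ∎
    where t = T (tail₀ λ r β → qp (l ℕ.∸ r) * ℓ-history l r α β) 0 β

ℓ-history-AdjEq : ∀ l r {α : Vec ℤ n} β → AdjEq α → ℓ-history l r α β ≃ 0#
ℓ-history-AdjEq zero    zero    β a = G-AdjEq β a
ℓ-history-AdjEq zero    (suc r) β a = ≃-refl
ℓ-history-AdjEq (suc l) zero    β a = annihilateʳ (T-zero 0 β λ where
  zero    γ → ≃-refl
  (suc r) γ → annihilateʳ (ℓ-history-AdjEq l r γ a))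
ℓ-history-AdjEq (suc l) (suc r) β a = ℓ-history-AdjEq l r β a

ℓ-history-HasZero : ∀ l r {α : Vec ℤ n} β → HasZero α → ℓ-history l r α β ≃ 0#
ℓ-history-HasZero zero    zero    β a = G-HasZero β a
ℓ-history-HasZero zero    (suc r) β a = ≃-refl
ℓ-history-HasZero (suc l) zero    β a = annihilateʳ (T-zero 0 β λ where
  zero    γ → ≃-refl
  (suc r) γ → annihilateʳ (ℓ-history-HasZero l r γ a))
ℓ-history-HasZero (suc l) (suc r) β a = ℓ-history-HasZero l r β a

ℓ-history-Swap : ∀ l r {α α′ : Vec ℤ n} β → Swap α α′ → ℓ-history l r α β ≃ - ℓ-history l r α′ β
ℓ-history-Swap zero    zero    β x = G-Swap β x
ℓ-history-Swap zero    (suc r) β x = solve 0 (con 0ℤ := :- con 0ℤ) ≃-refl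
ℓ-history-Swap (suc l) zero {α} {α′} β x = ≃-trans
  (*-congˡ (≃-trans (T-cong 0 β λ where
      zero    γ → solve 0 (con 0ℤ := :- con 0ℤ) ≃-refl
      (suc r) γ → ≃-trans (*-congˡ (ℓ-history-Swap l r γ x)) (solve 2 (λ p h → p :* :- h := :- (p :* h)) ≃-refl (qp (l ℕ.∸ r)) (ℓ-history l r α′ γ)))
    (T-neg (tail₀ λ r β → qp (l ℕ.∸ r) * ℓ-history l r α′ β) 0 β)))
  (solve 2 (λ i t → i :* :- t := :- (i :* t)) ≃-refl (recip l) (T (tail₀ λ r β → qp (l ℕ.∸ r) * ℓ-history l r α′ β) 0 β))
ℓ-history-Swap (suc l) (suc r) β x = ℓ-history-Swap l r β x

-- When an unbarred letter creates a tie, the barred half of the run is still to come, so the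
-- removal sum must vanish on ties too. Shifting exactly one of the tied entries gives two terms
-- that cancel by antisymmetry; shifting none or both keeps the tie.
es-AdjEq : ∀ s (F : Family n) → (∀ r {γ} → AdjEq γ → F r γ ≃ 0#) → (∀ r {γ γ′} → Swap γ γ′ → F r γ ≃ - F r γ′) →
  ∀ r {β} → AdjEq β → es s F r β ≃ 0#
es-AdjEq s F p x r {a ∷ .a ∷ γ} here = begin
  (es s (λ r δ → F r (a ∷ a ∷ δ)) r γ + es s (λ r δ → F (suc r) (a ∷ a ℤ.+ s ∷ δ)) r γ)
    + (es s (λ r δ → F (suc r) (a ℤ.+ s ∷ a ∷ δ)) r γ + es s (λ r δ → F (suc (suc r)) (a ℤ.+ s ∷ a ℤ.+ s ∷ δ)) r γ)
    ≈⟨ +-cong (+-cong (es-zero s _ r γ λ r δ _ → p r here) (≃-trans (es-cong s r γ λ r δ → x (suc r) here) (es-neg s _ r γ)))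
              (+-congˡ (es-zero s _ r γ λ r δ _ → p (suc (suc r)) here)) ⟩
  (0# - y) + (y + 0#)
    ≈⟨ solve 1 (λ y → (con 0ℤ :- y) :+ (y :+ con 0ℤ) := con 0ℤ) ≃-refl y ⟩
  0# ∎
  where y = es s (λ r δ → F (suc r) (a ℤ.+ s ∷ a ∷ δ)) r γ
es-AdjEq s F p x r {b ∷ β} (there a) = ≃-trans
  (+-cong (es-AdjEq s (λ r γ → F r (b ∷ γ)) (λ r y → p r (there y)) (λ r y → x r (there y)) r a)
          (es-AdjEq s (λ r γ → F (suc r) (b ℤ.+ s ∷ γ)) (λ r y → p (suc r) (there y)) (λ r y → x (suc r) (there y)) r a))
  (+-identityˡ 0#)

-- Dominant walks

import Data.List.Relation.Unary.All as ListAll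
import Data.List.Relation.Unary.All.Properties as ListAll
open import Data.List.Relation.Unary.AllPairs as AllPairs using (AllPairs; []; _∷_)
import Data.List.Relation.Unary.AllPairs.Properties as AllPairs
open import Data.Unit.Base using (⊤; tt)
open import Data.Vec.Relation.Unary.Linked as Linked using (Linked; []; [-]; _∷_)

upd : ℤ → Fin n → Vec ℤ n → Vec ℤ n
upd s j v = Vec.updateAt v j (ℤ._+ s)

⊕𝟘 : ∀ (v : Vec ℤ n) → v ⊕ 𝟘 n ≡ v
⊕𝟘 []      = refl
⊕𝟘 (a ∷ v) = cong₂ _∷_ (ℤ.+-identityʳ a) (⊕𝟘 v)

⊕-unbarred : ∀ (j : Fin n) v → v ⊕ wt (unbarred j) ≡ upd 1ℤ j v
⊕-unbarred zero    (a ∷ v) = cong (a ℤ.+ 1ℤ ∷_) (⊕𝟘 v)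
⊕-unbarred (suc j) (a ∷ v) = cong₂ _∷_ (ℤ.+-identityʳ a) (⊕-unbarred j v)

⊕-barred : ∀ (j : Fin n) v → v ⊕ wt (barred j) ≡ upd -1ℤ j v
⊕-barred zero    (a ∷ v) = cong (a ℤ.+ -1ℤ ∷_) (⊕-𝟘𝟘 v)
  where
  ⊕-𝟘𝟘 : ∀ {n} (v : Vec ℤ n) → v ⊕ (𝟘 n ⊖ 𝟘 n) ≡ v
  ⊕-𝟘𝟘 []      = refl
  ⊕-𝟘𝟘 (a ∷ v) = cong₂ _∷_ (ℤ.+-identityʳ a) (⊕-𝟘𝟘 v)
⊕-barred (suc j) (a ∷ v) = cong₂ _∷_ (ℤ.+-identityʳ a) (⊕-barred j v)

when : {P : Set} → Dec P → PS → PS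
when (yes _) x = x
when (no _)  x = 0#

when-cases : ∀ {P : Set} (d : Dec P) {x y} → (P → x ≃ y) → (¬ P → y ≃ 0#) → when d x ≃ y
when-cases (yes p) f g = f p
when-cases (no ¬p) f g = ≃-sym (g ¬p)

guard : Vec ℤ n → PS → PS
guard v = when (isPartition? v)

guard-cong : ∀ (v : Vec ℤ n) {x y} → (IsPartition v → x ≃ y) → guard v x ≃ guard v y
guard-cong v = cong′ (isPartition? v)
  where
  cong′ : ∀ {P : Set} (d : Dec P) {x y} → (P → x ≃ y) → when d x ≃ when d y
  cong′ (yes p) f = f p
  cong′ (no _)  f = ≃-refl

increasing free : List (Letter n) → Family n → Family n
increasing []       F r v = F r v
increasing (y ∷ ys) F r v = increasing ys F r v + guard (v ⊕ wt y) (increasing ys F (suc r) (v ⊕ wt y))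
free []       F r v = F r v
free (y ∷ ys) F r v = free ys F r v + free ys F (suc r) (v ⊕ wt y)

increasing-cong : ∀ (ys : List (Letter n)) {F F′} → (∀ r v → IsPartition v → F r v ≃ F′ r v) →
                  ∀ r v → IsPartition v → increasing ys F r v ≃ increasing ys F′ r v
increasing-cong []       p r v d = p r v d
increasing-cong (y ∷ ys) p r v d = +-cong (increasing-cong ys p r v d)
  (guard-cong (v ⊕ wt y) λ d′ → increasing-cong ys p (suc r) (v ⊕ wt y) d′)

increasing-++ : ∀ (xs ys : List (Letter n)) F r v → increasing (xs ++ ys) F r v ≡ increasing xs (increasing ys F) r v
increasing-++ []       ys F r v = refl
increasing-++ (x ∷ xs) ys F r v = cong₂ (λ a b → a + guard (v ⊕ wt x) b)
  (increasing-++ xs ys F r v) (increasing-++ xs ys F (suc r) (v ⊕ wt x))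

-- At a letter that leaves the dominant chamber, all continuations of the run by later letters have
-- to cancel together.
Safe : Family n → List (Letter n) → Set
Safe F []       = ⊤
Safe F (y ∷ ys) = (∀ r v → IsPartition v → ¬ IsPartition (v ⊕ wt y) → free ys F r (v ⊕ wt y) ≃ 0#) × Safe F ys

increasing≃free : ∀ ys (F : Family n) → Safe F ys → ∀ r v → IsPartition v → increasing ys F r v ≃ free ys F r v
increasing≃free []       F s r v d = ≃-refl
increasing≃free (y ∷ ys) F (p , s) r v d = +-cong (increasing≃free ys F s r v d)
  (when-cases (isPartition? (v ⊕ wt y)) (increasing≃free ys F s (suc r) (v ⊕ wt y)) (p (suc r) v d))

free-zero : ∀ (Bad : Vec ℤ n → Set) ys F → ListAll.All (λ y → ∀ v → Bad v → Bad (v ⊕ wt y)) ys →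
            (∀ r v → Bad v → F r v ≃ 0#) → ∀ r v → Bad v → free ys F r v ≃ 0#
free-zero Bad []       F a             p r v b = p r v b
free-zero Bad (y ∷ ys) F (a ListAll.∷ as) p r v b = ≃-trans
  (+-cong (free-zero Bad ys F as p r v b) (free-zero Bad ys F as p (suc r) (v ⊕ wt y) (a v b))) (+-identityˡ 0#)

-- v + ρ has equal entries at positions p and p + 1.
data Clash : Fin n → Vec ℤ n → Set where
  here  : ∀ {a c} {v : Vec ℤ n} → c ≡ a ℤ.+ 1ℤ → Clash zero (a ∷ c ∷ v)
  there : ∀ {p a} {v : Vec ℤ n} → Clash p v → Clash (suc p) (a ∷ v)

-- The last entry of v + ρ vanishes.
data LastZero : Fin n → Vec ℤ n → Set where
  here  : LastZero zero (-1ℤ ∷ [])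
  there : ∀ {p a} {v : Vec ℤ n} → LastZero p v → LastZero (suc p) (a ∷ v)

Clash⇒AdjEq : ∀ {p} {v : Vec ℤ n} → Clash p v → AdjEq (v ⊕ ρ n)
Clash⇒AdjEq {n = suc (suc n)} {v = a ∷ _ ∷ v} (here refl) = subst (λ z → AdjEq (a ℤ.+ + suc (suc n) ∷ z ∷ v ⊕ ρ n))
  (IntSolver.solve 2 (λ a m → a ⊞ (IntSolver.con 1ℤ ⊞ m) ⊜ a ⊞ IntSolver.con 1ℤ ⊞ m) refl a (+ suc n)) AdjEq.here
Clash⇒AdjEq (there x) = AdjEq.there (Clash⇒AdjEq x)

LastZero⇒HasZero : ∀ {p} {v : Vec ℤ n} → LastZero p v → HasZero (v ⊕ ρ n)
LastZero⇒HasZero here      = here refl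
LastZero⇒HasZero (there x) = there (LastZero⇒HasZero x)

Clash-below : ∀ {s p j} {v : Vec ℤ n} → suc (toℕ p) ℕ.< toℕ j → Clash p v → Clash p (upd s j v)
Clash-below {j = suc (suc j)} _ (here e) = here e
Clash-below {j = suc zero} (s≤s ()) (here e)
Clash-below {j = suc j} (s≤s l) (there x) = there (Clash-below l x)

Clash-above : ∀ {s p j} {v : Vec ℤ n} → toℕ j ℕ.< toℕ p → Clash p v → Clash p (upd s j v)
Clash-above {j = zero}  _       (there x) = there x
Clash-above {j = suc j} (s≤s l) (there x) = there (Clash-above l x)

LastZero-above : ∀ {s p j} {v : Vec ℤ n} → toℕ j ℕ.< toℕ p → LastZero p v → LastZero p (upd s j v)
LastZero-above {j = zero}  _       (there x) = there x
LastZero-above {j = suc j} (s≤s l) (there x) = there (LastZero-above l x)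

private
  tail-partition : ∀ {a} {v : Vec ℤ n} → IsPartition (a ∷ v) → IsPartition v
  tail-partition ([-]    , _ ∷ [])  = [] , []
  tail-partition (_ ∷ l  , _ ∷ ps) = l , ps

  i≤i+1 : ∀ a → a ℤ.≤ a ℤ.+ 1ℤ
  i≤i+1 a = ℤ.i≤i+j a 1ℤ

  i-1≤i : ∀ a → a ℤ.+ -1ℤ ℤ.≤ a
  i-1≤i a = ℤ.i≤j⇒i-k≤j 1ℤ ℤ.≤-refl

  <⇒≤-1 : ∀ {c a} → c ℤ.< a → c ℤ.≤ a ℤ.+ -1ℤ
  <⇒≤-1 {c} {a} p = subst (c ℤ.≤_) (ℤ.+-comm -1ℤ a) (ℤ.i<j⇒i≤pred[j] p)

add-box : ∀ (i : Fin n) v → IsPartition v →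
  IsPartition (upd 1ℤ i v) ⊎ ∃ λ p → toℕ i ≡ suc (toℕ p) × Clash p (upd 1ℤ i v)
add-box zero (a ∷ [])    ([-]   , p ∷ ps) = inj₁ ([-] , ℤ.≤-trans p (i≤i+1 a) ∷ ps)
add-box zero (a ∷ c ∷ v) (l ∷ m , p ∷ ps) = inj₁ (ℤ.≤-trans l (i≤i+1 a) ∷ m , ℤ.≤-trans p (i≤i+1 a) ∷ ps)
add-box (suc i) (a ∷ v) d with add-box i v (tail-partition d)
... | inj₂ (p , e , x) = inj₂ (suc p , cong suc e , there x)
add-box (suc zero) (a ∷ c ∷ v) (l ∷ m , p ∷ ps) | inj₁ (m′ , ps′) with c ℤ.≟ a
... | yes refl = inj₂ (zero , refl , here refl)
... | no c≢a   = inj₁ (subst (ℤ._≤ a) (ℤ.+-comm 1ℤ c) (ℤ.i<j⇒suc[i]≤j (ℤ.≤∧≢⇒< l c≢a)) ∷ m′ , p ∷ ps′)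
add-box (suc (suc i)) (a ∷ c ∷ v) (l ∷ m , p ∷ ps) | inj₁ (m′ , ps′) = inj₁ (l ∷ m′ , p ∷ ps′)

remove-box : ∀ (i : Fin n) v → IsPartition v →
  IsPartition (upd -1ℤ i v) ⊎ (Clash i (upd -1ℤ i v) ⊎ LastZero i (upd -1ℤ i v))
remove-box zero (a ∷ []) ([-] , p ∷ ps) with 0ℤ ℤ.≟ a
... | yes refl = inj₂ (inj₂ here)
... | no 0≢a   = inj₁ ([-] , <⇒≤-1 (ℤ.≤∧≢⇒< p 0≢a) ∷ ps)
remove-box zero (a ∷ c ∷ v) (l ∷ m , p ∷ ps@(p′ ∷ _)) with c ℤ.≟ a
... | yes refl = inj₂ (inj₁ (here (IntSolver.solve 1 (λ a → a ⊜ a ⊞ IntSolver.con -1ℤ ⊞ IntSolver.con 1ℤ) refl a)))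
... | no c≢a   = inj₁ (c≤ ∷ m , ℤ.≤-trans p′ c≤ ∷ ps)
  where c≤ = <⇒≤-1 (ℤ.≤∧≢⇒< l c≢a)
remove-box (suc i) (a ∷ v) d with remove-box i v (tail-partition d)
... | inj₂ (inj₁ x) = inj₂ (inj₁ (there x))
... | inj₂ (inj₂ x) = inj₂ (inj₂ (there x))
remove-box (suc zero) (a ∷ c ∷ v) (l ∷ m , p ∷ ps) | inj₁ (m′ , ps′) = inj₁ (ℤ.≤-trans (i-1≤i c) l ∷ m′ , p ∷ ps′)
remove-box (suc (suc i)) (a ∷ c ∷ v) (l ∷ m , p ∷ ps) | inj₁ (m′ , ps′) = inj₁ (l ∷ m′ , p ∷ ps′)

allFin-sorted : ∀ n → AllPairs Fin._<_ (List.allFin n)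
allFin-sorted n = AllPairs.tabulate⁺-< λ i<j → i<j

All-reverse : ∀ {A : Set} {P : A → Set} {xs : List A} → ListAll.All P xs → ListAll.All P (List.reverse xs)
All-reverse ListAll.[] = ListAll.[]
All-reverse {P = P} {x ∷ xs} (p ListAll.∷ ps) = subst (ListAll.All P) (sym (List.unfold-reverse x xs))
  (ListAll.++⁺ (All-reverse ps) (p ListAll.∷ ListAll.[]))

reverse-sorted : ∀ {A : Set} {R : A → A → Set} {xs : List A} → AllPairs R xs → AllPairs (λ x y → R y x) (List.reverse xs)
reverse-sorted []            = []
reverse-sorted {R = R} {x ∷ xs} (a ∷ as) = subst (AllPairs (λ x y → R y x)) (sym (List.unfold-reverse x xs))
  (AllPairs.++⁺ (reverse-sorted as) (ListAll.[] ∷ []) (ListAll.map (λ r → r ListAll.∷ ListAll.[]) (All-reverse a)))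

-- A box added in row i can only create a tie with the row above. The later unbarred letters act
-- strictly below row i, so the tie persists to the end of the list.
Safe-unbarred : ∀ (F : Family n) → (∀ r v → AdjEq (v ⊕ ρ n) → F r v ≃ 0#) →
                ∀ {js} → AllPairs Fin._<_ js → Safe F (List.map unbarred js)
Safe-unbarred F p [] = tt
Safe-unbarred {n} F p {i ∷ js} (a ∷ as) = stuck , Safe-unbarred F p as
  where
  stuck : ∀ r v → IsPartition v → ¬ IsPartition (v ⊕ wt (unbarred i)) → free (List.map unbarred js) F r (v ⊕ wt (unbarred i)) ≃ 0#
  stuck r v d ¬d with add-box i v d
  ... | inj₁ d′ = ⊥-elim (¬d (subst IsPartition (sym (⊕-unbarred i v)) d′))
  ... | inj₂ (k , e , x) = free-zero (Clash k) (List.map unbarred js) F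
    (ListAll.map⁺ (ListAll.map (λ {j} i<j v x → subst (Clash k) (sym (⊕-unbarred j v)) (Clash-below (subst (ℕ._< toℕ j) e i<j) x)) a))
    (λ r v x → p r v (Clash⇒AdjEq x)) r _ (subst (Clash k) (sym (⊕-unbarred i v)) x)

-- Barred letters run through the rows upwards. A box removed from row i can only create a tie with
-- the row below or, in the last row, a zero; the later letters act strictly above row i and disturb
-- neither.
Safe-barred : ∀ (F : Family n) → (∀ r v → AdjEq (v ⊕ ρ n) → F r v ≃ 0#) → (∀ r v → HasZero (v ⊕ ρ n) → F r v ≃ 0#) →
              ∀ {js} → AllPairs (λ i j → j Fin.< i) js → Safe F (List.map barred js)
Safe-barred F p z [] = tt
Safe-barred {n} F p z {i ∷ js} (a ∷ as) = stuck , Safe-barred F p z as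
  where
  stuck : ∀ r v → IsPartition v → ¬ IsPartition (v ⊕ wt (barred i)) → free (List.map barred js) F r (v ⊕ wt (barred i)) ≃ 0#
  stuck r v d ¬d with remove-box i v d
  ... | inj₁ d′ = ⊥-elim (¬d (subst IsPartition (sym (⊕-barred i v)) d′))
  ... | inj₂ (inj₁ x) = free-zero (Clash i) (List.map barred js) F
    (ListAll.map⁺ (ListAll.map (λ {j} j<i v x → subst (Clash i) (sym (⊕-barred j v)) (Clash-above j<i x)) a))
    (λ r v x → p r v (Clash⇒AdjEq x)) r _ (subst (Clash i) (sym (⊕-barred i v)) x)
  ... | inj₂ (inj₂ x) = free-zero (LastZero i) (List.map barred js) F
    (ListAll.map⁺ (ListAll.map (λ {j} j<i v x → subst (LastZero i) (sym (⊕-barred j v)) (LastZero-above j<i x)) a))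
    (λ r v x → z r v (LastZero⇒HasZero x)) r _ (subst (LastZero i) (sym (⊕-barred i v)) x)

free-upd : ℤ → List (Fin n) → Family n → Family n
free-upd s []       F r v = F r v
free-upd s (j ∷ js) F r v = free-upd s js F r v + free-upd s js F (suc r) (upd s j v)

free-letters : ∀ s (x : Fin n → Letter n) → (∀ j v → v ⊕ wt (x j) ≡ upd s j v) →
               ∀ js F r v → free (List.map x js) F r v ≡ free-upd s js F r v
free-letters s x h []       F r v = refl
free-letters s x h (j ∷ js) F r v = cong₂ _+_ (free-letters s x h js F r v)
  (trans (cong (free (List.map x js) F (suc r)) (h j v)) (free-letters s x h js F (suc r) (upd s j v)))

free-upd-suc : ∀ s js (F : Family (suc n)) r a v → free-upd s (List.map suc js) F r (a ∷ v) ≡ free-upd s js (λ r γ → F r (a ∷ γ)) r v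
free-upd-suc s []       F r a v = refl
free-upd-suc s (j ∷ js) F r a v = cong₂ _+_ (free-upd-suc s js F r a v) (free-upd-suc s js F (suc r) a (upd s j v))

free-upd-∷ʳ : ∀ s js j (F : Family n) r v →
  free-upd s (js ∷ʳ j) F r v ≡ free-upd s js (λ r v → F r v + F (suc r) (upd s j v)) r v
free-upd-∷ʳ s []       j F r v = refl
free-upd-∷ʳ s (k ∷ js) j F r v = cong₂ _+_ (free-upd-∷ʳ s js j F r v) (free-upd-∷ʳ s js j F (suc r) (upd s k v))

free-upd-allFin : ∀ s (F : Family n) r v → free-upd s (List.allFin n) F r v ≃ es s F r v
free-upd-allFin {zero}  s F r [] = ≃-refl
free-upd-allFin {suc n} s F r (a ∷ v) = ≃-trans
  (≃-reflexive (trans (cong (λ l → free-upd s l F r (a ∷ v)) (allFin-suc n))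
    (cong₂ _+_ (free-upd-suc s (List.allFin n) F r a v) (free-upd-suc s (List.allFin n) F (suc r) (a ℤ.+ s) v))))
  (+-cong (free-upd-allFin s (λ r γ → F r (a ∷ γ)) r v)
    (≃-trans (free-upd-allFin s (λ r γ → F r (a ℤ.+ s ∷ γ)) (suc r) v) (≃-sym (es-suc s (λ r γ → F r (a ℤ.+ s ∷ γ)) r v))))

free-upd-reverse : ∀ s (F : Family n) r v → free-upd s (List.reverse (List.allFin n)) F r v ≃ es s F r v
free-upd-reverse {zero}  s F r [] = ≃-refl
free-upd-reverse {suc n} s F r (a ∷ v) = ≃-trans
  (≃-reflexive (trans (cong (λ l → free-upd s l F r (a ∷ v)) (trans (cong List.reverse (allFin-suc n))
      (trans (List.unfold-reverse zero (List.map suc (List.allFin n))) (cong (_∷ʳ zero) (sym (List.reverse-map suc (List.allFin n)))))))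
    (trans (free-upd-∷ʳ s (List.map suc (List.reverse (List.allFin n))) zero F r (a ∷ v))
      (free-upd-suc s (List.reverse (List.allFin n)) (λ r v → F r v + F (suc r) (upd s zero v)) r a v))))
  (≃-trans (free-upd-reverse s (λ r γ → F r (a ∷ γ) + F (suc r) (a ℤ.+ s ∷ γ)) r v)
    (es-+ s (λ r γ → F r (a ∷ γ)) (λ r γ → F (suc r) (a ℤ.+ s ∷ γ)) r v))

es-⊕ : ∀ s (F : Family n) r v κ → es s (λ r v → F r (v ⊕ κ)) r v ≃ es s F r (v ⊕ κ)
es-⊕ s F r []      []      = ≃-refl
es-⊕ s F r (a ∷ v) (k ∷ κ) = +-cong (es-⊕ s _ r v κ)
  (≃-trans (es-cong s r v λ r γ → ≃-reflexive (cong (λ z → F (suc r) (z ∷ γ ⊕ κ))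
     (IntSolver.solve 3 (λ a s k → a ⊞ s ⊞ k ⊜ a ⊞ k ⊞ s) refl a s k)))
   (es-⊕ s (λ r γ → F (suc r) (a ℤ.+ k ℤ.+ s ∷ γ)) r v κ))

-- Words that leave the dominant chamber contribute nothing to alternating functions.
increasing≃T : ∀ (F : Family n) →
  (∀ r {β} → AdjEq β → F r β ≃ 0#) → (∀ r {β} → HasZero β → F r β ≃ 0#) → (∀ r {β} → AdjEq β → es -1ℤ F r β ≃ 0#) →
  ∀ r v → IsPartition v → increasing (alphabet n) (λ r v → F r (v ⊕ ρ n)) r v ≃ T F r (v ⊕ ρ n)
increasing≃T {n} F adj zer adj′ r v d = begin
  increasing (us ++ bs) F′ r v
    ≈⟨ ≃-reflexive (increasing-++ us bs F′ r v) ⟩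
  increasing us (increasing bs F′) r v
    ≈⟨ increasing-cong us (increasing≃free bs F′ (Safe-barred F′ (λ r v → adj r) (λ r v → zer r) (reverse-sorted (allFin-sorted n)))) r v d ⟩
  increasing us (free bs F′) r v
    ≈⟨ increasing≃free us (free bs F′) (Safe-unbarred (free bs F′) (λ r v a → ≃-trans (free-bs r v) (adj′ r a)) (allFin-sorted n)) r v d ⟩
  free us (free bs F′) r v
    ≈⟨ ≃-trans (≃-reflexive (free-letters 1ℤ unbarred ⊕-unbarred (List.allFin n) (free bs F′) r v)) (free-upd-allFin 1ℤ (free bs F′) r v) ⟩
  es 1ℤ (free bs F′) r v
    ≈⟨ es-cong 1ℤ r v free-bs ⟩
  es 1ℤ (λ r v → es -1ℤ F r (v ⊕ ρ n)) r v
    ≈⟨ es-⊕ 1ℤ (es -1ℤ F) r v (ρ n) ⟩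
  T F r (v ⊕ ρ n) ∎
  where
  us = List.map unbarred (List.allFin n)
  bs = List.map barred (List.reverse (List.allFin n))
  F′ : Family n
  F′ r v = F r (v ⊕ ρ n)
  free-bs : ∀ r v → free bs F′ r v ≃ es -1ℤ F r (v ⊕ ρ n)
  free-bs r v = ≃-trans (≃-reflexive (free-letters -1ℤ barred ⊕-barred (List.reverse (List.allFin n)) F′ r v))
    (≃-trans (free-upd-reverse -1ℤ F′ r v) (es-⊕ -1ℤ F r v (ρ n)))

increasing-suc : ∀ (ys : List (Letter n)) F r v → increasing ys F (suc r) v ≡ increasing ys (λ r → F (suc r)) r v
increasing-suc []       F r v = refl
increasing-suc (y ∷ ys) F r v = cong₂ (λ a b → a + guard (v ⊕ wt y) b) (increasing-suc ys F r v) (increasing-suc ys F (suc r) (v ⊕ wt y))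

-- The empty run involves `F 0`, which contains the unknown itself. Once it is subtracted, agreement
-- on shorter remaining walks suffices.
increasing-rest-cong : ∀ (ys : List (Letter n)) {F F′} → (∀ r v → IsPartition v → F (suc r) v ≃ F′ (suc r) v) →
  ∀ v → IsPartition v → increasing ys F 0 v - F 0 v ≃ increasing ys F′ 0 v - F′ 0 v
increasing-rest-cong []       p v d = ≃-trans (-‿inverseʳ _) (≃-sym (-‿inverseʳ _))
increasing-rest-cong (y ∷ ys) {F} {F′} p v d = ≃-trans
  (solve 3 (λ x y z → x :+ y :- z := x :- z :+ y) ≃-refl (increasing ys F 0 v) _ (F 0 v))
  (≃-trans (+-cong (increasing-rest-cong ys p v d) (guard-cong (v ⊕ wt y) λ d′ →
      ≃-trans (≃-reflexive (increasing-suc ys F 0 (v ⊕ wt y)))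
        (≃-trans (increasing-cong ys p 0 (v ⊕ wt y) d′) (≃-reflexive (sym (increasing-suc ys F′ 0 (v ⊕ wt y)))))))
    (solve 3 (λ x y z → x :- z :+ y := x :+ y :- z) ≃-refl (increasing ys F′ 0 v) _ (F′ 0 v)))

-- Walks from λ to the empty partition

sum-⊕ : ∀ (v w : Vec ℤ n) → sum (v ⊕ w) ≡ sum v ℤ.+ sum w
sum-⊕ []      []      = refl
sum-⊕ (a ∷ v) (b ∷ w) = trans (cong (λ z → a ℤ.+ b ℤ.+ z) (sum-⊕ v w))
  (IntSolver.solve 4 (λ a b x y → a ⊞ b ⊞ (x ⊞ y) ⊜ a ⊞ x ⊞ (b ⊞ y)) refl a b (sum v) (sum w))

StrictPos-⊕ρ : ∀ (v : Vec ℤ n) → IsPartition v → StrictPos (v ⊕ ρ n)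
StrictPos-⊕ρ [] _ = []
StrictPos-⊕ρ (a ∷ []) ([-] , p ∷ []) = cons (ℤ.+-mono-≤-< p (ℤ.+<+ (s≤s z≤n))) [] []
StrictPos-⊕ρ {suc (suc n)} (a ∷ c ∷ v) (l ∷ m , p ∷ ps) with StrictPos-⊕ρ (c ∷ v) (m , ps)
... | s@(cons _ b _) = cons (ℤ.+-mono-≤-< p (ℤ.+<+ (s≤s z≤n))) (lt ∷ All.map (λ x → ℤ.<-trans x lt) b) s
  where
  lt : c ℤ.+ + suc n ℤ.< a ℤ.+ + suc (suc n)
  lt = ℤ.+-mono-≤-< l (ℤ.+<+ ℕ.≤-refl)

⊕ρ-injective : ∀ (v w κ : Vec ℤ n) → v ⊕ κ ≡ w ⊕ κ → v ≡ w
⊕ρ-injective []      []      []      _ = refl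
⊕ρ-injective (a ∷ v) (b ∷ w) (k ∷ κ) e = cong₂ _∷_ (+ℤ-cancelʳ a b k (cong Vec.head e)) (⊕ρ-injective v w κ (cong Vec.tail e))

sum-nonneg : ∀ {v : Vec ℤ n} → All (0ℤ ℤ.≤_) v → 0ℤ ℤ.≤ sum v
sum-nonneg []       = ℤ.≤-refl
sum-nonneg (p ∷ ps) = ℤ.+-mono-≤ p (sum-nonneg ps)

-- Cz and DQ carry the factors q^{l-r-∣λ∣} and q^∣λ∣ of q^{l-r} L (l - r).

module _ {n : ℕ} where

  size : Vec ℤ n → ℤ
  size β = sum β ℤ.- sum (ρ n)

  L : ℕ → Vec ℤ n → PS
  L l β = C′z (+ l ℤ.- size β) * D β

  KL : ℕ → Family n
  KL l r β = Cz (+ l ℤ.- size β ℤ.- + r) * DQ β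

  private
    Shifted-sum⁻ : ∀ {n r r′} {β γ : Vec ℤ n} → Shifted -1ℤ r β r′ γ → sum γ ℤ.+ + r′ ≡ sum β ℤ.+ + r
    Shifted-sum⁻ [] = refl
    Shifted-sum⁻ {r = r} {r′} {b ∷ β} {_ ∷ γ} (keep x) = trans (ℤ.+-assoc b (sum γ) (+ r′))
      (trans (cong (λ z → b ℤ.+ z) (Shifted-sum⁻ x)) (sym (ℤ.+-assoc b (sum β) (+ r))))
    Shifted-sum⁻ {r = r} {r′} {b ∷ β} {_ ∷ γ} (step x) = trans
      (IntSolver.solve 3 (λ b γ r → b ⊞ IntSolver.con -1ℤ ⊞ γ ⊞ r ⊜ b ⊞ IntSolver.con -1ℤ ⊞ (γ ⊞ r)) refl b (sum γ) (+ r′))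
      (trans (cong (λ z → b ℤ.+ -1ℤ ℤ.+ z) (Shifted-sum⁻ x))
        (IntSolver.solve 3 (λ b β r → b ⊞ IntSolver.con -1ℤ ⊞ (β ⊞ (IntSolver.con 1ℤ ⊞ r)) ⊜ b ⊞ β ⊞ r) refl b (sum β) (+ r)))

  -- Each removed box lowers the size by 1 and raises r by 1, so the scalar stays constant and only
  -- the branching rule `es-DQ` remains.
  es-KL : ∀ l r β → es -1ℤ (KL l) r β ≃ Cz (+ l ℤ.- size β ℤ.- + r) * D β
  es-KL l r β = ≃-trans
    (es-cong∈ -1ℤ {F′ = λ _ δ → x * DQ δ} r β λ r′ γ y → *-congʳ (≃-reflexive (cong Cz (index y))))
    (≃-trans (es-* -1ℤ x (λ _ → DQ) r β) (*-congˡ (es-DQ r β)))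
    where
    x = Cz (+ l ℤ.- size β ℤ.- + r)
    index : ∀ {r′ γ} → Shifted -1ℤ r β r′ γ → + l ℤ.- size γ ℤ.- + r′ ≡ + l ℤ.- size β ℤ.- + r
    index {r′} {γ} y = trans
      (IntSolver.solve 4 (λ l γ p r → l ⊟ (γ ⊟ p) ⊟ r ⊜ l ⊞ p ⊟ (γ ⊞ r)) refl (+ l) (sum γ) (sum (ρ n)) (+ r′))
      (trans (cong (λ z → + l ℤ.+ sum (ρ n) ℤ.- z) (Shifted-sum⁻ y))
        (IntSolver.solve 4 (λ l γ p r → l ⊞ p ⊟ (γ ⊞ r) ⊜ l ⊟ (γ ⊟ p) ⊟ r) refl (+ l) (sum β) (sum (ρ n)) (+ r)))

  -- An added box costs z², once through the size and once through r. The Pieri rule then yields Σ η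
  -- r C_{z-2r}, which is C′. The bound l ≤ n guarantees that all strips that occur fit into n rows.
  T-KL : ∀ l → l ℕ.≤ n → ∀ β → StrictPos β → 0ℤ ℤ.≤ size β → T (KL l) 0 β ≃ L l β
  T-KL l l≤n β s p = begin
    es 1ℤ (es -1ℤ (KL l)) 0 β
      ≈⟨ es-cong∈ 1ℤ {F′ = λ r δ → Cz (down z r) * D δ} 0 β (λ r γ y → ≃-trans (es-KL l r γ) (*-congʳ (≃-reflexive (cong Cz (index y))))) ⟩
    es 1ℤ (λ r δ → Cz (down z r) * D δ) 0 β
      ≈⟨ es-D-θ (λ r → Cz (down z r)) s (λ r θ<r → Cz-negative (small r θ<r)) ⟩
    dot n (λ r → Cz (down z r)) η * D β
      ≈⟨ *-congʳ (≃-trans (dot-swap n (λ r → Cz (down z r)) η) (≃-sym (C′-dot z n z≤n′))) ⟩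
    C′z z * D β ∎
    where
    z = + l ℤ.- size β
    z≤n′ : z ℤ.≤ + n
    z≤n′ = ℤ.≤-trans (subst (z ℤ.≤_) (ℤ.+-identityʳ (+ l)) (ℤ.+-monoʳ-≤ (+ l) (ℤ.neg-mono-≤ p))) (ℤ.+≤+ l≤n)
    index : ∀ {r γ} → Shifted 1ℤ 0 β r γ → + l ℤ.- size γ ℤ.- + r ≡ down z r
    index {r} {γ} y = trans
      (IntSolver.solve 4 (λ l γ p r → l ⊟ (γ ⊟ p) ⊟ r ⊜ l ⊞ p ⊟ (γ ⊞ IntSolver.con 0ℤ) ⊟ r) refl (+ l) (sum γ) (sum (ρ n)) (+ r))
      (trans (cong (λ x → + l ℤ.+ sum (ρ n) ℤ.- x ℤ.- + r) (Shifted-sum y))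
        (IntSolver.solve 4 (λ l β p r → l ⊞ p ⊟ (β ⊞ r) ⊟ r ⊜ l ⊟ (β ⊟ p) ⊟ (r ⊞ r)) refl (+ l) (sum β) (sum (ρ n)) (+ r)))
    small : ∀ r → θ β ℤ.< + r → down z r ℤ.< 0ℤ
    small r θ<r = subst (down z r ℤ.<_) (ℤ.+-inverseʳ (+ (r ℕ.+ r))) (ℤ.+-monoˡ-< (ℤ.- + (r ℕ.+ r))
      (ℤ.≤-<-trans (ℤ.≤-trans (ℤ.+-monoˡ-≤ (ℤ.- size β) (ℤ.+≤+ l≤n)) (ℤ.≤-reflexive
         (IntSolver.solve 3 (λ n β p → n ⊟ (β ⊟ p) ⊜ n ⊞ p ⊟ β) refl (+ n) (sum β) (sum (ρ n)))))
       (ℤ.<-≤-trans θ<r (ℤ.+≤+ (ℕ.m≤m+n r r)))))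

  KL-L : ∀ l r β → 0ℤ ℤ.≤ size β → r ℕ.≤ l → KL l r β ≃ qp (l ℕ.∸ r) * L (l ℕ.∸ r) β
  KL-L l r β p r≤l = go (+ (l ℕ.∸ r) ℤ.- size β) refl (size β) refl p
    where
    index : + l ℤ.- size β ℤ.- + r ≡ + (l ℕ.∸ r) ℤ.- size β
    index = trans (IntSolver.solve 3 (λ l s r → l ⊟ s ⊟ r ⊜ l ⊟ r ⊟ s) refl (+ l) (size β) (+ r))
      (cong (ℤ._- size β) (trans (ℤ.m-n≡m⊖n l r) (ℤ.⊖-≥ r≤l)))
    go : ∀ y → + (l ℕ.∸ r) ℤ.- size β ≡ y → ∀ s → size β ≡ s → 0ℤ ℤ.≤ s →
         Cz (+ l ℤ.- size β ℤ.- + r) * DQ β ≃ qp (l ℕ.∸ r) * (C′z (+ (l ℕ.∸ r) ℤ.- size β) * D β)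
    go -[1+ k ] e _ _ _ = ≃-trans (*-congʳ (≃-reflexive (cong Cz (trans index e)))) (≃-trans (zeroˡ _)
      (≃-sym (annihilateʳ (annihilateˡ (≃-reflexive (cong C′z e))))))
    go (+ Θ) e (+ s) e′ _ = begin
      Cz (+ l ℤ.- size β ℤ.- + r) * DQ β
        ≈⟨ *-cong (≃-trans (≃-reflexive (cong Cz (trans index e))) (C≃q*C′ Θ)) (DQ≃qz*D β (+ s) total) ⟩
      qp Θ * C′ Θ * (qp s * D β)
        ≈⟨ solve 4 (λ a c b d → a :* c :* (b :* d) := a :* b :* (c :* d)) ≃-refl (qp Θ) (C′ Θ) (qp s) (D β) ⟩
      qp Θ * qp s * (C′ Θ * D β)
        ≈⟨ *-cong (≃-trans (≃-sym (pow-+ q Θ s)) (≃-reflexive (cong qp degree))) (*-congʳ (≃-reflexive (sym (cong C′z e)))) ⟩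
      qp (l ℕ.∸ r) * (C′z (+ (l ℕ.∸ r) ℤ.- size β) * D β) ∎
      where
      total : sum β ≡ + s ℤ.+ sum (ρ n)
      total = trans (IntSolver.solve 2 (λ β p → β ⊜ β ⊟ p ⊞ p) refl (sum β) (sum (ρ n))) (cong (ℤ._+ sum (ρ n)) e′)
      degree : Θ ℕ.+ s ≡ l ℕ.∸ r
      degree = ℤ.+-injective (trans (cong₂ ℤ._+_ (sym e) (sym e′))
        (IntSolver.solve 2 (λ m s → m ⊟ s ⊞ s ⊜ m) refl (+ (l ℕ.∸ r)) (size β)))

  KL-> : ∀ l r β → 0ℤ ℤ.≤ size β → l ℕ.< r → KL l r β ≃ 0#
  KL-> l r β p l<r = annihilateˡ (Cz-negative
    (subst (+ l ℤ.- size β ℤ.- + r ℤ.<_) (ℤ.+-inverseʳ (+ r)) (ℤ.+-monoˡ-< (ℤ.- + r)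
      (ℤ.≤-<-trans (subst (+ l ℤ.- size β ℤ.≤_) (ℤ.+-identityʳ (+ l)) (ℤ.+-monoʳ-≤ (+ l) (ℤ.neg-mono-≤ p))) (ℤ.+<+ l<r)))))

  prod-Eq-HasZero : ∀ {n} (γ : Vec ℤ n) → HasZero γ → prod Eq γ ≃ 0#
  prod-Eq-HasZero (.0ℤ ∷ γ) (here refl) = zeroˡ _
  prod-Eq-HasZero (c ∷ γ)   (there x)   = annihilateʳ (prod-Eq-HasZero γ x)

  size-⊕ρ : ∀ (v : Vec ℤ n) → size (v ⊕ ρ n) ≡ sum v
  size-⊕ρ v = trans (cong (ℤ._- sum (ρ n)) (sum-⊕ v (ρ n))) (IntSolver.solve 2 (λ v p → v ⊞ p ⊟ p ⊜ v) refl (sum v) (sum (ρ n)))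

  size-nonneg : ∀ {v : Vec ℤ n} → IsPartition v → 0ℤ ℤ.≤ size (v ⊕ ρ n)
  size-nonneg {v} d = subst (0ℤ ℤ.≤_) (sym (size-⊕ρ v)) (sum-nonneg (proj₂ d))

  increasing-KL : ∀ l → l ℕ.≤ n → ∀ v → IsPartition v → increasing (alphabet n) (λ r v → KL l r (v ⊕ ρ n)) 0 v ≃ L l (v ⊕ ρ n)
  increasing-KL l l≤n v d = ≃-trans
    (increasing≃T (KL l) (λ r a → annihilateʳ (alt-AdjEq (prod Eq) a))
      (λ r z → annihilateʳ (alt-HasZero (prod Eq) z prod-Eq-HasZero))
      (λ r {β} a → ≃-trans (es-KL l r β) (annihilateʳ (D-AdjEq a))) 0 v d)
    (T-KL l l≤n (v ⊕ ρ n) (StrictPos-⊕ρ v d) (size-nonneg d))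

  increasing-K : ∀ l β v → IsPartition v → increasing (alphabet n) (λ r v → K l (v ⊕ ρ n) β r) 0 v ≃ ℓ l (v ⊕ ρ n) β
  increasing-K l β v d = ≃-trans
    (increasing≃T (λ r α → K l α β r) (λ r a → annihilateʳ (ℓ-history-AdjEq l r β a))
      (λ r z → annihilateʳ (ℓ-history-HasZero l r β z))
      (λ r a → es-AdjEq -1ℤ (λ r α → K l α β r) (λ r a → annihilateʳ (ℓ-history-AdjEq l r β a))
         (λ r {γ} {γ′} x → ≃-trans (*-congˡ (ℓ-history-Swap l r β x)) (solve 2 (λ p h → p :* :- h := :- (p :* h)) ≃-refl (qp (l ℕ.∸ r)) (ℓ-history l r γ′ β))) r a)
      0 v d)
    (ℓ-T l (v ⊕ ρ n) β)

  ℓ-closed : ∀ l m → m ℕ.≤ l → m ℕ.≤ n → ∀ v → IsPartition v → ℓ m (v ⊕ ρ n) (ρ n) ≃ L m (v ⊕ ρ n)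
  ℓ-closed l zero _ _ v d with (v ⊕ ρ n) ≟ʷ ρ n
  ... | yes e = ≃-trans (≃-reflexive (cong (λ β → G β (ρ n)) e)) (≃-trans (G-refl (subst StrictPos e (StrictPos-⊕ρ v d)))
          (≃-sym (≃-trans (*-cong (≃-reflexive (cong C′z (trans (cong (λ β → 0ℤ ℤ.- size β) e) (cong (λ z → 0ℤ ℤ.- z) (ℤ.+-inverseʳ (sum (ρ n)))))))
             (≃-trans (≃-reflexive (cong D e)) (D-ρ n))) (*-identityˡ _))))
  ... | no ¬e = ≃-trans (G-≢ (StrictPos-⊕ρ v d) (StrictPos-ρ′ n) ¬e) (≃-sym (annihilateˡ (vanish (size (v ⊕ ρ n)) refl)))
    where
    StrictPos-ρ′ : ∀ n → StrictPos (ρ n)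
    StrictPos-ρ′ zero    = []
    StrictPos-ρ′ (suc n) = cons (ℤ.+<+ (s≤s z≤n)) (All.map (λ p → ℤ.≤-<-trans p (ℤ.+<+ ℕ.≤-refl)) (ρ≤ n)) (StrictPos-ρ′ n)
    vanish : ∀ s → size (v ⊕ ρ n) ≡ s → C′z (0ℤ ℤ.- size (v ⊕ ρ n)) ≃ 0#
    vanish (+ suc s) e = ≃-reflexive (cong (λ x → C′z (0ℤ ℤ.- x)) e)
    vanish -[1+ s ]  e = ⊥-elim (ℤ.<⇒≱ ℤ.-<+ (subst (0ℤ ℤ.≤_) e (size-nonneg d)))
    vanish (+ zero)  e = ⊥-elim (¬e (zero-sum (Trailing-StrictPos n (StrictPos-⊕ρ v d)
      (trans (cong (ℤ._+ + n) (trans (IntSolver.solve 2 (λ β p → β ⊜ β ⊟ p ⊞ p) refl (sum (v ⊕ ρ n)) (sum (ρ n))) (cong (ℤ._+ sum (ρ n)) e)))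
        (IntSolver.solve 2 (λ p n → IntSolver.con 0ℤ ⊞ p ⊞ n ⊜ n ⊞ p) refl (sum (ρ n)) (+ n))))))
      where
      zero-sum : ∀ {m} {β : Vec ℤ m} → Trailing m β → β ≡ ρ m
      zero-sum base    = refl
      zero-sum (_ ∷ x) = ⊥-elim (ℕ.<-irrefl refl (Trailing-≤ x))
  ℓ-closed (suc l) (suc m) (s≤s m≤l) m<n v d = cancel (begin
      (1# - qp (suc m)) * ℓ (suc m) β (ρ n)
        ≈⟨ solve 2 (λ p x → (con 1ℤ :- p) :* x := x :- p :* x) ≃-refl (qp (suc m)) (ℓ (suc m) β (ρ n)) ⟩
      ℓ (suc m) β (ρ n) - F 0 v
        ≈⟨ +-congʳ (≃-sym (increasing-K (suc m) (ρ n) v d)) ⟩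
      increasing (alphabet n) F 0 v - F 0 v
        ≈⟨ increasing-rest-cong (alphabet n) rest v d ⟩
      increasing (alphabet n) F′ 0 v - F′ 0 v
        ≈⟨ +-cong (increasing-KL (suc m) m<n v d) (-‿cong (KL-L (suc m) 0 β (size-nonneg d) z≤n)) ⟩
      L (suc m) β - qp (suc m) * L (suc m) β
        ≈⟨ solve 2 (λ p x → x :- p :* x := (con 1ℤ :- p) :* x) ≃-refl (qp (suc m)) (L (suc m) β) ⟩
      (1# - qp (suc m)) * L (suc m) β ∎)
    where
    β = v ⊕ ρ n
    F F′ : Family n
    F  r v = K (suc m) (v ⊕ ρ n) (ρ n) r
    F′ r v = KL (suc m) r (v ⊕ ρ n)
    cancel : ∀ {x y} → (1# - qp (suc m)) * x ≃ (1# - qp (suc m)) * y → x ≃ y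
    cancel {x} {y} p = ≃-trans (rescale x) (≃-trans (*-congˡ p) (≃-sym (rescale y)))
      where
      rescale : ∀ x → x ≃ recip m * ((1# - qp (suc m)) * x)
      rescale x = ≃-sym (≃-trans (solve 3 (λ i p x → i :* (p :* x) := p :* i :* x) ≃-refl (recip m) (1# - qp (suc m)) x)
        (≃-trans (*-congʳ (recip-inverse m)) (*-identityˡ x)))
    rest : ∀ r v → IsPartition v → F (suc r) v ≃ F′ (suc r) v
    rest r v d with r ℕ.≤? m
    ... | yes r≤m = ≃-trans (*-congˡ (≃-trans (≃-reflexive (cong (λ f → f (v ⊕ ρ n) (ρ n)) (hist-≤ G (λ _ _ → 0#) ℓ-step m r r≤m)))
                       (ℓ-closed l (m ℕ.∸ r) (ℕ.≤-trans (ℕ.m∸n≤m m r) m≤l) (ℕ.≤-trans (ℕ.m∸n≤m m r) (ℕ.<⇒≤ m<n)) v d)))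
                      (≃-sym (KL-L (suc m) (suc r) (v ⊕ ρ n) (size-nonneg d) (s≤s r≤m)))
    ... | no r≰m  = ≃-trans (annihilateʳ (ℓ-history-> m r (v ⊕ ρ n) (ρ n) (ℕ.≰⇒> r≰m)))
                      (≃-sym (KL-> (suc m) (suc r) (v ⊕ ρ n) (size-nonneg d) (s≤s (ℕ.≰⇒> r≰m))))

-- Sums over words weighted by energy

sumL : {A : Set} → List A → (A → PS) → PS
sumL []       f = 0#
sumL (x ∷ xs) f = f x + sumL xs f

module _ {A : Set} where

  sumL-cong : ∀ (xs : List A) {f g : A → PS} → (∀ x → f x ≃ g x) → sumL xs f ≃ sumL xs g
  sumL-cong []       p = ≃-refl
  sumL-cong (x ∷ xs) p = +-cong (p x) (sumL-cong xs p)

  sumL-cong-All : ∀ {xs : List A} {f g : A → PS} → ListAll.All (λ x → f x ≃ g x) xs → sumL xs f ≃ sumL xs g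
  sumL-cong-All ListAll.[]       = ≃-refl
  sumL-cong-All (p ListAll.∷ ps) = +-cong p (sumL-cong-All ps)

  sumL-++ : ∀ (xs ys : List A) f → sumL (xs ++ ys) f ≃ sumL xs f + sumL ys f
  sumL-++ []       ys f = ≃-sym (+-identityˡ _)
  sumL-++ (x ∷ xs) ys f = ≃-trans (+-congˡ (sumL-++ xs ys f)) (≃-sym (+-assoc _ _ _))

  sumL-* : ∀ (xs : List A) c f → sumL xs (λ x → c * f x) ≃ c * sumL xs f
  sumL-* []       c f = ≃-sym (zeroʳ c)
  sumL-* (x ∷ xs) c f = ≃-trans (+-congˡ (sumL-* xs c f)) (≃-sym (distribˡ c _ _))

  sumL-map : ∀ {B : Set} (g : B → A) xs f → sumL (List.map g xs) f ≡ sumL xs (λ x → f (g x))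
  sumL-map g []       f = refl
  sumL-map g (x ∷ xs) f = cong (λ y → f (g x) + y) (sumL-map g xs f)

  sumL-cartesian : ∀ {B C : Set} (g : B → C → A) xs ys f →
    sumL (List.cartesianProductWith g xs ys) f ≃ sumL xs (λ x → sumL ys (λ y → f (g x y)))
  sumL-cartesian g []       ys f = ≃-refl
  sumL-cartesian g (x ∷ xs) ys f = ≃-trans (sumL-++ (List.map (g x) ys) _ f)
    (+-cong (≃-reflexive (sumL-map (g x) ys f)) (sumL-cartesian g xs ys f))

Before : Letter n → Letter n → Set
Before x y = x ≤ᶜ y × ¬ (y ≤ᶜ x)

alphabet-sorted : ∀ n → AllPairs Before (alphabet n)
alphabet-sorted n = AllPairs.++⁺
  (AllPairs.map⁺ (AllPairs.map (λ l → u≤u (ℕ.<⇒≤ l) , λ { (u≤u m) → ℕ.<⇒≱ l m }) (allFin-sorted n)))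
  (AllPairs.map⁺ (AllPairs.map (λ l → b≤b (ℕ.<⇒≤ l) , λ { (b≤b m) → ℕ.<⇒≱ l m }) (reverse-sorted (allFin-sorted n))))
  (ListAll.map⁺ (ListAll.universal (λ i → ListAll.map⁺ (ListAll.universal (λ j → u≤b , λ ()) (List.reverse (List.allFin n)))) (List.allFin n)))

AllPairs-split : ∀ {A : Set} {R : A → A → Set} pre {x suf} → AllPairs R (pre ++ x ∷ suf) →
                 ListAll.All (λ y → R y x) pre × ListAll.All (R x) suf
AllPairs-split []        (p ∷ _)  = ListAll.[] , p
AllPairs-split (y ∷ pre) (p ∷ ps) with AllPairs-split pre ps
... | r , s = ListAll.head (ListAll.++⁻ʳ pre p) ListAll.∷ r , s

H-descent : ∀ {x y : Letter n} → y ≤ᶜ x → H x y ≡ 1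
H-descent {x = x} {y} p = cong (λ b → if b then 1 else 0) (dec-true (y ≤ᶜ? x) p)

H-ascent : ∀ {x y : Letter n} → ¬ (y ≤ᶜ x) → H x y ≡ 0
H-ascent {x = x} {y} p = cong (λ b → if b then 1 else 0) (dec-false (y ≤ᶜ? x) p)

≤ᶜ-refl : ∀ (x : Letter n) → x ≤ᶜ x
≤ᶜ-refl (unbarred i) = u≤u ℕ.≤-refl
≤ᶜ-refl (barred i)   = b≤b ℕ.≤-refl

module Walks {n : ℕ} (κ : Vec ℤ n) (κ-partition : IsPartition κ) where

  valid : ∀ {l} → Vec ℤ n → Vec (Letter n) l → PS
  valid v []      = when (v ≟ʷ κ) 1#
  valid v (x ∷ w) = guard (v ⊕ wt x) (valid (v ⊕ wt x) w)

  walks : ℕ → Vec ℤ n → PS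
  walks l v = sumL (words (alphabet n) l) λ w → valid v w * qp (energy w)

  -- The letter x has just been read and is already included in v; it is remembered for the sake of
  -- a descent to the next letter.
  walksAfter : ℕ → Letter n → Vec ℤ n → PS
  walksAfter l x v = sumL (words (alphabet n) l) λ w → valid v w * qp (energy (x ∷ w))

  private
    guard-* : ∀ (v : Vec ℤ n) x y → guard v x * y ≃ guard v (x * y)
    guard-* v x y with isPartition? v
    ... | yes _ = ≃-refl
    ... | no _  = zeroˡ y

    *-guard : ∀ (v : Vec ℤ n) x y → x * guard v y ≃ guard v (x * y)
    *-guard v x y with isPartition? v
    ... | yes _ = ≃-refl
    ... | no _  = zeroʳ x

    sumL-guard : ∀ {A : Set} (xs : List A) (v : Vec ℤ n) f → sumL xs (λ x → guard v (f x)) ≃ guard v (sumL xs f)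
    sumL-guard xs v f with isPartition? v
    ... | yes _ = ≃-refl
    ... | no _  = ≃-trans (sumL-cong xs λ x → ≃-sym (zeroˡ 0#)) (≃-trans (sumL-* xs 0# (λ _ → 0#)) (zeroˡ _))

  next : List (Letter n) → (Letter n → PS) → Vec ℤ n → PS
  next ys f v = sumL ys λ y → guard (v ⊕ wt y) (f y)

  walks-suc : ∀ l v → walks (suc l) v ≃ next (alphabet n) (λ y → walksAfter l y (v ⊕ wt y)) v
  walks-suc l v = ≃-trans (sumL-cartesian _∷_ (alphabet n) (words (alphabet n) l) _)
    (sumL-cong (alphabet n) λ y → ≃-trans (sumL-cong (words (alphabet n) l) λ w → guard-* (v ⊕ wt y) (valid (v ⊕ wt y) w) _)
      (sumL-guard (words (alphabet n) l) (v ⊕ wt y) _))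

  walksAfter-suc : ∀ l x v → walksAfter (suc l) x v ≃
    next (alphabet n) (λ y → qp (suc l ℕ.* H x y) * walksAfter l y (v ⊕ wt y)) v
  walksAfter-suc l x v = ≃-trans (sumL-cartesian _∷_ (alphabet n) (words (alphabet n) l) _)
    (sumL-cong (alphabet n) λ y → ≃-trans (sumL-cong (words (alphabet n) l) λ w → ≃-trans (guard-* (v ⊕ wt y) (valid (v ⊕ wt y) w) _)
         (guard-cong (v ⊕ wt y) λ _ → ≃-trans (*-congˡ (pow-+ q (suc l ℕ.* H x y) (energy (y ∷ w))))
           (x∙yz≈y∙xz (valid (v ⊕ wt y) w) (qp (suc l ℕ.* H x y)) (qp (energy (y ∷ w))))))
      (≃-trans (sumL-guard (words (alphabet n) l) (v ⊕ wt y) _) (guard-cong (v ⊕ wt y) λ _ → sumL-* (words (alphabet n) l) _ _)))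

  F : ℕ → Family n
  F l r v = K l (v ⊕ ρ n) (κ ⊕ ρ n) r

  private
    ℓκ : ℕ → Vec ℤ n → PS
    ℓκ l v = ℓ l (v ⊕ ρ n) (κ ⊕ ρ n)

    P = pochhammer

    increasing-zero : ∀ ys v → increasing ys (F 0) 0 v ≃ F 0 0 v
    increasing-zero []       v = ≃-refl
    increasing-zero (y ∷ ys) v = ≃-trans (+-cong (increasing-zero ys v) (≃-trans
      (guard-cong (v ⊕ wt y) λ _ → vanish ys 0 (v ⊕ wt y)) (guard-0 (v ⊕ wt y)))) (+-identityʳ _)
      where
      guard-0 : ∀ (v : Vec ℤ n) → guard v 0# ≃ 0#
      guard-0 v with isPartition? v
      ... | yes _ = ≃-refl
      ... | no _  = ≃-refl
      vanish : ∀ ys r v → increasing ys (F 0) (suc r) v ≃ 0#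
      vanish []       r v = zeroʳ _
      vanish (y ∷ ys) r v = ≃-trans (+-cong (vanish ys r v) (≃-trans (guard-cong (v ⊕ wt y) λ _ → vanish ys (suc r) (v ⊕ wt y)) (guard-0 (v ⊕ wt y)))) (+-identityˡ 0#)

    base-case : ∀ v → IsPartition v → when (v ≟ʷ κ) 1# ≃ ℓκ 0 v
    base-case v d = when-cases (v ≟ʷ κ)
      (λ { refl → ≃-sym (G-refl (StrictPos-⊕ρ v d)) })
      (λ v≢κ → G-≢ (StrictPos-⊕ρ v d) (StrictPos-⊕ρ κ κ-partition) (v≢κ ∘ ⊕ρ-injective v κ (ρ n)))

    walks-zero : ∀ v → IsPartition v → (valid v [] * qp 0) + 0# ≃ ℓκ 0 v
    walks-zero v d = ≃-trans (+-identityʳ _) (≃-trans (*-identityʳ _) (base-case v d))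

    -- The P-partition argument: give the letters levels that increase weakly along the word, and
    -- strictly where the next letter is not larger. The sum of q^level over all choices is q^energy
    -- / ((1-q)⋯(1-q^l)). The letters of one level form an increasing run; after x, the run of level
    -- 0 can use only `suf`, and `F l` stands for the higher levels.
    Claim : ℕ → Set
    Claim l = ∀ pre x suf → alphabet n ≡ pre ++ x ∷ suf → ∀ v → IsPartition v →
              walksAfter l x v ≃ P l * increasing suf (F l) 0 v

    -- Non-empty runs in `ys`, sorted by their first letter; the subtracted term is the empty run.
    -- By definition `F (suc l) (suc r)` is `F l r`, so the claim for l applies after that letter.
    next-suffix : ∀ l → Claim l → ∀ pre ys → alphabet n ≡ pre ++ ys → ∀ v →
      next ys (λ y → walksAfter l y (v ⊕ wt y)) v ≃ P l * (increasing ys (F (suc l)) 0 v - F (suc l) 0 v)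
    next-suffix l c pre []       e v = ≃-sym (annihilateʳ (-‿inverseʳ _))
    next-suffix l c pre (y ∷ ys) e v = ≃-trans
      (+-cong (≃-trans (guard-cong (v ⊕ wt y) λ d → ≃-trans (c pre y ys e (v ⊕ wt y) d)
                 (*-congˡ (≃-reflexive (sym (increasing-suc ys (F (suc l)) 0 (v ⊕ wt y))))))
               (≃-sym (*-guard (v ⊕ wt y) (P l) (increasing ys (F (suc l)) 1 (v ⊕ wt y)))))
        (next-suffix l c (pre ∷ʳ y) ys (trans e (sym (List.++-assoc pre (y ∷ []) ys))) v))
      (solve 4 (λ p a b c → p :* a :+ p :* (b :- c) := p :* (b :+ a :- c)) ≃-refl (P l)
        (guard (v ⊕ wt y) (increasing ys (F (suc l)) 1 (v ⊕ wt y))) (increasing ys (F (suc l)) 0 v) (F (suc l) 0 v))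

    walks-step : ∀ l → Claim l → ∀ v → IsPartition v → walks (suc l) v ≃ P (suc l) * ℓκ (suc l) v
    walks-step l c v d = begin
      walks (suc l) v
        ≈⟨ ≃-trans (walks-suc l v) (next-suffix l c [] (alphabet n) refl v) ⟩
      P l * (increasing (alphabet n) (F (suc l)) 0 v - F (suc l) 0 v)
        ≈⟨ *-congˡ (+-congʳ (increasing-K (suc l) (κ ⊕ ρ n) v d)) ⟩
      P l * (ℓκ (suc l) v - qp (suc l) * ℓκ (suc l) v)
        ≈⟨ solve 3 (λ p q x → p :* (x :- q :* x) := p :* (con 1ℤ :- q) :* x) ≃-refl (P l) (qp (suc l)) (ℓκ (suc l) v) ⟩
      P (suc l) * ℓκ (suc l) v ∎

    claim : ∀ l → Claim l
    claim zero pre x suf e v d = ≃-trans (walks-zero v d) (≃-sym (≃-trans (*-identityˡ _) (≃-trans (increasing-zero suf v) (*-identityˡ _))))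
    claim (suc l) pre x suf e v d = begin
      walksAfter (suc l) x v
        ≈⟨ walksAfter-suc l x v ⟩
      next (alphabet n) weighted v
        ≈⟨ ≃-trans (≃-reflexive (cong (λ ys → next ys weighted v) e)) (sumL-++ pre (x ∷ suf) _) ⟩
      next pre weighted v + (guard (v ⊕ wt x) (weighted x) + next suf weighted v)
        ≈⟨ +-cong (≃-trans (descents pre (ListAll.map (H-descent ∘ proj₁) (proj₁ order))) (sumL-* pre Q _))
             (+-cong (descent x (H-descent (≤ᶜ-refl x))) (ascents suf (ListAll.map (H-ascent ∘ proj₂) (proj₂ order)))) ⟩
      Q * next pre after v + (Q * guard (v ⊕ wt x) (after x) + next suf after v)
        -- Letters up to and including x are descents and cost Q. Giving the factor Q to the larger
        -- letters as well completes the sum to the whole alphabet, which is `walks (suc l)`; the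
        -- excess is corrected by 1 - Q.
        ≈⟨ solve 4 (λ q a b c → q :* a :+ (q :* b :+ c) := q :* (a :+ (b :+ c)) :+ (con 1ℤ :- q) :* c) ≃-refl Q (next pre after v) (guard (v ⊕ wt x) (after x)) (next suf after v) ⟩
      Q * (next pre after v + (guard (v ⊕ wt x) (after x) + next suf after v)) + (1# - Q) * next suf after v
        ≈⟨ +-cong (*-congˡ (≃-trans (≃-sym (sumL-++ pre (x ∷ suf) _)) (≃-trans (≃-reflexive (cong (λ ys → next ys after v) (sym e)))
                (≃-trans (≃-sym (walks-suc l v)) (walks-step l (claim l) v d)))))
             (*-congˡ (next-suffix l (claim l) (pre ∷ʳ x) suf (trans e (sym (List.++-assoc pre (x ∷ []) suf))) v)) ⟩
      Q * (P l * (1# - Q) * ℓκ (suc l) v) + (1# - Q) * (P l * (increasing suf (F (suc l)) 0 v - Q * ℓκ (suc l) v))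
        ≈⟨ solve 4 (λ q p x y → q :* (p :* (con 1ℤ :- q) :* x) :+ (con 1ℤ :- q) :* (p :* (y :- q :* x)) := p :* (con 1ℤ :- q) :* y) ≃-refl
             Q (P l) (ℓκ (suc l) v) (increasing suf (F (suc l)) 0 v) ⟩
      P (suc l) * increasing suf (F (suc l)) 0 v ∎
      where
      Q = qp (suc l)
      after weighted : Letter n → PS
      after y = walksAfter l y (v ⊕ wt y)
      weighted y = qp (suc l ℕ.* H x y) * after y
      order = AllPairs-split pre (subst (AllPairs Before) e (alphabet-sorted n))
      descent : ∀ y → H x y ≡ 1 → guard (v ⊕ wt y) (weighted y) ≃ Q * guard (v ⊕ wt y) (after y)
      descent y h = ≃-trans (guard-cong (v ⊕ wt y) λ _ → *-congʳ (≃-reflexive (cong qp (trans (cong (suc l ℕ.*_) h) (ℕ.*-identityʳ (suc l))))))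
        (≃-sym (*-guard (v ⊕ wt y) Q (after y)))
      descents : ∀ ys → ListAll.All (λ y → H x y ≡ 1) ys → next ys weighted v ≃ sumL ys (λ y → Q * guard (v ⊕ wt y) (after y))
      descents ys hs = sumL-cong-All (ListAll.map (λ {y} h → descent y h) hs)
      ascents : ∀ ys → ListAll.All (λ y → H x y ≡ 0) ys → next ys weighted v ≃ next ys after v
      ascents ys hs = sumL-cong-All (ListAll.map (λ {y} h → guard-cong (v ⊕ wt y) λ _ →
        ≃-trans (*-congʳ (≃-reflexive (cong qp (trans (cong (suc l ℕ.*_) h) (ℕ.*-zeroʳ (suc l)))))) (*-identityˡ _)) hs)

  walks-ℓ : ∀ l v → IsPartition v → walks l v ≃ P l * ℓκ l v
  walks-ℓ zero    v d = ≃-trans (walks-zero v d) (≃-sym (*-identityˡ _))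
  walks-ℓ (suc l) v d = walks-step l (claim l) v d

open import Data.Fin.Permutation as Perm using (Permutation′; _⟨$⟩ʳ_; _⟨$⟩ˡ_)
open import Defs

-- Signs of permutations

ΣF : ∀ n → (Fin n → ℕ) → ℕ
ΣF zero    f = 0
ΣF (suc n) f = f zero ℕ.+ ΣF n (f ∘ suc)

ΣF-cong : ∀ n {f g : Fin n → ℕ} → (∀ i → f i ≡ g i) → ΣF n f ≡ ΣF n g
ΣF-cong zero    p = refl
ΣF-cong (suc n) p = cong₂ ℕ._+_ (p zero) (ΣF-cong n (p ∘ suc))

ΣF-zero : ∀ n {f : Fin n → ℕ} → (∀ i → f i ≡ 0) → ΣF n f ≡ 0
ΣF-zero zero    p = refl
ΣF-zero (suc n) p = cong₂ ℕ._+_ (p zero) (ΣF-zero n (p ∘ suc))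

ΣF-+ : ∀ n (f g : Fin n → ℕ) → ΣF n (λ i → f i ℕ.+ g i) ≡ ΣF n f ℕ.+ ΣF n g
ΣF-+ zero    f g = refl
ΣF-+ (suc n) f g = trans (cong (f zero ℕ.+ g zero ℕ.+_) (ΣF-+ n (f ∘ suc) (g ∘ suc)))
  (exchange (f zero) (g zero) (ΣF n (f ∘ suc)) (ΣF n (g ∘ suc)))
  where
  exchange : ∀ a b c d → a ℕ.+ b ℕ.+ (c ℕ.+ d) ≡ a ℕ.+ c ℕ.+ (b ℕ.+ d)
  exchange a b c d = trans (ℕ.+-assoc a b (c ℕ.+ d)) (trans (cong (a ℕ.+_)
    (trans (sym (ℕ.+-assoc b c d)) (trans (cong (ℕ._+ d) (ℕ.+-comm b c)) (ℕ.+-assoc c b d)))) (sym (ℕ.+-assoc a c (b ℕ.+ d))))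

ΣF-punchIn : ∀ {n} (i : Fin (suc n)) f → ΣF (suc n) f ≡ f i ℕ.+ ΣF n (f ∘ Fin.punchIn i)
ΣF-punchIn zero f = refl
ΣF-punchIn {suc n} (suc i) f = trans (cong (f zero ℕ.+_) (ΣF-punchIn i (f ∘ suc)))
  (trans (sym (ℕ.+-assoc (f zero) (f (suc i)) _)) (trans (cong (ℕ._+ ΣF n (f ∘ suc ∘ Fin.punchIn i)) (ℕ.+-comm (f zero) (f (suc i)))) (ℕ.+-assoc (f (suc i)) (f zero) _)))

bit : Bool → ℕ
bit b = if b then 1 else 0

length-filter : ∀ {A : Set} {P : Pred A 0ℓ} (P? : Decidable P) xs ys →
  List.length (List.filter P? (xs ++ ys)) ≡ List.length (List.filter P? xs) ℕ.+ List.length (List.filter P? ys)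
length-filter P? xs ys = trans (cong List.length (List.filter-++ P? xs ys)) (List.length-++ (List.filter P? xs))

length-filter-tabulate : ∀ {A B : Set} {P : Pred B 0ℓ} (P? : Decidable P) n (g : A → B) (f : Fin n → A) →
  List.length (List.filter P? (List.map g (List.tabulate f))) ≡ ΣF n (λ j → bit (does (P? (g (f j)))))
length-filter-tabulate P? zero    g f = refl
length-filter-tabulate P? (suc n) g f with does (P? (g (f zero)))
... | true  = cong suc (length-filter-tabulate P? n g (f ∘ suc))
... | false = length-filter-tabulate P? n g (f ∘ suc)

length-filter-product : ∀ {A B : Set} {P : Pred (A × B) 0ℓ} (P? : Decidable P) m n (f : Fin m → A) (g : Fin n → B) →
  List.length (List.filter P? (List.cartesianProduct (List.tabulate f) (List.tabulate g))) ≡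
  ΣF m (λ i → ΣF n (λ j → bit (does (P? (f i , g j)))))
length-filter-product P? zero    n f g = refl
length-filter-product P? (suc m) n f g = trans (length-filter P? (List.map (f zero ,_) (List.tabulate g)) _)
  (cong₂ ℕ._+_ (length-filter-tabulate P? n (f zero ,_) g) (length-filter-product P? m n (f ∘ suc) g))

inverted : (Fin n → Fin n) → Fin n → Fin n → ℕ
inverted σ i j = bit (does (i Fin.<? j) ∧ does (σ j Fin.<? σ i))

inversions-ΣF : ∀ (σ : Permutation′ n) → inversions σ ≡ ΣF n (λ i → ΣF n (inverted (σ ⟨$⟩ʳ_) i))
inversions-ΣF {n} σ = length-filter-product _ n n (λ i → i) (λ j → j)

private
  punchIn-<ᵇ : ∀ (i : Fin (suc n)) a b → (toℕ (Fin.punchIn i a) ℕ.<ᵇ toℕ (Fin.punchIn i b)) ≡ (toℕ a ℕ.<ᵇ toℕ b)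
  punchIn-<ᵇ zero    a       b       = refl
  punchIn-<ᵇ (suc i) zero    zero    = refl
  punchIn-<ᵇ (suc i) zero    (suc b) = refl
  punchIn-<ᵇ (suc i) (suc a) zero    = refl
  punchIn-<ᵇ (suc i) (suc a) (suc b) = punchIn-<ᵇ i a b

  ΣF-below : ∀ (i : Fin (suc n)) → ΣF n (λ a → bit (toℕ (Fin.punchIn i a) ℕ.<ᵇ toℕ i)) ≡ toℕ i
  ΣF-below {n} zero = ΣF-zero n λ _ → refl
  ΣF-below {suc n} (suc i) = cong suc (ΣF-below i)

  insert-zero : ∀ (i : Fin (suc n)) (π : Permutation′ n) → Perm.insert i zero π ⟨$⟩ʳ i ≡ zero
  insert-zero i π with i Fin.≟ i
  ... | yes _   = refl
  ... | no i≢i  = contradiction refl i≢i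

  ∧-zero : ∀ b → bit (b ∧ false) ≡ 0
  ∧-zero false = refl
  ∧-zero true  = refl

  ∧-one : ∀ b → bit (b ∧ true) ≡ bit b
  ∧-one false = refl
  ∧-one true  = refl

-- Position i receives the smallest value: it forms no inversion with later positions and one with
-- each of the i earlier ones. The other pairs keep their order under `punchIn`.
inversions-insert : ∀ (i : Fin (suc n)) (π : Permutation′ n) →
  inversions (Perm.insert i zero π) ≡ toℕ i ℕ.+ inversions π
inversions-insert {n} i π = trans (inversions-ΣF (Perm.insert i zero π)) (trans
  (ΣF-punchIn i (λ a → ΣF (suc n) (χ a)))
  (trans (cong₂ ℕ._+_ (ΣF-zero (suc n) top)
    (trans (ΣF-cong n λ a → trans (ΣF-punchIn i (χ (p a))) (cong₂ ℕ._+_ (left a) (ΣF-cong n (rest a))))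
           (ΣF-+ n _ _)))
    (cong₂ ℕ._+_ (ΣF-below i) (sym (inversions-ΣF π)))))
  where
  σ = Perm.insert i zero π ⟨$⟩ʳ_
  χ = inverted σ
  p = Fin.punchIn i
  top : ∀ b → χ i b ≡ 0
  top b = trans (cong (λ z → bit (does (i Fin.<? b) ∧ does (σ b Fin.<? z))) (insert-zero i π)) (∧-zero (does (i Fin.<? b)))
  left : ∀ a → χ (p a) i ≡ bit (toℕ (p a) ℕ.<ᵇ toℕ i)
  left a = trans (cong₂ (λ y z → bit (does (p a Fin.<? i) ∧ does (y Fin.<? z))) (insert-zero i π) (Perm.insert-punchIn i zero π a))
    (∧-one (does (p a Fin.<? i)))
  rest : ∀ a b → χ (p a) (p b) ≡ inverted (π ⟨$⟩ʳ_) a b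
  rest a b = trans (cong₂ (λ y z → bit (does (p a Fin.<? p b) ∧ does (y Fin.<? z))) (Perm.insert-punchIn i zero π b) (Perm.insert-punchIn i zero π a))
    (cong (λ x → bit (x ∧ does ((π ⟨$⟩ʳ b) Fin.<? (π ⟨$⟩ʳ a)))) (punchIn-<ᵇ i a b))

lookup-removeAt : ∀ (β : Vec ℤ (suc n)) i k → Vec.lookup β (Fin.punchIn i k) ≡ Vec.lookup (Vec.removeAt β i) k
lookup-removeAt (b ∷ β)       zero    k       = refl
lookup-removeAt (b ∷ c ∷ β) (suc i) zero    = refl
lookup-removeAt (b ∷ c ∷ β) (suc i) (suc k) = lookup-removeAt (c ∷ β) i k

insert-▷ : ∀ (i : Fin (suc n)) (π : Permutation′ n) β →
  Perm.insert i zero π ▷ β ≡ Vec.lookup β i ∷ (π ▷ Vec.removeAt β i)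
insert-▷ i π β = cong (Vec.lookup β i ∷_) (Vec.tabulate-cong λ k → lookup-removeAt β i (π ⟨$⟩ˡ k))

pick-positions : ∀ (β : Vec ℤ (suc n)) k →
  sumL (List.allFin (suc n)) (λ i → sgn (toℕ i) * k (Vec.lookup β i) (Vec.removeAt β i)) ≃ pick β k
pick-positions {zero}  (b ∷ []) k = ≃-trans (+-identityʳ _) (*-identityˡ _)
pick-positions {suc n} (b ∷ c ∷ β) k = +-cong (*-identityˡ _) (begin
  sumL (List.tabulate suc) (λ i → sgn (toℕ i) * k (Vec.lookup (b ∷ c ∷ β) i) (Vec.removeAt (b ∷ c ∷ β) i))
    ≈⟨ ≃-reflexive (trans (cong (λ l → sumL l (λ i → sgn (toℕ i) * k (Vec.lookup (b ∷ c ∷ β) i) (Vec.removeAt (b ∷ c ∷ β) i))) (sym (List.map-tabulate {n = suc n} (λ i → i) suc)))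
         (sumL-map suc (List.allFin (suc n)) _)) ⟩
  sumL (List.allFin (suc n)) (λ i → sgn (suc (toℕ i)) * k (Vec.lookup (c ∷ β) i) (b ∷ Vec.removeAt (c ∷ β) i))
    ≈⟨ sumL-cong (List.allFin (suc n)) (λ i → *-assoc (- 1#) (sgn (toℕ i)) _) ⟩
  sumL (List.allFin (suc n)) (λ i → - 1# * (sgn (toℕ i) * k (Vec.lookup (c ∷ β) i) (b ∷ Vec.removeAt (c ∷ β) i)))
    ≈⟨ sumL-* (List.allFin (suc n)) (- 1#) _ ⟩
  - 1# * sumL (List.allFin (suc n)) (λ i → sgn (toℕ i) * k (Vec.lookup (c ∷ β) i) (b ∷ Vec.removeAt (c ∷ β) i))
    ≈⟨ *-congˡ (pick-positions (c ∷ β) (λ d γ → k d (b ∷ γ))) ⟩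
  - 1# * pick (c ∷ β) (λ d γ → k d (b ∷ γ))
    ≈⟨ solve 1 (λ x → :- con 1ℤ :* x := :- x) ≃-refl _ ⟩
  - pick (c ∷ β) (λ d γ → k d (b ∷ γ)) ∎)

alt-permutations : ∀ (β : Vec ℤ n) Φ → sumL (permutations n) (λ σ → sgn (inversions σ) * Φ (σ ▷ β)) ≃ alt β Φ
alt-permutations {zero}  [] Φ = ≃-trans (+-identityʳ _) (*-identityˡ _)
alt-permutations {suc n} β Φ = begin
  sumL (permutations (suc n)) (λ σ → sgn (inversions σ) * Φ (σ ▷ β))
    ≈⟨ sumL-cartesian (λ i π → Perm.insert i zero π) (List.allFin (suc n)) (permutations n) (λ σ → sgn (inversions σ) * Φ (σ ▷ β)) ⟩
  sumL (List.allFin (suc n)) (λ i → sumL (permutations n) (λ π → sgn (inversions (Perm.insert i zero π)) * Φ (Perm.insert i zero π ▷ β)))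
    ≈⟨ sumL-cong (List.allFin (suc n)) (λ i → ≃-trans (sumL-cong (permutations n) λ π → ≃-trans
         (*-cong (≃-trans (≃-reflexive (cong sgn (inversions-insert i π))) (pow-+ (- 1#) (toℕ i) (inversions π))) (≃-reflexive (cong Φ (insert-▷ i π β))))
         (*-assoc _ _ _)) (sumL-* (permutations n) (sgn (toℕ i)) _)) ⟩
  sumL (List.allFin (suc n)) (λ i → sgn (toℕ i) * sumL (permutations n) (λ π → sgn (inversions π) * Φ (Vec.lookup β i ∷ (π ▷ Vec.removeAt β i))))
    ≈⟨ sumL-cong (List.allFin (suc n)) (λ i → *-congˡ (alt-permutations (Vec.removeAt β i) (λ γ → Φ (Vec.lookup β i ∷ γ)))) ⟩
  sumL (List.allFin (suc n)) (λ i → sgn (toℕ i) * alt (Vec.removeAt β i) (λ γ → Φ (Vec.lookup β i ∷ γ)))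
    ≈⟨ pick-positions β (λ c γ → alt γ (λ δ → Φ (c ∷ δ))) ⟩
  alt β Φ ∎

-- Coefficients of U and X, and their comparison

sgn-coeff : ∀ k f d → (sgn k * f) d ≡ (-1ℤ ℤ.^ k) ℤ.* f d
sgn-coeff zero    f d = trans (≃⇒≡ (*-identityˡ f) d) (sym (ℤ.*-identityˡ (f d)))
sgn-coeff (suc k) f d = trans
  (≃⇒≡ (solve 2 (λ s f → :- con 1ℤ :* s :* f := :- (s :* f)) ≃-refl (sgn k) f) d)
  (trans (neg-coeff (sgn k * f) d) (trans (cong ℤ.-_ (sgn-coeff k f d))
    (trans (sym (ℤ.-1*i≡-i _)) (sym (ℤ.*-assoc -1ℤ (-1ℤ ℤ.^ k) (f d))))))

∑-sumL : ∀ {A : Set} (xs : List A) (f : A → Laurent) (g : A → PS) d → (∀ x → f x (+ d) ≡ g x d) → ∑ xs f (+ d) ≡ sumL xs g d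
∑-sumL []       f g d p = sym (const-zero d)
∑-sumL (x ∷ xs) f g d p = trans (cong₂ ℤ._+_ (p x) (∑-sumL xs f g d p)) (sym (add-coeff (g x) (sumL xs g) d))

∑-zero : ∀ {A : Set} (xs : List A) (f : A → Laurent) d → (∀ x → f x d ≡ 0ℤ) → ∑ xs f d ≡ 0ℤ
∑-zero []       f d p = refl
∑-zero (x ∷ xs) f d p = cong₂ ℤ._+_ (p x) (∑-zero xs f d p)

U-coeff : ∀ (κ : Vec ℤ n) d → U κ (𝟙 n) (+ d) ≡ Û (κ ⊕ ρ n) d
U-coeff {n} κ d = trans
  (∑-sumL (permutations n) (λ σ → (-1ℤ ℤ.^ inversions σ) · F (σ ▷ (κ ⊕ ρ n) ⊖ 𝟙 n ⊖ ρ n)) (λ σ → sgn (inversions σ) * at (generating n) (base-point (σ ▷ (κ ⊕ ρ n)))) d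
    λ σ → sym (sgn-coeff (inversions σ) (at (generating n) (base-point (σ ▷ (κ ⊕ ρ n)))) d))
  (≃⇒≡ (alt-permutations (κ ⊕ ρ n) (λ γ → at (generating n) (base-point γ))) d)

U-negative : ∀ (κ : Vec ℤ n) d → U κ (𝟙 n) -[1+ d ] ≡ 0ℤ
U-negative {n} κ d = ∑-zero (permutations n) (λ σ → (-1ℤ ℤ.^ inversions σ) · F (σ ▷ (κ ⊕ ρ n) ⊖ 𝟙 n ⊖ ρ n)) -[1+ d ] λ σ → ℤ.*-zeroʳ (-1ℤ ℤ.^ inversions σ)

qp-coeff : ∀ k d → (q^ (+ k)) (+ d) ≡ qp k d
qp-coeff zero    zero    = sym (const-head 1ℤ)
qp-coeff zero    (suc d) = sym (const-tail 1ℤ d)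
qp-coeff (suc k) zero    = sym (q*-zero (qp k))
qp-coeff (suc k) (suc d) = trans (𝟏[]-⇔ (+ suc k ℤ.≟ + suc d) (+ k ℤ.≟ + d)
    (cong (λ z → z ℤ.- 1ℤ)) (cong (ℤ._+_ 1ℤ)))
  (trans (qp-coeff k d) (sym (q*-suc (qp k) d)))

∑-filter : ∀ {A : Set} {P : Pred A 0ℓ} (P? : Decidable P) xs (f : A → Laurent) (g : A → PS) d →
  (∀ x → f x (+ d) ≡ g x d) → ∑ (List.filter P? xs) f (+ d) ≡ sumL xs (λ x → when (P? x) (g x)) d
∑-filter P? []       f g d p = sym (const-zero d)
∑-filter P? (x ∷ xs) f g d p with P? x
... | yes _ = trans (cong₂ ℤ._+_ (p x) (∑-filter P? xs f g d p)) (sym (add-coeff (g x) _ d))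
... | no  _ = trans (∑-filter P? xs f g d p) (sym (≃⇒≡ (+-identityˡ _) d))

when-⇔ : ∀ {P Q : Set} (d : Dec P) (d′ : Dec Q) → (P → Q) → (Q → P) → ∀ x → when d x ≃ when d′ x
when-⇔ (yes _) (yes _)  f g x = ≃-refl
when-⇔ (no _)  (no _)   f g x = ≃-refl
when-⇔ (yes p) (no ¬r)  f g x = contradiction (f p) ¬r
when-⇔ (no ¬p) (yes r)  f g x = contradiction (g r) ¬p

module _ (κ : Vec ℤ n) (κ-partition : IsPartition κ) where
  open Walks κ κ-partition

  when-valid : ∀ {l} v (w : Vec (Letter n) l) x →
    when (All.all? isPartition? (partialSums v w) ×-dec (Vec.last (v ∷ partialSums v w) ≟ʷ κ)) x ≃ valid v w * x
  when-valid v [] x = by-cases (v ≟ʷ κ)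
    where
    by-cases : (d : Dec (v ≡ κ)) → when (yes [] ×-dec d) x ≃ when d 1# * x
    by-cases (yes _) = ≃-sym (*-identityˡ x)
    by-cases (no _)  = ≃-sym (zeroˡ x)
  when-valid v (y ∷ w) x = by-cases (isPartition? (v ⊕ wt y))
    (All.all? isPartition? (partialSums (v ⊕ wt y) w)) (Vec.last (v ⊕ wt y ∷ partialSums (v ⊕ wt y) w) ≟ʷ κ)
    (when-valid (v ⊕ wt y) w x)
    where
    by-cases : (d : Dec (IsPartition (v ⊕ wt y))) (as : Dec (All IsPartition (partialSums (v ⊕ wt y) w))) (e : Dec (Vec.last (v ⊕ wt y ∷ partialSums (v ⊕ wt y) w) ≡ κ)) →
      when (as ×-dec e) x ≃ valid (v ⊕ wt y) w * x →
      when (All.all? isPartition? (v ⊕ wt y ∷ partialSums (v ⊕ wt y) w) ×-dec e) x ≃ when d (valid (v ⊕ wt y) w) * x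
    by-cases (yes p) as e h = ≃-trans (when-⇔ (All.all? isPartition? (v ⊕ wt y ∷ partialSums (v ⊕ wt y) w) ×-dec e) (as ×-dec e)
      (λ { (_ ∷ ps , r) → ps , r }) (λ { (ps , r) → p ∷ ps , r }) x) h
    by-cases (no ¬p) as e h = ≃-trans (when-⇔ (All.all? isPartition? (v ⊕ wt y ∷ partialSums (v ⊕ wt y) w) ×-dec e) (no ¬p)
      (λ { (p ∷ _ , _) → p }) (λ p → contradiction p ¬p) x) (≃-sym (zeroˡ x))

  X-coeff : ∀ d → X κ (+ d) ≡ walks n (𝟘 n) d
  X-coeff d = trans (∑-filter (highestWeight? κ) (words (alphabet n) n) (λ b → q^ (+ energy b)) (λ w → qp (energy w)) d (λ w → qp-coeff (energy w) d))
    (≃⇒≡ (sumL-cong (words (alphabet n) n) λ w → when-valid (𝟘 n) w (qp (energy w))) d)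

  X-closed : walks n (𝟘 n) ≃ pochhammer n * (C′z (+ n ℤ.- sum κ) * D (κ ⊕ ρ n))
  X-closed = ≃-trans (walks-ℓ n (𝟘 n) (𝟘-partition n)) (*-congˡ (begin
    ℓ n (𝟘 n ⊕ ρ n) (κ ⊕ ρ n)
      ≈⟨ ≃-reflexive (cong (λ β → ℓ n β (κ ⊕ ρ n)) (𝟘⊕ (ρ n))) ⟩
    ℓ n (ρ n) (κ ⊕ ρ n)
      ≈⟨ ℓ-history-comm n 0 (ρ n) (κ ⊕ ρ n) ⟩
    ℓ n (κ ⊕ ρ n) (ρ n)
      ≈⟨ ℓ-closed n n ℕ.≤-refl ℕ.≤-refl κ κ-partition ⟩
    C′z (+ n ℤ.- size (κ ⊕ ρ n)) * D (κ ⊕ ρ n)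
      ≈⟨ *-congʳ (≃-reflexive (cong (λ z → C′z (+ n ℤ.- z)) (size-⊕ρ κ))) ⟩
    C′z (+ n ℤ.- sum κ) * D (κ ⊕ ρ n) ∎))
    where
    𝟘-partition : ∀ n → IsPartition (𝟘 n)
    𝟘-partition zero          = [] , []
    𝟘-partition (suc zero)    = [-] , ℤ.≤-refl ∷ []
    𝟘-partition (suc (suc n)) with 𝟘-partition (suc n)
    ... | l , ps = ℤ.≤-refl ∷ l , ℤ.≤-refl ∷ ps

  U-closed : Û (κ ⊕ ρ n) ≃ pochhammer n * (Cz (+ n ℤ.- sum κ) * D (κ ⊕ ρ n))
  U-closed = ≃-trans (Û-closed n (κ ⊕ ρ n) (StrictPos-⊕ρ κ κ-partition)) (*-congˡ (*-congʳ (≃-reflexive (cong Cz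
    (trans (cong (λ z → + n ℤ.+ sum (ρ n) ℤ.- z) (sum-⊕ κ (ρ n)))
      (IntSolver.solve 3 (λ n r k → n ⊞ r ⊟ (k ⊞ r) ⊜ n ⊟ k) refl (+ n) (sum (ρ n)) (sum κ)))))))

  X-negative : ∀ d → X κ -[1+ d ] ≡ 0ℤ
  X-negative d = ∑-zero (E κ) (λ b → q^ (+ energy b)) -[1+ d ] λ _ → refl

  X-vanishes : ∀ {k} → + n ℤ.- sum κ ≡ -[1+ k ] → ∀ d → X κ d ≡ 0ℤ
  X-vanishes e -[1+ d ] = X-negative d
  X-vanishes e (+ d)    = trans (X-coeff d) (trans (≃⇒≡ (≃-trans X-closed
    (annihilateʳ (annihilateˡ (≃-reflexive (cong C′z e))))) d) (const-zero d))

  U-vanishes : ∀ {k} → + n ℤ.- sum κ ≡ -[1+ k ] → Û (κ ⊕ ρ n) ≃ 0#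
  U-vanishes e = ≃-trans U-closed (annihilateʳ (annihilateˡ (≃-reflexive (cong Cz e))))

  U≃q*X : ∀ {Θ} → + n ℤ.- sum κ ≡ + Θ → Û (κ ⊕ ρ n) ≃ qp Θ * walks n (𝟘 n)
  U≃q*X {Θ} e = begin
    Û (κ ⊕ ρ n)
      ≈⟨ U-closed ⟩
    pochhammer n * (Cz (+ n ℤ.- sum κ) * D (κ ⊕ ρ n))
      ≈⟨ *-congˡ (*-congʳ (≃-trans (≃-reflexive (cong Cz e)) (≃-trans (C≃q*C′ Θ) (*-congˡ (≃-reflexive (sym (cong C′z e))))))) ⟩
    pochhammer n * (qp Θ * C′z (+ n ℤ.- sum κ) * D (κ ⊕ ρ n))
      ≈⟨ solve 4 (λ p q c d → p :* (q :* c :* d) := q :* (p :* (c :* d))) ≃-refl (pochhammer n) (qp Θ) (C′z (+ n ℤ.- sum κ)) (D (κ ⊕ ρ n)) ⟩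
    qp Θ * (pochhammer n * (C′z (+ n ℤ.- sum κ) * D (κ ⊕ ρ n)))
      ≈⟨ *-congˡ (≃-sym X-closed) ⟩
    qp Θ * walks n (𝟘 n) ∎

qp-shift : ∀ Θ f (g : Laurent) → (∀ d → g (+ d) ≡ f d) → (∀ d → g -[1+ d ] ≡ 0ℤ) →
           ∀ d → (qp Θ * f) d ≡ g (+ d ℤ.- + Θ)
qp-shift zero f g p r d = trans (≃⇒≡ (*-identityˡ f) d) (trans (sym (p d)) (cong g (sym (ℤ.+-identityʳ (+ d)))))
qp-shift (suc Θ) f g p r zero = trans (≃⇒≡ (*-assoc q (qp Θ) f) 0) (trans (q*-zero (qp Θ * f)) (sym (r Θ)))
qp-shift (suc Θ) f g p r (suc d) = trans (≃⇒≡ (*-assoc q (qp Θ) f) (suc d)) (trans (q*-suc (qp Θ * f) d)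
  (trans (qp-shift Θ f g p r d) (cong g (trans (ℤ.m-n≡m⊖n d Θ) (sym (ℤ.[1+m]⊖[1+n]≡m⊖n d Θ))))))


mainTheorem13 : (n : ℕ) → n ≥ 1 → (κ : Weight n) → IsPartition κ →
    U κ (𝟙 n) ≈ q^ (+ n ℤ.- ∣ κ ∣ʷ) ⊛ X κ
mainTheorem13 n _ κ p d = by-degree (+ n ℤ.- ∣ κ ∣ʷ) refl d
  where
  by-degree : ∀ z → + n ℤ.- ∣ κ ∣ʷ ≡ z → ∀ d → U κ (𝟙 n) d ≡ X κ (d ℤ.- z)
  by-degree (+ Θ) e (+ d) = trans (U-coeff κ d) (trans (≃⇒≡ (U≃q*X κ p e) d)
    (qp-shift Θ (walks n (𝟘 n)) (X κ) (X-coeff κ p) (X-negative κ p) d))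
    where open Walks κ p
  by-degree (+ zero) e -[1+ d ] = trans (U-negative κ d) (sym (X-negative κ p d))
  by-degree (+ suc Θ) e -[1+ d ] = trans (U-negative κ d) (sym (X-negative κ p (d ℕ.+ suc Θ)))
  -- Here |λ| > n: C and C′ have a negative index, so both U and X are zero.
  by-degree -[1+ k ] e (+ d) = trans (U-coeff κ d) (trans (trans (≃⇒≡ (U-vanishes κ p e) d) (const-zero d)) (sym (X-vanishes κ p e (+ d ℤ.- -[1+ k ]))))
  by-degree -[1+ k ] e -[1+ d ] = trans (U-negative κ d) (sym (X-vanishes κ p e (-[1+ d ] ℤ.- -[1+ k ])))
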